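{- Let $\mathcal{M}$ be a positroid of rank $d$ on $[n]$ without loops or coloops, and let $\pi$ be its associated (fixed-point-free) decorated permutation. Then the independent set polytope $P_{\mathcal{M}}\subset\mathbb{R}^n$ is exactly the set of points $x\in\mathbb{R}^n$ satisfying the inequalities $x_i\ge 0$ for each $i\in[n]$ and the inequalities $$\sum_{l\in E}x_l\le d-\operatorname{ccw}(E^c)$$ for all nonempty subsets $E\subseteq[n]$ whose complement $E^c=[n]\setminus E$ is covered by CCW-arrows of $\pi$.
   Context: A positroid of rank $d$ on $[n]=\{1,\dots,n\}$ is a matroid whose bases are the column sets of the nonzero maximal minors of some real $d\times n$ matrix of rank $d$ all of whose maximal minors are nonnegative. The cyclically shifted order $<_i$ on $[n]$ is $i<_i i+1<_i\cdots<_i n<_i 1<_i\cdots<_i i-1$. For $a,b\in[n]$ the cyclic interval is $[a,b]=\{x\in[n]: x\le_a b\}$ (nonempty; $[a,a-1]=[n]$, indices mod $n$). Decorated permutation of a loopless and coloopless positroid $\mathcal{M}$ with rank function $\operatorname{rk}$: it is the permutation $\pi$ of $[n]$ (without fixed points) for which $\pi(i)$ is the first element $j$ in the list $i+1,i+2,\dots,i-1$ (cyclically) such that $\operatorname{rk}(\{i,i+1,\dots,j\})=\operatorname{rk}(\{i+1,\dots,j\})$. A CCW-arrow of $\pi$ is a cyclic interval of the form $[x,\pi^{ -1}(x)]$, one for each $x\in[n]$. For $S\subseteq[n]$, $\operatorname{ccw}(S)$ is the number of $x\in[n]$ with $[x,\pi^{ -1}(x)]\subseteq S$. A set $S\subseteq[n]$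 is covered by CCW-arrows of $\pi$ if each element of $S$ is contained in some CCW-arrow of $\pi$ that is itself contained in $S$ (vacuously true for $S=\emptyset$). The independent set polytope is $P_{\mathcal{M}}=\operatorname{conv}\{e_I : I \text{ an independent set of }\mathcal{M}\}$ with $e_I=\sum_{i\in I}e_i$, where $e_1,\dots,e_n$ is the standard basis of $\mathbb{R}^n$. -}

module Defs where

open import Algebra.Bundles using (CommutativeRing)
open import Data.Bool.Base using (if_then_else_)
open import Data.Fin.Base as Fin using (Fin; zero; suc; toℕ; punchIn)
import Data.Fin.Properties as Finₚ
open import Data.Fin.Permutation using (Permutation′; _⟨$⟩ʳ_; _⟨$⟩ˡ_)
open import Data.Fin.Subset
  using (Subset; inside; outside; _∈_; _∉_; _⊆_; _∪_; _-_; ⁅_⁆; ∣_∣)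
open import Data.Fin.Subset.Properties using (_∈?_; _⊆?_; anySubset?)
open import Data.List.Base as List using (List; _++_; filter)
open import Data.List.Extrema.Nat using (max)
open import Data.Nat.Base as ℕ using (ℕ; zero; suc)
open import Data.Product.Base using (∃; Σ-syntax; ∃-syntax; _×_)
open import Data.Sum.Base using (_⊎_)
open import Data.Vec.Base using ([]; _∷_; tabulate)
open import Data.Vec.Functional using (Vector)
open import Function.Bundles using (_⇔_)
open import Level using (Level; 0ℓ; _⊔_) renaming (suc to lsuc)
open import Relation.Binary.Core using (Rel)
open import Relation.Binary.PropositionalEquality.Core using (_≡_; _≢_)
open import Relation.Binary.Structures using (IsDecTotalOrder)
open import Relation.Nullary using (¬_; Dec; does)
open import Relation.Nullary.Decidable using (_×-dec_; _⊎-dec_)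
open import Relation.Unary using (Pred; Decidable)
import Algebra.Definitions.RawMonoid as RawMonoidDefs

-- The standard library has no real numbers, so ℝ is given by its
-- (categorical) axioms: a Dedekind-complete ordered field. The order is
-- the classical one, i.e. total and decidable.

record RealField (c ℓ : Level) : Set (lsuc (c ⊔ ℓ)) where
  infix 4 _≤_
  field
    commutativeRing : CommutativeRing c ℓ
  open CommutativeRing commutativeRing public
  field
    _≤_             : Rel Carrier ℓ
    isDecTotalOrder : IsDecTotalOrder _≈_ _≤_
    1≉0             : ¬ 1# ≈ 0#
    inverse         : ∀ x → ¬ x ≈ 0# → ∃[ y ] x * y ≈ 1#
    +-mono-≤        : ∀ x y z → x ≤ y → x + z ≤ y + z
    *-nonneg        : ∀ x y → 0# ≤ x → 0# ≤ y → 0# ≤ x * y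

  UpperBound : Pred Carrier (c ⊔ ℓ) → Carrier → Set (c ⊔ ℓ)
  UpperBound P u = ∀ x → P x → x ≤ u

  field
    complete : ∀ (P : Pred Carrier (c ⊔ ℓ)) → ∃ P → ∃ (UpperBound P) →
               ∃[ s ] UpperBound P s × (∀ u → UpperBound P u → s ≤ u)

  open RawMonoidDefs +-rawMonoid public using (sum)
  open RawMonoidDefs +-rawMonoid using () renaming (_×_ to _·_)

  fromℕ : ℕ → Carrier
  fromℕ k = k · 1#

record Matroid (n : ℕ) : Set₁ where
  field
    Basis    : Pred (Subset n) 0ℓ
    basis?   : Decidable Basis
    nonempty : ∃ Basis
    exchange : ∀ {A B} → Basis A → Basis B → ∀ {x} → x ∈ A → x ∉ B →
               ∃[ y ] y ∈ B × y ∉ A × Basis ((A - x) ∪ ⁅ y ⁆)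

  Independent : Pred (Subset n) 0ℓ
  Independent I = ∃[ B ] Basis B × I ⊆ B

  independent? : Decidable Independent
  independent? I = anySubset? (λ B → basis? B ×-dec I ⊆? B)

  Loop : Pred (Fin n) 0ℓ
  Loop x = ∀ B → Basis B → x ∉ B

  Coloop : Pred (Fin n) 0ℓ
  Coloop x = ∀ B → Basis B → x ∈ B

subsets : ∀ n → List (Subset n)
subsets zero    = List.[ [] ]
subsets (suc n) = List.map (inside ∷_) (subsets n) ++
                  List.map (outside ∷_) (subsets n)

module _ {n : ℕ} (M : Matroid n) where
  open Matroid M

  rk : Subset n → ℕ
  rk S = max 0 (List.map ∣_∣
    (filter (λ I → independent? I ×-dec I ⊆? S) (subsets n)))

module _ {c ℓ : Level} (R : RealField c ℓ) where
  open RealField R hiding (zero)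

  Matrix : ℕ → ℕ → Set c
  Matrix d n = Fin d → Fin n → Carrier

  -- v₀ - v₁ + v₂ - ⋯
  altSum : ∀ {n} → Vector Carrier n → Carrier
  altSum {zero}  v = 0#
  altSum {suc n} v = v zero + - altSum (λ i → v (suc i))

  det : ∀ {d} → Matrix d d → Carrier
  det {zero}  A = 1#
  det {suc d} A =
    altSum (λ j → A zero j * det (λ i k → A (suc i) (punchIn j k)))

  minor : ∀ {d n} → Matrix d n → (Fin d → Fin n) → Carrier
  minor A f = det (λ i k → A i (f k))

  StrictlyIncreasing : ∀ {d n} → (Fin d → Fin n) → Set
  StrictlyIncreasing f = ∀ {i j} → i Fin.< j → f i Fin.< f j

  IsImage : ∀ {d n} → (Fin d → Fin n) → Subset n → Set
  IsImage f B = ∀ x → (x ∈ B) ⇔ (∃[ k ] f k ≡ x)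

  -- For a d × n matrix, having rank d means having independent rows.
  HasFullRowRank : ∀ {d n} → Matrix d n → Set (c ⊔ ℓ)
  HasFullRowRank {d} A = (a : Fin d → Carrier) →
    (∀ j → sum (λ i → a i * A i j) ≈ 0#) → ∀ i → a i ≈ 0#

  record IsPositroid {n : ℕ} (d : ℕ) (M : Matroid n) : Set (c ⊔ ℓ) where
    field
      matrix        : Matrix d n
      fullRowRank   : HasFullRowRank matrix
      minors-nonneg : ∀ f → StrictlyIncreasing f → 0# ≤ minor matrix f
      basis⇔minor≉0 : ∀ B → Matroid.Basis M B ⇔
        (Σ[ f ∈ (Fin d → Fin n) ]
          StrictlyIncreasing f × IsImage f B × ¬ minor matrix f ≈ 0#)

module _ {n : ℕ} where

  -- x ≤[ a ] y : x is weakly before y in the list a, a+1, …, n, 1, …, a-1.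
  infix 4 _≤[_]_ _≤[_]?_ _<[_]_
  _≤[_]_ : Fin n → Fin n → Fin n → Set
  x ≤[ a ] y = (a Fin.≤ x × x Fin.≤ y)
             ⊎ (x Fin.≤ y × y Fin.< a)
             ⊎ (a Fin.≤ x × y Fin.< a)

  _≤[_]?_ : ∀ x a y → Dec (x ≤[ a ] y)
  x ≤[ a ]? y = (a Finₚ.≤? x ×-dec x Finₚ.≤? y)
         ⊎-dec (x Finₚ.≤? y ×-dec y Finₚ.<? a)
         ⊎-dec (a Finₚ.≤? x ×-dec y Finₚ.<? a)

  _<[_]_ : Fin n → Fin n → Fin n → Set
  x <[ a ] y = x ≤[ a ] y × x ≢ y

  [_⋯_] : Fin n → Fin n → Subset n
  [ a ⋯ b ] = tabulate (λ x → does (x ≤[ a ]? b))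

-- For j ≢ i the set {i+1, …, j} is [ i ⋯ j ] - i, and the list
-- i+1, …, i-1 consists of the j ≢ i in the order <[ i ].
module _ {n : ℕ} (M : Matroid n) where

  Closes : Fin n → Fin n → Set
  Closes i j = j ≢ i × rk M [ i ⋯ j ] ≡ rk M ([ i ⋯ j ] - i)

  IsDecoratedPermutation : Permutation′ n → Set
  IsDecoratedPermutation π = ∀ i →
    Closes i (π ⟨$⟩ʳ i) × (∀ j → j <[ i ] (π ⟨$⟩ʳ i) → ¬ Closes i j)

module _ {n : ℕ} (π : Permutation′ n) where

  ccwArrow : Fin n → Subset n
  ccwArrow x = [ x ⋯ π ⟨$⟩ˡ x ]

  ccw : Subset n → ℕ
  ccw S = ∣ tabulate (λ x → does (ccwArrow x ⊆? S)) ∣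

  CoveredByCCWArrows : Subset n → Set
  CoveredByCCWArrows S = ∀ x → x ∈ S → ∃[ y ] x ∈ ccwArrow y × ccwArrow y ⊆ S

module _ {c ℓ : Level} (R : RealField c ℓ) where
  open RealField R hiding (zero)

  indicator : ∀ {n} → Subset n → Vector Carrier n
  indicator S i = if does (i ∈? S) then 1# else 0#

  sumOver : ∀ {n} → Subset n → Vector Carrier n → Carrier
  sumOver E x = sum (λ l → if does (l ∈? E) then x l else 0#)

  Conv : ∀ {n p} → Pred (Vector Carrier n) p → Pred (Vector Carrier n) (c ⊔ ℓ ⊔ p)
  Conv {n} X x =
    Σ[ m ∈ ℕ ] Σ[ w ∈ (Fin m → Carrier) ] Σ[ v ∈ (Fin m → Vector Carrier n) ]
      (∀ k → 0# ≤ w k) × sum w ≈ 1# × (∀ k → X (v k)) ×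
      (∀ i → x i ≈ sum (λ k → w k * v k i))

  IndependentSetPolytope : ∀ {n} → Matroid n → Pred (Vector Carrier n) (c ⊔ ℓ)
  IndependentSetPolytope M = Conv λ p →
    ∃[ I ] Matroid.Independent M I × (∀ i → p i ≈ indicator I i)

{-# OPTIONS --safe #-}

-- Both directions compare the rank of E with the number of CCW-arrows in its complement. Fix e ∈ E and add the
-- remaining elements to E in the reverse of the cyclic order from e. If the arrow ending at i lies in the
-- complement of E, then everything present when i is added lies strictly between i and π(i), so i raises the
-- rank; hence rk E + ccw(Eᶜ) ≤ d, in any matroid. If E is connected, the converse holds: an element i that raises
-- the rank although its arrow meets E yields a j such that i and j separate E cyclically in two parts and are
-- parallel modulo a flat through E. A dependency of E across the two parts then contradicts the three-term
-- Plücker relation p_{ac} p_{ij} = p_{ai} p_{cj} + p_{aj} p_{ci} between nonnegative minors. So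
-- rk E = d − ccw(Eᶜ) for connected flats E, whose complements are therefore covered by arrows, and the rank
-- inequalities of the connected flats imply all others. Edmonds' theorem finishes the proof: a point satisfying
-- the rank inequalities that is not a vertex can be moved both ways along some e_i or e_i − e_j without
-- leaving its tight constraints, by submodularity.

module Submission where

open import Defs
import Algebra.Properties.CommutativeMonoid.Sum as CommutativeMonoidSum
import Algebra.Properties.Ring as RingProperties
import Algebra.Properties.Semiring.Sum as SemiringSum
open import Data.Bool.Base using (Bool; true; false; if_then_else_)
import Data.Empty
open import Data.Fin.Base as Fin using (Fin; zero; suc; toℕ; punchIn)
open import Data.Fin.Permutation using (Permutation′; _⟨$⟩ʳ_; inverseˡ)
import Data.Fin.Properties as Finₚ
open import Data.Fin.Subset renaming (_-_ to _∖_)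
open import Data.Fin.Subset.Properties
import Data.List.Base as List
import Data.List.Extrema as Extrema
open import Data.List.Extrema.Nat using (argmax-sel; xs≤max)
open import Data.List.Membership.Propositional using () renaming (_∈_ to _∈ˡ_)
open import Data.List.Membership.Propositional.Properties
  using (∈-map⁺; ∈-map⁻; ∈-++⁺ˡ; ∈-++⁺ʳ; ∈-filter⁺; ∈-filter⁻; ∈-allFin)
import Data.List.Relation.Unary.All as All
import Data.List.Relation.Unary.Any as Any
open import Data.Nat.Base as ℕ using (ℕ; zero; suc)
import Data.Nat.Properties as ℕₚ
open import Algebra.Properties.CommutativeMonoid.Sum ℕₚ.+-0-commutativeMonoid using (sum-permute) renaming (sum to ∑)
open import Data.Product.Base using (∃; ∃-syntax; Σ-syntax; _×_; _,_; proj₁; proj₂)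
open import Data.Sum.Base using (_⊎_; inj₁; inj₂; [_,_]′)
open import Data.Vec.Base using ([]; _∷_; here; there; tabulate)
open import Data.Vec.Functional using (Vector) renaming (_∷_ to _◂_)
import Data.Vec.Properties as Vecₚ
open import Function.Base using (_∘_; id)
open import Function.Bundles using (_⇔_; mk⇔; Equivalence)
open import Level using (Level; _⊔_)
open import Relation.Binary.Bundles using (TotalOrder)
open import Relation.Binary.Core using (Rel)
open import Relation.Binary.Definitions using (tri<; tri≈; tri>)
open import Relation.Binary.PropositionalEquality as ≡ using (_≡_; _≢_; refl; _≗_)
import Relation.Binary.Reasoning.Setoid as SetoidReasoning
open import Relation.Binary.Structures using (IsDecTotalOrder)
open import Relation.Nullary using (¬_; Dec; yes; no; does; contradiction)
open import Relation.Nullary.Decidable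
  using (_×-dec_; _⊎-dec_; ¬?; map′; decidable-stable; dec-true; dec-false)
open import Relation.Unary using (Pred; Decidable)

-- Why a dependency across the separation is absurd: let `B` be a basis of `E`, let `c` in `E₂` make
-- `B ∪ ⁅ c ⁆` dependent, and let `a` in `B` and `E₁` be missing from some basis `J` of `E` inside
-- `B ∪ ⁅ c ⁆`. Extend `B` to a basis of the flat-like set `G`, add `i`, extend to a basis of the
-- matroid, and take `a` and `i` out again; call the rest `K`. Over `K`, the element `c` does the
-- work of `a` (through `E`), and the partner `i′` of `i` does the work of `i` (through `G`), so
-- `pair K a i` and `pair K c i′` are both bases. Since `a`, `i`, `c`, `i′` lie in this cyclic
-- order, these are opposite sides of a quadrilateral, and a nonzero product of opposite sides
-- forces a nonzero product of diagonals. Then `pair K a c` is a basis, yet it contains `B ∪ ⁅ c ⁆`.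
-- The obstacle is signs. Nonnegativity concerns minors with increasing columns, while the relation
-- is proved for columns in any order, two of them in front of `K`. Hence the sorted insertion, its
-- sign, and a case split over rotations.

insert : ∀ {m n} → Fin n → (Fin m → Fin n) → Fin (suc m) → Fin n
insert {zero}  u g = u ◂ g
insert {suc m} u g with u Finₚ.<? g zero
... | yes _ = u ◂ g
... | no  _ = g zero ◂ insert u (g ∘ suc)

-- Arithmetic in an ordered field

module OrderedField {c ℓ : Level} (R : RealField c ℓ) where
  open RealField R hiding (zero; refl; sym; trans)
  open RealField R using () renaming (refl to ≈-refl; sym to ≈-sym; trans to ≈-trans)
  open IsDecTotalOrder isDecTotalOrder public
    using (total; _≟_; _≤?_) renaming (reflexive to ≤-reflexive; trans to ≤-trans; antisym to ≤-antisym)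
  open RingProperties ring

  ≤-refl : ∀ {x} → x ≤ x
  ≤-refl = ≤-reflexive ≈-refl

  ≤-resp : ∀ {x x′ y y′} → x ≈ x′ → y ≈ y′ → x ≤ y → x′ ≤ y′
  ≤-resp p q h = ≤-trans (≤-reflexive (≈-sym p)) (≤-trans h (≤-reflexive q))

  +-mono : ∀ {x y u v} → x ≤ y → u ≤ v → x + u ≤ y + v
  +-mono {x} {y} {u} {v} p q = ≤-trans (+-mono-≤ x y u p)
    (≤-resp (+-comm u y) (+-comm v y) (+-mono-≤ u v y q))

  +-cancelʳ-≤ : ∀ z {x y} → x + z ≤ y + z → x ≤ y
  +-cancelʳ-≤ z {x} {y} h = ≤-resp (undo x) (undo y) (+-mono-≤ (x + z) (y + z) (- z) h)
    where
    undo : ∀ x → (x + z) + - z ≈ x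
    undo x = ≈-trans (+-assoc x z (- z)) (≈-trans (+-congˡ (-‿inverseʳ z)) (+-identityʳ x))

  +-nonneg : ∀ {x y} → 0# ≤ x → 0# ≤ y → 0# ≤ x + y
  +-nonneg p q = ≤-resp (+-identityˡ 0#) ≈-refl (+-mono p q)

  neg-antimono : ∀ {x y} → x ≤ y → - y ≤ - x
  neg-antimono {x} {y} h = +-cancelʳ-≤ (x + y)
    (≤-resp
      (≈-sym (≈-trans (+-congˡ (+-comm x y)) (≈-trans (≈-sym (+-assoc (- y) y x))
        (≈-trans (+-congʳ (-‿inverseˡ y)) (+-identityˡ x)))))
      (≈-sym (≈-trans (≈-sym (+-assoc (- x) x y))
        (≈-trans (+-congʳ (-‿inverseˡ x)) (+-identityˡ y))))
      h)

  -- The order stands in for division by 2: negation reverses it, so `x` and `- x` can agree only at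
  -- zero.
  x≈-x⇒x≈0 : ∀ {x} → x ≈ - x → x ≈ 0#
  x≈-x⇒x≈0 {x} e with total 0# x
  ... | inj₁ p = ≤-antisym (≤-resp (≈-sym e) -0#≈0# (neg-antimono p)) p
  ... | inj₂ p = ≤-antisym p (≤-resp -0#≈0# (≈-sym e) (neg-antimono p))

  nonneg-sum≈0 : ∀ {x y} → 0# ≤ x → 0# ≤ y → x + y ≈ 0# → x ≈ 0#
  nonneg-sum≈0 {x} {y} p q e = ≤-antisym
    (≤-resp (+-identityʳ x) e (+-mono ≤-refl q)) p

  x*y≈0⇒y≈0 : ∀ {x y} → ¬ x ≈ 0# → x * y ≈ 0# → y ≈ 0#
  x*y≈0⇒y≈0 {x} {y} x≉0 e with inverse x x≉0
  ... | x⁻¹ , xx⁻¹ = ≈-trans (≈-sym (*-identityˡ y)) (≈-trans (*-congʳ (≈-sym (≈-trans (*-comm x⁻¹ x) xx⁻¹)))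
    (≈-trans (*-assoc x⁻¹ x y) (≈-trans (*-congˡ e) (zeroʳ x⁻¹))))

-- Minors and the three-term Plücker relation

module Determinant {c ℓ : Level} (R : RealField c ℓ) where
  open RealField R hiding (zero; refl; sym; trans)
  open RealField R using () renaming (refl to ≈-refl; sym to ≈-sym; trans to ≈-trans)
  open RingProperties ring
  open OrderedField R using (x≈-x⇒x≈0; nonneg-sum≈0; x*y≈0⇒y≈0)
  open SetoidReasoning setoid

  *-swapˡ : ∀ x y z → x * (y * z) ≈ y * (x * z)
  *-swapˡ x y z = ≈-trans (≈-sym (*-assoc x y z))
    (≈-trans (*-congʳ (*-comm x y)) (*-assoc y x z))

  altSum-cong : ∀ {n} (v w : Vector Carrier n) → (∀ i → v i ≈ w i) → altSum R v ≈ altSum R w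
  altSum-cong {zero}  v w e = ≈-refl
  altSum-cong {suc n} v w e = +-cong (e zero) (-‿cong (altSum-cong (v ∘ suc) (w ∘ suc) (e ∘ suc)))

  altSum-0 : ∀ {n} (v : Vector Carrier n) → (∀ i → v i ≈ 0#) → altSum R v ≈ 0#
  altSum-0 {zero}  v e = ≈-refl
  altSum-0 {suc n} v e = ≈-trans (+-cong (e zero) (-‿cong (altSum-0 (v ∘ suc) (e ∘ suc)))) (-‿inverseʳ 0#)

  interchange : ∀ a b c d → (a + b) + - (c + d) ≈ (a + - c) + (b + - d)
  interchange a b c d = begin
    (a + b) + - (c + d)     ≈⟨ +-congˡ (-‿+-comm c d) ⟨
    (a + b) + (- c + - d)   ≈⟨ +-assoc a b _ ⟩
    a + (b + (- c + - d))   ≈⟨ +-congˡ (+-assoc b (- c) (- d)) ⟨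
    a + ((b + - c) + - d)   ≈⟨ +-congˡ (+-congʳ (+-comm b (- c))) ⟩
    a + ((- c + b) + - d)   ≈⟨ +-congˡ (+-assoc (- c) b (- d)) ⟩
    a + (- c + (b + - d))   ≈⟨ +-assoc a (- c) _ ⟨
    (a + - c) + (b + - d)   ∎

  altSum-+ : ∀ {n} (v w : Vector Carrier n) →
             altSum R (λ i → v i + w i) ≈ altSum R v + altSum R w
  altSum-+ {zero}  v w = ≈-sym (+-identityˡ 0#)
  altSum-+ {suc n} v w = ≈-trans (+-congˡ (-‿cong (altSum-+ (v ∘ suc) (w ∘ suc))))
    (interchange _ _ _ _)

  altSum-neg : ∀ {n} (v : Vector Carrier n) → altSum R (λ i → - v i) ≈ - altSum R v
  altSum-neg {zero}  v = ≈-sym -0#≈0#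
  altSum-neg {suc n} v = ≈-trans (+-congˡ (-‿cong (altSum-neg (v ∘ suc)))) (-‿+-comm _ _)

  *-altSum : ∀ {n} a (v : Vector Carrier n) → altSum R (λ i → a * v i) ≈ a * altSum R v
  *-altSum {zero}  a v = ≈-sym (zeroʳ a)
  *-altSum {suc n} a v = begin
    a * v zero + - altSum R (λ i → a * v (suc i)) ≈⟨ +-congˡ (-‿cong (*-altSum a (v ∘ suc))) ⟩
    a * v zero + - (a * altSum R (v ∘ suc))       ≈⟨ +-congˡ (-‿distribʳ-* a _) ⟩
    a * v zero + a * - altSum R (v ∘ suc)         ≈⟨ distribˡ a _ _ ⟨
    a * (v zero + - altSum R (v ∘ suc))           ∎

  altSum-comm : ∀ {m n} (f : Fin m → Fin n → Carrier) →
    altSum R (λ i → altSum R (f i)) ≈ altSum R (λ j → altSum R (λ i → f i j))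
  altSum-comm {zero} {n} f = ≈-sym (altSum-0 {n} (λ _ → 0#) (λ _ → ≈-refl))
  altSum-comm {suc m} f = begin
    altSum R (f zero) + - altSum R (λ i → altSum R (f (suc i)))
      ≈⟨ +-congˡ (-‿cong (altSum-comm (f ∘ suc))) ⟩
    altSum R (f zero) + - altSum R (λ j → altSum R (λ i → f (suc i) j))
      ≈⟨ +-congˡ (altSum-neg (λ j → altSum R (λ i → f (suc i) j))) ⟨
    altSum R (f zero) + altSum R (λ j → - altSum R (λ i → f (suc i) j))
      ≈⟨ altSum-+ (f zero) (λ j → - altSum R (λ i → f (suc i) j)) ⟨
    altSum R (λ j → altSum R (λ i → f i j)) ∎

  det-cong : ∀ {d} {A B : Matrix R d d} → (∀ i j → A i j ≈ B i j) → det R A ≈ det R B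
  det-cong {zero}  e = ≈-refl
  det-cong {suc d} {A} {B} e = altSum-cong
    (λ j → A zero j * det R (λ i k → A (suc i) (punchIn j k)))
    (λ j → B zero j * det R (λ i k → B (suc i) (punchIn j k)))
    λ j → *-cong (e zero j) (det-cong λ i k → e (suc i) (punchIn j k))

  -- Both expansions share the term of the corner entry. The remaining terms of either one form a
  -- double alternating sum over the rest of the first row and the rest of the first column, and the
  -- order of summation is immaterial.
  det-expandColumn : ∀ {d} (A : Matrix R (suc d) (suc d)) →
    det R A ≈ altSum R (λ i → A i zero * det R (λ k l → A (punchIn i k) (suc l)))
  det-expandColumn {zero}  A = ≈-refl
  det-expandColumn {suc d} A = +-congˡ (-‿cong (begin
    altSum R (λ j → A zero (suc j) * det R (λ i k → A (suc i) (punchIn (suc j) k)))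
      ≈⟨ altSum-cong
           (λ j → A zero (suc j) * det R (λ i k → A (suc i) (punchIn (suc j) k)))
           (λ j → altSum R (λ i → A zero (suc j) * (A (suc i) zero * m i j)))
           (λ j → ≈-trans (*-congˡ (det-expandColumn (λ i k → A (suc i) (punchIn (suc j) k))))
             (≈-sym (*-altSum (A zero (suc j)) (λ i → A (suc i) zero * m i j)))) ⟩
    altSum R (λ j → altSum R (λ i → A zero (suc j) * (A (suc i) zero * m i j)))
      ≈⟨ altSum-comm (λ j i → A zero (suc j) * (A (suc i) zero * m i j)) ⟩
    altSum R (λ i → altSum R (λ j → A zero (suc j) * (A (suc i) zero * m i j)))
      ≈⟨ altSum-cong
           (λ i → altSum R (λ j → A zero (suc j) * (A (suc i) zero * m i j)))
           (λ i → A (suc i) zero * altSum R (λ j → A zero (suc j) * m i j))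
           (λ i → ≈-trans (altSum-cong
             (λ j → A zero (suc j) * (A (suc i) zero * m i j))
             (λ j → A (suc i) zero * (A zero (suc j) * m i j))
             (λ j → *-swapˡ (A zero (suc j)) (A (suc i) zero) (m i j)))
             (*-altSum (A (suc i) zero) (λ j → A zero (suc j) * m i j))) ⟩
    altSum R (λ i → A (suc i) zero * altSum R (λ j → A zero (suc j) * m i j)) ∎))
    where
    m : Fin (suc d) → Fin (suc d) → Carrier
    m i j = det R (λ k l → A (suc (punchIn i k)) (suc (punchIn j l)))

  det-transpose : ∀ {d} (A : Matrix R d d) → det R A ≈ det R (λ i j → A j i)
  det-transpose {zero}  A = ≈-refl
  det-transpose {suc d} A = ≈-trans (det-expandColumn A)
    (altSum-cong
      (λ j → A j zero * det R (λ k l → A (punchIn j k) (suc l)))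
      (λ j → A j zero * det R (λ l k → A (punchIn j k) (suc l)))
      λ j → *-congˡ (det-transpose (λ k l → A (punchIn j k) (suc l))))

  minor-cong : ∀ {d n} (A : Matrix R d n) (f g : Fin d → Fin n) → f ≗ g →
               minor R A f ≈ minor R A g
  minor-cong A f g e = det-cong λ i k → reflexive (≡.cong (A i) (e k))

  minor-expandColumn : ∀ {d n} (A : Matrix R (suc d) n) (f : Fin (suc d) → Fin n) →
    minor R A f ≈ altSum R (λ i → A i (f zero) * minor R (A ∘ punchIn i) (f ∘ suc))
  minor-expandColumn A f = det-expandColumn (λ i k → A i (f k))

  -- Expansion along the column put in front involves only minors of the tail, in matrices with one
  -- row deleted; this is why the hypothesis ranges over all matrices. Together with `minor-swap` it
  -- reaches columns at any position.
  minor-scaleTail : ∀ {d n} s (f g : Fin d → Fin n) →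
    (∀ (A : Matrix R d n) → minor R A f ≈ s * minor R A g) →
    ∀ (A : Matrix R (suc d) n) u → minor R A (u ◂ f) ≈ s * minor R A (u ◂ g)
  minor-scaleTail s f g e A u = begin
    minor R A (u ◂ f)
      ≈⟨ minor-expandColumn A (u ◂ f) ⟩
    altSum R (λ i → A i u * minor R (A ∘ punchIn i) f)
      ≈⟨ altSum-cong
           (λ i → A i u * minor R (A ∘ punchIn i) f)
           (λ i → s * (A i u * minor R (A ∘ punchIn i) g))
           (λ i → ≈-trans (*-congˡ (e (A ∘ punchIn i))) (*-swapˡ (A i u) s _)) ⟩
    altSum R (λ i → s * (A i u * minor R (A ∘ punchIn i) g))
      ≈⟨ *-altSum s (λ i → A i u * minor R (A ∘ punchIn i) g) ⟩
    s * altSum R (λ i → A i u * minor R (A ∘ punchIn i) g)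
      ≈⟨ *-congˡ (minor-expandColumn A (u ◂ g)) ⟨
    s * minor R A (u ◂ g) ∎

  alternate-swap : ∀ a b c → a + - (b + - - c) ≈ - (b + - (a + - c))
  alternate-swap a b c = begin
    a + - (b + - - c)       ≈⟨ +-congˡ (-‿+-comm b (- - c)) ⟨
    a + (- b + - - - c)     ≈⟨ +-congˡ (+-congˡ (-‿involutive (- c))) ⟩
    a + (- b + - c)         ≈⟨ +-assoc a (- b) (- c) ⟨
    (a + - b) + - c         ≈⟨ +-congʳ (+-comm a (- b)) ⟩
    (- b + a) + - c         ≈⟨ +-assoc (- b) a (- c) ⟩
    - b + (a + - c)         ≈⟨ +-congˡ (-‿involutive _) ⟨
    - b + - - (a + - c)     ≈⟨ -‿+-comm b (- (a + - c)) ⟩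
    - (b + - (a + - c))     ∎

  -- In the expansion along the first row the terms of `u` and `v` trade places and signs. Every
  -- other term keeps both columns, so there the swap takes place in a smaller minor.
  minor-swap : ∀ {m n} (A : Matrix R (suc (suc m)) n) u v (g : Fin m → Fin n) →
    minor R A (u ◂ v ◂ g) ≈ - minor R A (v ◂ u ◂ g)
  minor-swap {m} {n} A u v g = begin
    A zero u * minor R (A ∘ suc) ((u ◂ v ◂ g) ∘ punchIn zero) +
      - (A zero v * minor R (A ∘ suc) ((u ◂ v ◂ g) ∘ punchIn (suc zero)) + - altSum R (term u v))
      ≈⟨ +-cong (*-congˡ (adjacent u v))
          (-‿cong (+-cong (*-congˡ (≈-sym (adjacent v u)))
            (-‿cong (≈-trans (altSum-cong (term u v) (λ j → - term v u j) term-swap)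
              (altSum-neg (term v u)))))) ⟩
    A zero u * minor R (A ∘ suc) ((v ◂ u ◂ g) ∘ punchIn (suc zero)) +
      - (A zero v * minor R (A ∘ suc) ((v ◂ u ◂ g) ∘ punchIn zero) + - - altSum R (term v u))
      ≈⟨ alternate-swap _ _ _ ⟩
    - minor R A (v ◂ u ◂ g) ∎
    where
    adjacent : ∀ u v → minor R (A ∘ suc) ((u ◂ v ◂ g) ∘ punchIn zero) ≈
                       minor R (A ∘ suc) ((v ◂ u ◂ g) ∘ punchIn (suc zero))
    adjacent u v = minor-cong (A ∘ suc)
      ((u ◂ v ◂ g) ∘ punchIn zero) ((v ◂ u ◂ g) ∘ punchIn (suc zero))
      λ { zero → refl ; (suc k) → refl }
    term : Fin n → Fin n → Fin m → Carrier
    term u v j = A zero (g j) * minor R (A ∘ suc) ((u ◂ v ◂ g) ∘ punchIn (suc (suc j)))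
    pull : ∀ {m} (g : Fin (suc m) → Fin n) j u v →
      (u ◂ v ◂ g) ∘ punchIn (suc (suc j)) ≗ (u ◂ v ◂ (g ∘ punchIn j))
    pull g j u v zero          = refl
    pull g j u v (suc zero)    = refl
    pull g j u v (suc (suc k)) = refl
    tail-swap : ∀ {m} (B : Matrix R (suc m) n) (g : Fin m → Fin n) (j : Fin m) →
      minor R B ((u ◂ v ◂ g) ∘ punchIn (suc (suc j))) ≈
      - minor R B ((v ◂ u ◂ g) ∘ punchIn (suc (suc j)))
    tail-swap {suc m} B g j = begin
      minor R B ((u ◂ v ◂ g) ∘ punchIn (suc (suc j)))
        ≈⟨ minor-cong B _ (u ◂ v ◂ (g ∘ punchIn j)) (pull g j u v) ⟩
      minor R B (u ◂ v ◂ (g ∘ punchIn j))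
        ≈⟨ minor-swap B u v (g ∘ punchIn j) ⟩
      - minor R B (v ◂ u ◂ (g ∘ punchIn j))
        ≈⟨ -‿cong (minor-cong B _ (v ◂ u ◂ (g ∘ punchIn j)) (pull g j v u)) ⟨
      - minor R B ((v ◂ u ◂ g) ∘ punchIn (suc (suc j))) ∎
    term-swap : ∀ j → term u v j ≈ - term v u j
    term-swap j = ≈-trans (*-congˡ (tail-swap (A ∘ suc) g j)) (≈-sym (-‿distribʳ-* _ _))

  -- Equal columns in the first two places make the minor its own negative. Otherwise swapping the
  -- first two columns leaves a repetition in the tail, which is shorter.
  minor-repeatedColumn : ∀ {d n} (A : Matrix R (suc d) n) (g : Fin d → Fin n) j →
                         minor R A (g j ◂ g) ≈ 0#
  minor-repeatedColumn {suc d} A g j = ≈-trans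
    (minor-cong A (g j ◂ g) (g j ◂ g zero ◂ (g ∘ suc))
      λ { zero → refl ; (suc zero) → refl ; (suc (suc k)) → refl })
    (helper j)
    where
    helper : ∀ j → minor R A (g j ◂ g zero ◂ (g ∘ suc)) ≈ 0#
    helper zero    = x≈-x⇒x≈0 (minor-swap A (g zero) (g zero) (g ∘ suc))
    helper (suc j) = begin
      minor R A (g (suc j) ◂ g zero ◂ (g ∘ suc))
        ≈⟨ minor-swap A (g (suc j)) (g zero) (g ∘ suc) ⟩
      - minor R A (g zero ◂ g (suc j) ◂ (g ∘ suc))
        ≈⟨ -‿cong (minor-scaleTail 0# (g (suc j) ◂ (g ∘ suc)) (g (suc j) ◂ (g ∘ suc))
             (λ B → ≈-trans (minor-repeatedColumn B (g ∘ suc) j) (≈-sym (zeroˡ _))) A (g zero)) ⟩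
      - (0# * minor R A (g zero ◂ g (suc j) ◂ (g ∘ suc)))
        ≈⟨ -‿cong (zeroˡ _) ⟩
      - 0#
        ≈⟨ -0#≈0# ⟩
      0# ∎

  -- Expanding the singular matrix (A i ◂ A) along its repeated first row.
  cramer : ∀ {d n} (A : Matrix R d n) (f : Fin (suc d) → Fin n) i →
           altSum R (λ j → A i (f j) * minor R A (f ∘ punchIn j)) ≈ 0#
  cramer {d} {n} A f i = ≈-trans (det-transpose (λ p k → (A i ◂ A) p (f k)))
    (≈-trans (det-cong {B = λ p k → Aᵀ p ((i ◂ id) k)} pointwise) (minor-repeatedColumn Aᵀ id i))
    where
    Aᵀ : Matrix R (suc d) d
    Aᵀ p k = A k (f p)
    pointwise : ∀ p k → (A i ◂ A) k (f p) ≈ Aᵀ p ((i ◂ id) k)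
    pointwise p zero    = ≈-refl
    pointwise p (suc k) = ≈-refl

  -- Pair the linear dependency that `cramer` gives for the columns `w`, `x`, `y`, `K` with the
  -- minor that has a variable first column followed by `z` and `K`: this minor is linear in that
  -- column, with cofactors `M`, so the alternating sum vanishes. The terms whose variable column
  -- comes from `K` repeat a column and drop out, which leaves three.
  plücker₃ : ∀ {m n} (A : Matrix R (suc (suc m)) n) (K : Fin m → Fin n) w x y z →
    minor R A (x ◂ y ◂ K) * minor R A (w ◂ z ◂ K) +
      - (minor R A (w ◂ y ◂ K) * minor R A (x ◂ z ◂ K) +
      - (minor R A (w ◂ x ◂ K) * minor R A (y ◂ z ◂ K))) ≈ 0#
  plücker₃ {m} {n} A K w x y z = begin
    minor R A (x ◂ y ◂ K) * minor R A (w ◂ z ◂ K) +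
      - (minor R A (w ◂ y ◂ K) * minor R A (x ◂ z ◂ K) +
      - (minor R A (w ◂ x ◂ K) * minor R A (y ◂ z ◂ K)))
      ≈⟨ +-cong (*-congʳ (minor-cong A (x ◂ y ◂ K) (f ∘ punchIn zero) λ { zero → refl ; (suc zero) → refl ; (suc (suc k)) → refl }))
         (-‿cong (+-cong (*-congʳ (minor-cong A (w ◂ y ◂ K) (f ∘ punchIn (suc zero)) λ { zero → refl ; (suc zero) → refl ; (suc (suc k)) → refl }))
         (-‿cong (≈-trans (≈-sym (+-identityʳ _)) (+-cong
           (*-congʳ (minor-cong A (w ◂ x ◂ K) (f ∘ punchIn (suc (suc zero))) λ { zero → refl ; (suc zero) → refl ; (suc (suc k)) → refl }))
           (≈-trans (≈-sym -0#≈0#) (-‿cong (≈-sym (altSum-0 _ tail≈0))))))))) ⟩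
    altSum R (λ j → D j * minor R A (f j ◂ z ◂ K))
      ≈⟨ altSum-cong
           (λ j → D j * minor R A (f j ◂ z ◂ K))
           (λ j → altSum R (λ i → M i * (A i (f j) * D j)))
           (λ j → ≈-trans (*-congˡ (minor-expandColumn A (f j ◂ z ◂ K)))
             (≈-trans (≈-sym (*-altSum (D j) (λ i → A i (f j) * M i)))
               (altSum-cong (λ i → D j * (A i (f j) * M i)) (λ i → M i * (A i (f j) * D j))
                 (λ i → reverse* (D j) (A i (f j)) (M i))))) ⟩
    altSum R (λ j → altSum R (λ i → M i * (A i (f j) * D j)))
      ≈⟨ altSum-comm (λ j i → M i * (A i (f j) * D j)) ⟩
    altSum R (λ i → altSum R (λ j → M i * (A i (f j) * D j)))
      ≈⟨ altSum-0 (λ i → altSum R (λ j → M i * (A i (f j) * D j)))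
           (λ i → ≈-trans (*-altSum (M i) (λ j → A i (f j) * D j))
             (≈-trans (*-congˡ (cramer A f i)) (zeroʳ (M i)))) ⟩
    0# ∎
    where
    f : Fin (suc (suc (suc m))) → Fin n
    f = w ◂ x ◂ y ◂ K
    D : Fin (suc (suc (suc m))) → Carrier
    D j = minor R A (f ∘ punchIn j)
    M : Fin (suc (suc m)) → Carrier
    M i = minor R (A ∘ punchIn i) (z ◂ K)
    reverse* : ∀ a b c → a * (b * c) ≈ c * (b * a)
    reverse* a b c = ≈-trans (*-congˡ (*-comm b c)) (≈-trans (*-swapˡ a c b) (*-congˡ (*-comm a b)))
    tail≈0 : ∀ j → D (suc (suc (suc j))) * minor R A (K j ◂ z ◂ K) ≈ 0#
    tail≈0 j = ≈-trans (*-congˡ (≈-trans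
      (minor-cong A (K j ◂ z ◂ K) ((z ◂ K) (suc j) ◂ z ◂ K) (λ { zero → refl ; (suc k) → refl }))
      (minor-repeatedColumn A (z ◂ K) (suc j)))) (zeroʳ _)

  -- The sign of the cycle that carries `u` from the front to its place in the sorted sequence: one
  -- factor of minus one for each entry it passes.
  insertSign : ∀ {m n} → Fin n → (Fin m → Fin n) → Carrier
  insertSign {zero}  u g = 1#
  insertSign {suc m} u g with u Finₚ.<? g zero
  ... | yes _ = 1#
  ... | no  _ = - insertSign u (g ∘ suc)

  minor-insert : ∀ {m n} (A : Matrix R (suc m) n) u (g : Fin m → Fin n) →
    minor R A (insert u g) ≈ insertSign u g * minor R A (u ◂ g)
  minor-insert {zero}  A u g = ≈-sym (*-identityˡ _)
  minor-insert {suc m} A u g with u Finₚ.<? g zero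
  ... | yes _ = ≈-sym (*-identityˡ _)
  ... | no  _ = begin
    minor R A (g zero ◂ insert u (g ∘ suc))
      ≈⟨ minor-scaleTail s _ (u ◂ (g ∘ suc)) (λ B → minor-insert B u (g ∘ suc)) A (g zero) ⟩
    s * minor R A (g zero ◂ u ◂ (g ∘ suc))
      ≈⟨ *-congˡ (minor-swap A (g zero) u (g ∘ suc)) ⟩
    s * - minor R A (u ◂ g zero ◂ (g ∘ suc))
      ≈⟨ *-congˡ (-‿cong (minor-cong A (u ◂ g zero ◂ (g ∘ suc)) (u ◂ g)
           λ { zero → refl ; (suc zero) → refl ; (suc (suc k)) → refl })) ⟩
    s * - minor R A (u ◂ g)
      ≈⟨ -‿distribʳ-* s _ ⟨
    - (s * minor R A (u ◂ g))
      ≈⟨ -‿distribˡ-* s _ ⟩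
    - s * minor R A (u ◂ g) ∎
    where s = insertSign u (g ∘ suc)

  -- The smaller `u` stops before it would meet `v`. Hence the sign of inserting two columns is a
  -- product of one factor per column, each depending on `K` alone.
  insertSign-insert : ∀ {m n} u v (g : Fin m → Fin n) → u Fin.< v →
    insertSign u (insert v g) ≈ insertSign u g
  insertSign-insert {zero} u v g u<v with u Finₚ.<? v
  ... | yes _  = ≈-refl
  ... | no u≮v = contradiction u<v u≮v
  insertSign-insert {suc m} u v g u<v with v Finₚ.<? g zero
  insertSign-insert {suc m} u v g u<v | yes v<g with u Finₚ.<? v | u Finₚ.<? g zero
  ... | yes _  | yes _  = ≈-refl
  ... | yes _  | no u≮g = contradiction (ℕₚ.<-trans u<v v<g) u≮g
  ... | no u≮v | _      = contradiction u<v u≮v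
  insertSign-insert {suc m} u v g u<v | no _ with u Finₚ.<? g zero
  ... | yes _ = ≈-refl
  ... | no  _ = -‿cong (insertSign-insert u v (g ∘ suc) u<v)

  minor-insert₂ : ∀ {m n} (A : Matrix R (suc (suc m)) n) {u v} (g : Fin m → Fin n) → u Fin.< v →
    minor R A (insert u (insert v g)) ≈
    (insertSign u g * insertSign v g) * minor R A (u ◂ v ◂ g)
  minor-insert₂ A {u} {v} g u<v = begin
    minor R A (insert u (insert v g))
      ≈⟨ minor-insert A u (insert v g) ⟩
    insertSign u (insert v g) * minor R A (u ◂ insert v g)
      ≈⟨ *-cong (insertSign-insert u v g u<v)
           (minor-scaleTail (insertSign v g) _ (v ◂ g) (λ B → minor-insert B v g) A u) ⟩
    insertSign u g * (insertSign v g * minor R A (u ◂ v ◂ g))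
      ≈⟨ *-assoc _ _ _ ⟨
    (insertSign u g * insertSign v g) * minor R A (u ◂ v ◂ g) ∎

  -- Each of the three products uses every one of `w`, `x`, `y`, `z` once, so all of them carry the
  -- same sign `S`, the product of the four insertion signs. With sorted columns the relation thus
  -- has no minus sign left.
  plücker₃-sorted : ∀ {m n} (A : Matrix R (suc (suc m)) n) (K : Fin m → Fin n) {w x y z} →
    w Fin.< x → x Fin.< y → y Fin.< z →
    let p = λ u v → minor R A (insert u (insert v K)) in
    p w y * p x z ≈ p x y * p w z + p w x * p y z
  plücker₃-sorted {m} A K {w} {x} {y} {z} w<x x<y y<z = begin
    p w y * p x z
      ≈⟨ *-cong (minor-insert₂ A K w<y) (minor-insert₂ A K x<z) ⟩
    ((s w * s y) * φ w y) * ((s x * s z) * φ x z)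
      ≈⟨ ≈-trans (regroup _ _ _ _) (*-congʳ (perm₁ (s w) (s x) (s y) (s z))) ⟩
    S * (φ w y * φ x z)
      ≈⟨ *-congˡ (move (plücker₃ A K w x y z)) ⟩
    S * (φ x y * φ w z + φ w x * φ y z)
      ≈⟨ distribˡ S _ _ ⟩
    S * (φ x y * φ w z) + S * (φ w x * φ y z)
      ≈⟨ +-cong (≈-trans (regroup _ _ _ _) (*-congʳ (perm₂ (s w) (s x) (s y) (s z)))) (regroup _ _ _ _) ⟨
    ((s x * s y) * φ x y) * ((s w * s z) * φ w z) + ((s w * s x) * φ w x) * ((s y * s z) * φ y z)
      ≈⟨ +-cong (*-cong (minor-insert₂ A K x<y) (minor-insert₂ A K w<z))
                (*-cong (minor-insert₂ A K w<x) (minor-insert₂ A K y<z)) ⟨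
    p x y * p w z + p w x * p y z ∎
    where
    p φ : _ → _ → Carrier
    p u v = minor R A (insert u (insert v K))
    φ u v = minor R A (u ◂ v ◂ K)
    s : _ → Carrier
    s u = insertSign u K
    S = (s w * s x) * (s y * s z)
    w<y = ℕₚ.<-trans w<x x<y
    x<z = ℕₚ.<-trans x<y y<z
    w<z = ℕₚ.<-trans w<y y<z
    regroup : ∀ a b c d → (a * b) * (c * d) ≈ (a * c) * (b * d)
    regroup a b c d = ≈-trans (*-assoc a b _) (≈-trans (*-congˡ (*-swapˡ b c d)) (≈-sym (*-assoc a c _)))
    perm₁ : ∀ a b c d → (a * c) * (b * d) ≈ (a * b) * (c * d)
    perm₁ a b c d = regroup a c b d
    perm₂ : ∀ a b c d → (b * c) * (a * d) ≈ (a * b) * (c * d)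
    perm₂ a b c d = ≈-trans (regroup b c a d) (*-congʳ (*-comm b a))
    move : ∀ {a b c} → a + - (b + - c) ≈ 0# → b ≈ a + c
    move {a} {b} {c} e = begin
      b                              ≈⟨ +-identityˡ b ⟨
      0# + b                         ≈⟨ +-congʳ e ⟨
      (a + - (b + - c)) + b          ≈⟨ +-congʳ (+-congˡ (-‿+-comm b (- c))) ⟨
      (a + (- b + - - c)) + b        ≈⟨ +-congʳ (+-congˡ (+-cong ≈-refl (-‿involutive c))) ⟩
      (a + (- b + c)) + b            ≈⟨ +-assoc a _ b ⟩
      a + ((- b + c) + b)            ≈⟨ +-congˡ (+-congʳ (+-comm (- b) c)) ⟩
      a + ((c + - b) + b)            ≈⟨ +-congˡ (+-assoc c (- b) b) ⟩
      a + (c + (- b + b))            ≈⟨ +-congˡ (+-congˡ (-‿inverseˡ b)) ⟩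
      a + (c + 0#)                   ≈⟨ +-congˡ (+-identityʳ c) ⟩
      a + c                          ∎

-- Increasing enumerations of subsets

insert-∋ : ∀ {m n} u (g : Fin m → Fin n) → ∃[ k ] insert u g k ≡ u
insert-∋ {zero}  u g = zero , refl
insert-∋ {suc m} u g with u Finₚ.<? g zero
... | yes _ = zero , refl
... | no  _ with insert-∋ u (g ∘ suc)
...   | k , e = suc k , e

insert-⊇ : ∀ {m n} u (g : Fin m → Fin n) k → ∃[ l ] insert u g l ≡ g k
insert-⊇ {suc m} u g k with u Finₚ.<? g zero
... | yes _ = suc k , refl
insert-⊇ {suc m} u g zero    | no _ = zero , refl
insert-⊇ {suc m} u g (suc k) | no _ with insert-⊇ u (g ∘ suc) k
... | l , e = suc l , e

insert-⊆ : ∀ {m n} u (g : Fin m → Fin n) k → insert u g k ≡ u ⊎ (∃[ l ] insert u g k ≡ g l)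
insert-⊆ {zero} u g zero = inj₁ refl
insert-⊆ {suc m} u g k with u Finₚ.<? g zero
insert-⊆ {suc m} u g zero    | yes _ = inj₁ refl
insert-⊆ {suc m} u g (suc k) | yes _ = inj₂ (k , refl)
insert-⊆ {suc m} u g zero    | no  _ = inj₂ (zero , refl)
insert-⊆ {suc m} u g (suc k) | no  _ with insert-⊆ u (g ∘ suc) k
... | inj₁ e       = inj₁ e
... | inj₂ (l , e) = inj₂ (suc l , e)

pair : ∀ {n} → Subset n → Fin n → Fin n → Subset n
pair K u v = (K ∪ ⁅ u ⁆) ∪ ⁅ v ⁆

pair-comm : ∀ {n} (K : Subset n) u v → pair K u v ≡ pair K v u
pair-comm {n} K u v = ≡.trans (∪-assoc K ⁅ u ⁆ ⁅ v ⁆)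
  (≡.trans (≡.cong (K ∪_) (∪-comm ⁅ u ⁆ ⁅ v ⁆)) (≡.sym (∪-assoc K ⁅ v ⁆ ⁅ u ⁆)))

module Enumeration {c ℓ : Level} (R : RealField c ℓ) where

  ◂-increasing : ∀ {m n} u (g : Fin m → Fin n) → StrictlyIncreasing R g →
    (∀ k → u Fin.< g k) → StrictlyIncreasing R (u ◂ g)
  ◂-increasing u g g↑ u< {zero}  {suc j} _          = u< j
  ◂-increasing u g g↑ u< {suc i} {suc j} (ℕ.s≤s lt) = g↑ lt

  insert-increasing : ∀ {m n} u (g : Fin m → Fin n) → StrictlyIncreasing R g →
    (∀ k → g k ≢ u) → StrictlyIncreasing R (insert u g)
  insert-increasing {zero} u g g↑ u∉g = ◂-increasing u g g↑ λ ()
  insert-increasing {suc m} u g g↑ u∉g with u Finₚ.<? g zero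
  ... | yes u<g = ◂-increasing u g g↑ λ where
    zero    → u<g
    (suc j) → ℕₚ.<-trans u<g (g↑ {zero} {suc j} (ℕ.s≤s ℕ.z≤n))
  ... | no u≮g = ◂-increasing (g zero) (insert u (g ∘ suc))
    (insert-increasing u (g ∘ suc) (λ lt → g↑ (ℕ.s≤s lt)) (u∉g ∘ suc)) first
    where
    first : ∀ j → g zero Fin.< insert u (g ∘ suc) j
    first j with insert-⊆ u (g ∘ suc) j
    ... | inj₁ e       = ≡.subst (g zero Fin.<_) (≡.sym e)
      (ℕₚ.≤∧≢⇒< (ℕₚ.≮⇒≥ u≮g) (u∉g zero ∘ Finₚ.toℕ-injective))
    ... | inj₂ (l , e) = ≡.subst (g zero Fin.<_) (≡.sym e) (g↑ (ℕ.s≤s ℕ.z≤n))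

  insert-image : ∀ {m n} u (g : Fin m → Fin n) {K} → IsImage R g K →
                 IsImage R (insert u g) (K ∪ ⁅ u ⁆)
  insert-image u g {K} im x = mk⇔ to from
    where
    to : x ∈ K ∪ ⁅ u ⁆ → ∃[ k ] insert u g k ≡ x
    to x∈ with x∈p∪q⁻ K ⁅ u ⁆ x∈
    ... | inj₁ x∈K with Equivalence.to (im x) x∈K
    ...   | k , gk≡x with insert-⊇ u g k
    ...     | l , e = l , ≡.trans e gk≡x
    to x∈ | inj₂ x∈u with insert-∋ u g
    ... | k , e = k , ≡.trans e (≡.sym (x∈⁅y⁆⇒x≡y u x∈u))
    from : (∃[ k ] insert u g k ≡ x) → x ∈ K ∪ ⁅ u ⁆
    from (k , refl) with insert-⊆ u g k
    ... | inj₁ e       = ≡.subst (_∈ K ∪ ⁅ u ⁆) (≡.sym e) (x∈p∪q⁺ (inj₂ (x∈⁅x⁆ u)))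
    ... | inj₂ (l , e) = x∈p∪q⁺ (inj₁ (Equivalence.from (im _) (l , ≡.sym e)))

  enumerate : ∀ {n} (Z : Subset n) →
    Σ[ f ∈ (Fin ∣ Z ∣ → Fin n) ] StrictlyIncreasing R f × IsImage R f Z
  enumerate []            = (λ ()) , (λ { {()} _ }) , λ ()
  enumerate (outside ∷ Z) with enumerate Z
  ... | f , inc , im = suc ∘ f , (λ lt → ℕ.s≤s (inc lt)) , λ where
    zero    → mk⇔ (λ ()) (λ ())
    (suc x) → mk⇔ (λ { (there x∈) → let k , e = Equivalence.to (im x) x∈ in k , ≡.cong suc e })
                  (λ { (k , refl) → there (Equivalence.from (im x) (k , refl)) })
  enumerate (inside ∷ Z) with enumerate Z
  ... | f , inc , im = zero ◂ (suc ∘ f) ,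
    ◂-increasing zero (suc ∘ f) (λ lt → ℕ.s≤s (inc lt)) (λ _ → ℕ.s≤s ℕ.z≤n) , λ where
    zero    → mk⇔ (λ _ → zero , refl) (λ _ → here)
    (suc x) → mk⇔ (λ { (there x∈) → let k , e = Equivalence.to (im x) x∈ in suc k , ≡.cong suc e })
                  (λ { (suc k , refl) → there (Equivalence.from (im x) (k , refl)) })

  -- Both sequences start with the least element of their common image, so the heads agree and the
  -- tails have a common image again. The equality of the lengths is a conclusion because it yields
  -- the common size of all bases.
  increasing-unique : ∀ {d e n} (f : Fin d → Fin n) (g : Fin e → Fin n) →
    StrictlyIncreasing R f → StrictlyIncreasing R g →
    (∀ k → ∃[ l ] f k ≡ g l) → (∀ l → ∃[ k ] g l ≡ f k) →
    Σ[ eq ∈ d ≡ e ] f ≗ g ∘ Fin.cast eq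
  increasing-unique {zero}  {zero}  f g _ _ _ _ = refl , λ ()
  increasing-unique {zero}  {suc e} f g _ _ _ g⊆f with () ← proj₁ (g⊆f zero)
  increasing-unique {suc d} {zero}  f g _ _ f⊆g _ with () ← proj₁ (f⊆g zero)
  increasing-unique {suc d} {suc e} f g f↑ g↑ f⊆g g⊆f = ≡.cong suc eq ,
    λ { zero → f₀≡g₀ ; (suc k) → tails k }
    where
    minimum : ∀ {d n} (f : Fin (suc d) → Fin n) → StrictlyIncreasing R f → ∀ k → f zero Fin.≤ f k
    minimum f f↑ zero    = ℕₚ.≤-refl
    minimum f f↑ (suc k) = ℕₚ.<⇒≤ (f↑ (ℕ.s≤s ℕ.z≤n))
    f₀≡g₀ : f zero ≡ g zero
    f₀≡g₀ with f⊆g zero | g⊆f zero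
    ... | l , f₀≡ | k , g₀≡ = Finₚ.≤-antisym
      (≡.subst (f zero Fin.≤_) (≡.sym g₀≡) (minimum f f↑ k))
      (≡.subst (g zero Fin.≤_) (≡.sym f₀≡) (minimum g g↑ l))
    tail⊆ : ∀ {d e n} (f : Fin (suc d) → Fin n) (g : Fin (suc e) → Fin n) →
      StrictlyIncreasing R f → f zero ≡ g zero → (∀ k → ∃[ l ] f k ≡ g l) →
      ∀ k → ∃[ l ] f (suc k) ≡ g (suc l)
    tail⊆ f g f↑ e f⊆g k with f⊆g (suc k)
    ... | suc l , e′ = l , e′
    ... | zero  , e′ = contradiction (f↑ {zero} {suc k} (ℕ.s≤s ℕ.z≤n))
      (ℕₚ.<-irrefl (≡.cong toℕ (≡.trans e (≡.sym e′))))
    rec = increasing-unique (f ∘ suc) (g ∘ suc)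
      (λ lt → f↑ (ℕ.s≤s lt)) (λ lt → g↑ (ℕ.s≤s lt))
      (tail⊆ f g f↑ f₀≡g₀ f⊆g) (tail⊆ g f g↑ (≡.sym f₀≡g₀) g⊆f)
    eq = proj₁ rec
    tails = proj₂ rec

  sameImage⇒≗ : ∀ {d e n} (f : Fin d → Fin n) (g : Fin e → Fin n) {Z} →
    StrictlyIncreasing R f → StrictlyIncreasing R g → IsImage R f Z → IsImage R g Z →
    Σ[ eq ∈ d ≡ e ] f ≗ g ∘ Fin.cast eq
  sameImage⇒≗ f g f↑ g↑ imf img = increasing-unique f g f↑ g↑ (⊆-image f g imf img) (⊆-image g f img imf)
    where
    ⊆-image : ∀ {d e n} (f : Fin d → Fin n) (g : Fin e → Fin n) {Z} → IsImage R f Z → IsImage R g Z →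
      ∀ k → ∃[ l ] f k ≡ g l
    ⊆-image f g imf img k with Equivalence.to (img (f k)) (Equivalence.from (imf (f k)) (k , refl))
    ... | l , e = l , ≡.sym e

-- Crossing pairs in a positroid

module Positroid {c ℓ : Level} (R : RealField c ℓ) where
  open RealField R hiding (zero; refl; sym; trans)
  open RealField R using () renaming (refl to ≈-refl; sym to ≈-sym; trans to ≈-trans)
  open OrderedField R
  open Determinant R
  open Enumeration R
  open IsPositroid

  basis-size : ∀ {n d} {M : Matroid n} → IsPositroid R d M → ∀ {B} → Matroid.Basis M B → ∣ B ∣ ≡ d
  basis-size P {B} b with enumerate B | Equivalence.to (basis⇔minor≉0 P B) b
  ... | g , g↑ , img | f , f↑ , imf , _ = proj₁ (sameImage⇒≗ g f g↑ f↑ img imf)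

  basis⇒minor≉0 : ∀ {n d} {M : Matroid n} (P : IsPositroid R d M) {B} → Matroid.Basis M B →
    (f : Fin d → Fin n) → StrictlyIncreasing R f → IsImage R f B → ¬ minor R (matrix P) f ≈ 0#
  basis⇒minor≉0 P {B} b f f↑ imf f≈0 with Equivalence.to (basis⇔minor≉0 P B) b
  ... | g , g↑ , img , g≉0 with sameImage⇒≗ g f g↑ f↑ img imf
  ... | refl , e = g≉0 (≈-trans
    (minor-cong (matrix P) g f λ k → ≡.trans (e k) (≡.cong f (Finₚ.cast-is-id refl k))) f≈0)

  insert₂-increasing : ∀ {m n} {k : Fin m → Fin n} {K} → StrictlyIncreasing R k → IsImage R k K →
    ∀ {u v} → u ∉ K → v ∉ K → u Fin.< v → StrictlyIncreasing R (insert u (insert v k))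
  insert₂-increasing {k = k} k↑ kim {u} {v} u∉ v∉ u<v = insert-increasing u (insert v k)
    (insert-increasing v k k↑ (λ l e → v∉ (Equivalence.from (kim v) (l , e))))
    (λ l e → avoids l e (insert-⊆ v k l))
    where
    avoids : ∀ l → insert v k l ≡ u → ¬ (insert v k l ≡ v ⊎ (∃[ l′ ] insert v k l ≡ k l′))
    avoids l e (inj₁ e′)        = ℕₚ.<-irrefl (≡.cong toℕ (≡.trans (≡.sym e) e′)) u<v
    avoids l e (inj₂ (l′ , e′)) = u∉ (Equivalence.from (kim u) (l′ , ≡.trans (≡.sym e′) e))

  insert₂-image : ∀ {m n} {k : Fin m → Fin n} {K} → IsImage R k K →
    ∀ u v → IsImage R (insert u (insert v k)) (pair K u v)
  insert₂-image {k = k} {K} kim u v = ≡.subst (IsImage R (insert u (insert v k)))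
    (pair-comm K v u) (insert-image u (insert v k) (insert-image v k kim))

  -- Such a basis fixes the number of rows as `m` plus two. Matching on this equality makes the
  -- Plücker relation, which is stated for `suc (suc m)` rows, applicable to the given matrix.
  pair-basis-size : ∀ {m n d} {M : Matroid n} → IsPositroid R d M →
    {k : Fin m → Fin n} {K : Subset n} → StrictlyIncreasing R k → IsImage R k K →
    ∀ {u v} → u ∉ K → v ∉ K → u Fin.< v → Matroid.Basis M (pair K u v) → d ≡ suc (suc m)
  pair-basis-size P k↑ kim {u} {v} u∉ v∉ u<v b with Equivalence.to (basis⇔minor≉0 P _) b
  ... | g , g↑ , img , _ = proj₁ (sameImage⇒≗ g (insert u (insert v _)) g↑
    (insert₂-increasing k↑ kim u∉ v∉ u<v) img (insert₂-image kim u v))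

  module Crossing {m n : ℕ} {M : Matroid n} (P : IsPositroid R (suc (suc m)) M)
    (k : Fin m → Fin n) {K : Subset n} (k↑ : StrictlyIncreasing R k) (kim : IsImage R k K) where
    open Matroid M using (Basis)

    p : Fin n → Fin n → Carrier
    p u v = minor R (matrix P) (insert u (insert v k))

    p≥0 : ∀ {u v} → u ∉ K → v ∉ K → u Fin.< v → 0# ≤ p u v
    p≥0 u∉ v∉ u<v = minors-nonneg P _ (insert₂-increasing k↑ kim u∉ v∉ u<v)

    p≉0 : ∀ {u v} → u ∉ K → v ∉ K → u Fin.< v → Basis (pair K u v) → ¬ p u v ≈ 0#
    p≉0 u∉ v∉ u<v b = basis⇒minor≉0 P b _ (insert₂-increasing k↑ kim u∉ v∉ u<v) (insert₂-image kim _ _)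

    p≉0⇒basis : ∀ {u v} → u ∉ K → v ∉ K → u Fin.< v → ¬ p u v ≈ 0# → Basis (pair K u v)
    p≉0⇒basis u∉ v∉ u<v ≉0 = Equivalence.from (basis⇔minor≉0 P _)
      (_ , insert₂-increasing k↑ kim u∉ v∉ u<v , insert₂-image kim _ _ , ≉0)

    -- Both products on the right of the sorted relation are nonnegative and cannot cancel. If one
    -- of them is nonzero, so is the product on the left, and with it both of its factors.
    crossing : ∀ {w x y z} → w ∉ K → x ∉ K → y ∉ K → z ∉ K →
      w Fin.< x → x Fin.< y → y Fin.< z →
      (Basis (pair K w x) × Basis (pair K y z)) ⊎ (Basis (pair K x y) × Basis (pair K w z)) →
      Basis (pair K w y) × Basis (pair K x z)
    crossing {w} {x} {y} {z} w∉ x∉ y∉ z∉ w<x x<y y<z h =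
      p≉0⇒basis w∉ y∉ w<y (λ e → pp≉0 (≈-trans (*-congʳ e) (zeroˡ (p x z)))) ,
      p≉0⇒basis x∉ z∉ x<z (λ e → pp≉0 (≈-trans (*-congˡ e) (zeroʳ (p w y))))
      where
      w<y = ℕₚ.<-trans w<x x<y
      x<z = ℕₚ.<-trans x<y y<z
      w<z = ℕₚ.<-trans w<y y<z
      ≥₁ : 0# ≤ p x y * p w z
      ≥₁ = *-nonneg _ _ (p≥0 x∉ y∉ x<y) (p≥0 w∉ z∉ w<z)
      ≥₂ : 0# ≤ p w x * p y z
      ≥₂ = *-nonneg _ _ (p≥0 w∉ x∉ w<x) (p≥0 y∉ z∉ y<z)
      pp≉0 : ¬ p w y * p x z ≈ 0#
      pp≉0 e = [ (λ (b , b′) → p≉0 y∉ z∉ y<z b′ (x*y≈0⇒y≈0 (p≉0 w∉ x∉ w<x b)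
                   (nonneg-sum≈0 ≥₂ ≥₁ (≈-trans (+-comm _ _) sum≈0))))
               , (λ (b , b′) → p≉0 w∉ z∉ w<z b′ (x*y≈0⇒y≈0 (p≉0 x∉ y∉ x<y b)
                   (nonneg-sum≈0 ≥₁ ≥₂ sum≈0))) ]′ h
        where
        sum≈0 : p x y * p w z + p w x * p y z ≈ 0#
        sum≈0 = ≈-trans (≈-sym (plücker₃-sorted (matrix P) k w<x x<y y<z)) e

  crossing-sorted : ∀ {n d} {M : Matroid n} → IsPositroid R d M →
    ∀ {K w x y z} → w ∉ K → x ∉ K → y ∉ K → z ∉ K →
    w Fin.< x → x Fin.< y → y Fin.< z →
    (Matroid.Basis M (pair K w x) × Matroid.Basis M (pair K y z)) ⊎
    (Matroid.Basis M (pair K x y) × Matroid.Basis M (pair K w z)) →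
    Matroid.Basis M (pair K w y) × Matroid.Basis M (pair K x z)
  crossing-sorted P {K} w∉ x∉ y∉ z∉ w<x x<y y<z h with enumerate K
  ... | k , k↑ , kim with [ (λ b → pair-basis-size P k↑ kim w∉ x∉ w<x (proj₁ b))
                          , (λ b → pair-basis-size P k↑ kim x∉ y∉ x<y (proj₁ b)) ]′ h
  ...   | refl = Crossing.crossing P k k↑ kim w∉ x∉ y∉ z∉ w<x x<y y<z h

-- Subsets and matroid rank

module _ {n : ℕ} where

  ∈∪ˡ : ∀ {x} {p q : Subset n} → x ∈ p → x ∈ p ∪ q
  ∈∪ˡ = x∈p∪q⁺ ∘ inj₁

  ∈∪ʳ : ∀ {x} {p q : Subset n} → x ∈ q → x ∈ p ∪ q
  ∈∪ʳ = x∈p∪q⁺ ∘ inj₂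

  ∪-elim : ∀ {ℓ} {A : Set ℓ} {x} {p q : Subset n} → (x ∈ p → A) → (x ∈ q → A) → x ∈ p ∪ q → A
  ∪-elim {p = p} {q} f g x∈ = [ f , g ]′ (x∈p∪q⁻ p q x∈)

  ∪-lub : ∀ {p q r : Subset n} → p ⊆ r → q ⊆ r → p ∪ q ⊆ r
  ∪-lub f g = ∪-elim f g

  ⁅⁆⊆ : ∀ {x} {p : Subset n} → x ∈ p → ⁅ x ⁆ ⊆ p
  ⁅⁆⊆ {x} {p} x∈p y∈ = ≡.subst (_∈ p) (≡.sym (x∈⁅y⁆⇒x≡y x y∈)) x∈p

  ⊈⇒∃ : ∀ {p q : Subset n} → p ⊈ q → ∃[ x ] x ∈ p × x ∉ q
  ⊈⇒∃ {p} {q} p⊈q with Finₚ.any? (λ x → x ∈? p ×-dec ¬? (x ∈? q))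
  ... | yes found = found
  ... | no none   = contradiction
    (λ {x} x∈p → decidable-stable (x ∈? q) λ x∉q → none (x , x∈p , x∉q)) p⊈q

  x∉p-x : ∀ {p : Subset n} {x} → x ∉ p ∖ x
  x∉p-x {p} {x} x∈ = go p x x∈
    where
    go : ∀ {n} (p : Subset n) x → x ∉ p ∖ x
    go (s ∷ p) (suc x) (there x∈) = go p x x∈
    go (inside ∷ p) zero ()
    go (outside ∷ p) zero ()

∣∪∣+∣∩∣ : ∀ {n} (p q : Subset n) → ∣ p ∪ q ∣ ℕ.+ ∣ p ∩ q ∣ ≡ ∣ p ∣ ℕ.+ ∣ q ∣
∣∪∣+∣∩∣ []            []            = refl
∣∪∣+∣∩∣ (outside ∷ p) (outside ∷ q) = ∣∪∣+∣∩∣ p q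
∣∪∣+∣∩∣ (outside ∷ p) (inside ∷ q)  = ≡.trans (≡.cong suc (∣∪∣+∣∩∣ p q)) (≡.sym (ℕₚ.+-suc ∣ p ∣ ∣ q ∣))
∣∪∣+∣∩∣ (inside ∷ p)  (outside ∷ q) = ≡.cong suc (∣∪∣+∣∩∣ p q)
∣∪∣+∣∩∣ (inside ∷ p)  (inside ∷ q)  = ≡.cong suc (≡.trans (ℕₚ.+-suc _ _)
  (≡.trans (≡.cong suc (∣∪∣+∣∩∣ p q)) (≡.sym (ℕₚ.+-suc ∣ p ∣ ∣ q ∣))))

∣∩∣+∣∩∁∣ : ∀ {n} (p q : Subset n) → ∣ p ∩ q ∣ ℕ.+ ∣ p ∩ ∁ q ∣ ≡ ∣ p ∣
∣∩∣+∣∩∁∣ []            []            = refl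
∣∩∣+∣∩∁∣ (outside ∷ p) (_ ∷ q)       = ∣∩∣+∣∩∁∣ p q
∣∩∣+∣∩∁∣ (inside ∷ p)  (outside ∷ q) = ≡.trans (ℕₚ.+-suc _ _) (≡.cong suc (∣∩∣+∣∩∁∣ p q))
∣∩∣+∣∩∁∣ (inside ∷ p)  (inside ∷ q)  = ≡.cong suc (∣∩∣+∣∩∁∣ p q)

module _ {n : ℕ} where

  ∣p∪⁅x⁆∣ : ∀ {p : Subset n} {x} → x ∉ p → ∣ p ∪ ⁅ x ⁆ ∣ ≡ suc ∣ p ∣
  ∣p∪⁅x⁆∣ {p} {x} x∉p = begin
    ∣ p ∪ ⁅ x ⁆ ∣                     ≡⟨ ℕₚ.+-identityʳ _ ⟨
    ∣ p ∪ ⁅ x ⁆ ∣ ℕ.+ 0               ≡⟨ ≡.cong (∣ p ∪ ⁅ x ⁆ ∣ ℕ.+_) (≡.sym (≡.trans (≡.cong ∣_∣ empty) (∣⊥∣≡0 n))) ⟩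
    ∣ p ∪ ⁅ x ⁆ ∣ ℕ.+ ∣ p ∩ ⁅ x ⁆ ∣   ≡⟨ ∣∪∣+∣∩∣ p ⁅ x ⁆ ⟩
    ∣ p ∣ ℕ.+ ∣ ⁅ x ⁆ ∣               ≡⟨ ≡.cong (∣ p ∣ ℕ.+_) (∣⁅x⁆∣≡1 x) ⟩
    ∣ p ∣ ℕ.+ 1                       ≡⟨ ℕₚ.+-comm ∣ p ∣ 1 ⟩
    suc ∣ p ∣                         ∎
    where
    open ≡.≡-Reasoning
    empty : p ∩ ⁅ x ⁆ ≡ ⊥
    empty = Empty-unique λ (y , y∈) → let y∈p , y∈x = x∈p∩q⁻ p ⁅ x ⁆ y∈ in
      x∉p (≡.subst (_∈ p) (x∈⁅y⁆⇒x≡y x y∈x) y∈p)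

  p-x∪⁅x⁆ : ∀ {p : Subset n} {x} → x ∈ p → (p ∖ x) ∪ ⁅ x ⁆ ≡ p
  p-x∪⁅x⁆ {p} {x} x∈p = ⊆-antisym (∪-lub (p─q⊆p p ⁅ x ⁆) (⁅⁆⊆ x∈p)) λ {y} y∈p → split y y∈p
    where
    split : ∀ y → y ∈ p → y ∈ (p ∖ x) ∪ ⁅ x ⁆
    split y y∈p with y Finₚ.≟ x
    ... | yes refl = ∈∪ʳ (x∈⁅x⁆ x)
    ... | no  y≢x  = ∈∪ˡ (x∈p∧x≢y⇒x∈p-y y∈p y≢x)

  p∪⁅x⁆≡p : ∀ {p : Subset n} {x} → x ∈ p → p ∪ ⁅ x ⁆ ≡ p
  p∪⁅x⁆≡p x∈p = ⊆-antisym (∪-lub id (⁅⁆⊆ x∈p)) ∈∪ˡ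

  ⊆∧∣∣≥⇒⊇ : ∀ {p q : Subset n} → p ⊆ q → ∣ q ∣ ℕ.≤ ∣ p ∣ → q ⊆ p
  ⊆∧∣∣≥⇒⊇ {p} {q} p⊆q le = decidable-stable (q ⊆? p) λ q⊈p →
    ℕₚ.<⇒≱ (p⊂q⇒∣p∣<∣q∣ {p = p} {q} (p⊆q , ⊈⇒∃ q⊈p)) le

∈-subsets : ∀ {n} (S : Subset n) → S ∈ˡ subsets n
∈-subsets []            = Any.here refl
∈-subsets (inside ∷ S)  = ∈-++⁺ˡ (∈-map⁺ (inside ∷_) (∈-subsets S))
∈-subsets (outside ∷ S) = ∈-++⁺ʳ _ (∈-map⁺ (outside ∷_) (∈-subsets S))

module Rank {n : ℕ} (M : Matroid n) {d : ℕ} (basis-size : ∀ {B} → Matroid.Basis M B → ∣ B ∣ ≡ d) where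
  open Matroid M

  -- Opaque because type checking blows up when rk unfolds to its enumeration of all subsets.
  opaque
    r : Subset n → ℕ
    r = rk M

    r≡rk : ∀ S → r S ≡ rk M S
    r≡rk S = refl

  independent-⊆ : ∀ {I J} → I ⊆ J → Independent J → Independent I
  independent-⊆ I⊆J (B , b , J⊆B) = B , b , J⊆B ∘ I⊆J

  independent-⊥ : Independent ⊥
  independent-⊥ = let B , b = nonempty in B , b , ⊆-min B

  -- An element of the current basis outside `I ∪ B` can be exchanged for one of `B`, which leaves
  -- fewer such elements and never touches `I`.
  extendWithin : ∀ {I B} → Independent I → Basis B → ∃[ B′ ] Basis B′ × I ⊆ B′ × B′ ⊆ I ∪ B
  extendWithin {I} {B} (B₀ , b₀ , I⊆B₀) b = go (suc ∣ B₀ ∩ ∁ (I ∪ B) ∣) B₀ b₀ I⊆B₀ ℕₚ.≤-refl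
    where
    go : ∀ k B₁ → Basis B₁ → I ⊆ B₁ → ∣ B₁ ∩ ∁ (I ∪ B) ∣ ℕ.< k →
         ∃[ B′ ] Basis B′ × I ⊆ B′ × B′ ⊆ I ∪ B
    go (suc k) B₁ b₁ I⊆B₁ lt with B₁ ⊆? I ∪ B
    ... | yes B₁⊆ = B₁ , b₁ , I⊆B₁ , B₁⊆
    ... | no  B₁⊈ with ⊈⇒∃ B₁⊈
    ...   | x , x∈B₁ , x∉ with exchange b₁ b x∈B₁ (x∉ ∘ ∈∪ʳ)
    ...     | y , y∈B , y∉B₁ , b₂ = go k B₂ b₂ I⊆B₂
      (ℕₚ.<-≤-trans (p⊂q⇒∣p∣<∣q∣ {p = B₂ ∩ ∁ (I ∪ B)} (smaller , x , x∈p∩q⁺ (x∈B₁ , x∉p⇒x∈∁p x∉) , x∉smaller)) (ℕ.s≤s⁻¹ lt))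
      where
      B₂ = (B₁ ∖ x) ∪ ⁅ y ⁆
      I⊆B₂ : I ⊆ B₂
      I⊆B₂ {i} i∈I = ∈∪ˡ (x∈p∧x≢y⇒x∈p-y (I⊆B₁ i∈I) λ { refl → x∉ (∈∪ˡ i∈I) })
      smaller : B₂ ∩ ∁ (I ∪ B) ⊆ B₁ ∩ ∁ (I ∪ B)
      smaller z∈ with x∈p∩q⁻ B₂ _ z∈
      ... | z∈B₂ , z∈∁ = x∈p∩q⁺ (∪-elim (p─q⊆p B₁ ⁅ x ⁆)
        (λ z∈y → contradiction (∈∪ʳ (⁅⁆⊆ y∈B z∈y)) (x∈∁p⇒x∉p z∈∁)) z∈B₂ , z∈∁)
      x∉smaller : x ∉ B₂ ∩ ∁ (I ∪ B)
      x∉smaller x∈ = ∪-elim (x∉p-x {p = B₁}) (λ x∈y → x∉ (∈∪ʳ (⁅⁆⊆ y∈B x∈y))) (proj₁ (x∈p∩q⁻ B₂ _ x∈))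

  -- Extend `I` to a basis `B₁` inside `I ∪ B₂`, where `B₂` is a basis containing `J`. If `B₁`
  -- picked up nothing new from `J`, all it has outside `I` lies in `B₂` outside `J`; as `I` is
  -- smaller than `J`, then `B₁` would be smaller than `B₂`.
  augment : ∀ {I J} → Independent I → Independent J → ∣ I ∣ ℕ.< ∣ J ∣ →
            ∃[ y ] y ∈ J × y ∉ I × Independent (I ∪ ⁅ y ⁆)
  augment {I} {J} ind (B₂ , b₂ , J⊆B₂) I<J with extendWithin ind b₂
  ... | B₁ , b₁ , I⊆B₁ , B₁⊆ with B₁ ∩ J ⊆? I
  ...   | no ⊈I = let y , y∈ , y∉I = ⊈⇒∃ ⊈I ; y∈B₁ , y∈J = x∈p∩q⁻ B₁ J y∈ in
                  y , y∈J , y∉I , B₁ , b₁ , ∪-lub I⊆B₁ (⁅⁆⊆ y∈B₁)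
  ...   | yes ⊆I = contradiction (ℕₚ.≤-refl {d}) (ℕₚ.<⇒≱ (begin-strict
    d                                  ≡⟨ basis-size b₁ ⟨
    ∣ B₁ ∣                             ≡⟨ ∣∩∣+∣∩∁∣ B₁ I ⟨
    ∣ B₁ ∩ I ∣ ℕ.+ ∣ B₁ ∩ ∁ I ∣        ≤⟨ ℕₚ.+-mono-≤ (∣p∩q∣≤∣q∣ B₁ I) (p⊆q⇒∣p∣≤∣q∣ outer) ⟩
    ∣ I ∣ ℕ.+ ∣ B₂ ∩ ∁ J ∣             <⟨ ℕₚ.+-monoˡ-< _ I<J ⟩
    ∣ J ∣ ℕ.+ ∣ B₂ ∩ ∁ J ∣             ≤⟨ ℕₚ.+-monoˡ-≤ _ (p⊆q⇒∣p∣≤∣q∣ (λ x∈J → x∈p∩q⁺ (J⊆B₂ x∈J , x∈J))) ⟩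
    ∣ B₂ ∩ J ∣ ℕ.+ ∣ B₂ ∩ ∁ J ∣        ≡⟨ ∣∩∣+∣∩∁∣ B₂ J ⟩
    ∣ B₂ ∣                             ≡⟨ basis-size b₂ ⟩
    d                                  ∎))
    where
    open ℕₚ.≤-Reasoning
    outer : B₁ ∩ ∁ I ⊆ B₂ ∩ ∁ J
    outer x∈ with x∈p∩q⁻ B₁ (∁ I) x∈
    ... | x∈B₁ , x∈∁I = x∈p∩q⁺
      ( ∪-elim (λ x∈I → contradiction x∈I (x∈∁p⇒x∉p x∈∁I)) id (B₁⊆ x∈B₁)
      , x∉p⇒x∈∁p (λ x∈J → x∈∁p⇒x∉p x∈∁I (⊆I (x∈p∩q⁺ (x∈B₁ , x∈J)))))

  opaque
    unfolding r

    rk-upper : ∀ {I S} → Independent I → I ⊆ S → ∣ I ∣ ℕ.≤ r S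
    rk-upper {I} {S} ind I⊆S = All.lookup (xs≤max 0 _)
      (∈-map⁺ ∣_∣ (∈-filter⁺ (λ I → independent? I ×-dec I ⊆? S) (∈-subsets I) (ind , I⊆S)))

    rk-attained : ∀ S → ∃[ I ] Independent I × I ⊆ S × ∣ I ∣ ≡ r S
    rk-attained S with argmax-sel id 0 (List.map ∣_∣ (List.filter (λ I → independent? I ×-dec I ⊆? S) (subsets n)))
    ... | inj₁ e  = ⊥ , independent-⊥ , ⊆-min S , ≡.trans (∣⊥∣≡0 n) (≡.sym e)
    ... | inj₂ r∈ with ∈-map⁻ ∣_∣ r∈
    ...   | I , I∈ , e with ∈-filter⁻ (λ I → independent? I ×-dec I ⊆? S) {xs = subsets n} I∈
    ...     | _ , ind , I⊆S = I , ind , I⊆S , ≡.sym e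

  extendIn : ∀ {J S} → Independent J → J ⊆ S → ∃[ I ] Independent I × J ⊆ I × I ⊆ S × ∣ I ∣ ≡ r S
  extendIn {J₀} {S} ind₀ J₀⊆S = go (suc (r S)) J₀ ind₀ id J₀⊆S (ℕₚ.m≤m+n (suc (r S)) ∣ J₀ ∣)
    where
    best = rk-attained S
    go : ∀ k J → Independent J → J₀ ⊆ J → J ⊆ S → r S ℕ.< k ℕ.+ ∣ J ∣ →
         ∃[ I ] Independent I × J₀ ⊆ I × I ⊆ S × ∣ I ∣ ≡ r S
    go zero J ind J₀⊆J J⊆S lt = contradiction (rk-upper ind J⊆S) (ℕₚ.<⇒≱ lt)
    go (suc k) J ind J₀⊆J J⊆S lt with ∣ J ∣ ℕₚ.≟ r S
    ... | yes e = J , ind , J₀⊆J , J⊆S , e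
    ... | no ne with augment ind (proj₁ (proj₂ best))
             (≡.subst (∣ J ∣ ℕ.<_) (≡.sym (proj₂ (proj₂ (proj₂ best)))) (ℕₚ.≤∧≢⇒< (rk-upper ind J⊆S) ne))
    ...   | y , y∈ , y∉J , ind′ = go k (J ∪ ⁅ y ⁆) ind′ (∈∪ˡ ∘ J₀⊆J)
      (∪-lub J⊆S (⁅⁆⊆ (proj₁ (proj₂ (proj₂ best)) y∈)))
      (≡.subst (r S ℕ.<_) (≡.sym (≡.trans (≡.cong (k ℕ.+_) (∣p∪⁅x⁆∣ y∉J)) (ℕₚ.+-suc k ∣ J ∣))) lt)

  rk-mono : ∀ {S T} → S ⊆ T → r S ℕ.≤ r T
  rk-mono {S} S⊆T with rk-attained S
  ... | I , ind , I⊆S , e = ≡.subst (ℕ._≤ _) e (rk-upper ind (S⊆T ∘ I⊆S))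

  rk≤∣∣ : ∀ S → r S ℕ.≤ ∣ S ∣
  rk≤∣∣ S with rk-attained S
  ... | I , ind , I⊆S , e = ≡.subst (ℕ._≤ _) e (p⊆q⇒∣p∣≤∣q∣ I⊆S)

  rk-⁅⁆ : ∀ x → r ⁅ x ⁆ ℕ.≤ 1
  rk-⁅⁆ x = ≡.subst (r ⁅ x ⁆ ℕ.≤_) (∣⁅x⁆∣≡1 x) (rk≤∣∣ ⁅ x ⁆)

  rk-independent : ∀ {I} → Independent I → r I ≡ ∣ I ∣
  rk-independent {I} ind = ℕₚ.≤-antisym (rk≤∣∣ I) (rk-upper ind id)

  rk≥∣∣⇒independent : ∀ {I} → ∣ I ∣ ℕ.≤ r I → Independent I
  rk≥∣∣⇒independent {I} le with rk-attained I
  ... | J , ind , J⊆I , e = independent-⊆ (⊆∧∣∣≥⇒⊇ J⊆I (≡.subst (∣ I ∣ ℕ.≤_) (≡.sym e) le)) ind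

  independent-size : ∀ {I} → Independent I → ∣ I ∣ ℕ.≤ d
  independent-size (B , b , I⊆B) = ≡.subst (_ ℕ.≤_) (basis-size b) (p⊆q⇒∣p∣≤∣q∣ I⊆B)

  independent⇒basis : ∀ {I} → Independent I → d ℕ.≤ ∣ I ∣ → Basis I
  independent⇒basis {I} (B , b , I⊆B) le = ≡.subst Basis
    (⊆-antisym (⊆∧∣∣≥⇒⊇ I⊆B (≡.subst (ℕ._≤ ∣ I ∣) (≡.sym (basis-size b)) le)) I⊆B) b

  rk≤d : ∀ S → r S ℕ.≤ d
  rk≤d S with rk-attained S
  ... | I , ind , _ , e = ≡.subst (ℕ._≤ d) e (independent-size ind)

  rk-⊤ : r ⊤ ≡ d
  rk-⊤ = ℕₚ.≤-antisym (rk≤d ⊤) (let B , b = nonempty in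
    ≡.subst (ℕ._≤ r ⊤) (basis-size b) (rk-upper (B , b , id) (⊆-max B)))

  rk-submodular : ∀ S T → r (S ∪ T) ℕ.+ r (S ∩ T) ℕ.≤ r S ℕ.+ r T
  rk-submodular S T with rk-attained (S ∩ T)
  ... | I , indI , I⊆ , eI with extendIn {S = S ∪ T} indI (λ x∈ → ∈∪ˡ (p∩q⊆p S T (I⊆ x∈)))
  ...   | J , indJ , I⊆J , J⊆ , eJ = begin
    r (S ∪ T) ℕ.+ r (S ∩ T)                           ≡⟨ ≡.cong₂ ℕ._+_ (≡.sym eJ) (≡.sym eI) ⟩
    ∣ J ∣ ℕ.+ ∣ I ∣                                   ≤⟨ ℕₚ.+-mono-≤ (p⊆q⇒∣p∣≤∣q∣ cover) (p⊆q⇒∣p∣≤∣q∣ meet) ⟩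
    ∣ (J ∩ S) ∪ (J ∩ T) ∣ ℕ.+ ∣ (J ∩ S) ∩ (J ∩ T) ∣   ≡⟨ ∣∪∣+∣∩∣ (J ∩ S) (J ∩ T) ⟩
    ∣ J ∩ S ∣ ℕ.+ ∣ J ∩ T ∣                           ≤⟨ ℕₚ.+-mono-≤
      (rk-upper (independent-⊆ (p∩q⊆p J S) indJ) (p∩q⊆q J S))
      (rk-upper (independent-⊆ (p∩q⊆p J T) indJ) (p∩q⊆q J T)) ⟩
    r S ℕ.+ r T                                       ∎
    where
    open ℕₚ.≤-Reasoning
    cover : J ⊆ (J ∩ S) ∪ (J ∩ T)
    cover x∈J = ∪-elim (λ x∈S → ∈∪ˡ (x∈p∩q⁺ (x∈J , x∈S))) (λ x∈T → ∈∪ʳ (x∈p∩q⁺ (x∈J , x∈T))) (J⊆ x∈J)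
    meet : I ⊆ (J ∩ S) ∩ (J ∩ T)
    meet x∈I = let x∈S , x∈T = x∈p∩q⁻ S T (I⊆ x∈I) in
      x∈p∩q⁺ (x∈p∩q⁺ (I⊆J x∈I , x∈S) , x∈p∩q⁺ (I⊆J x∈I , x∈T))

  rk-subadditive : ∀ S T → r (S ∪ T) ℕ.≤ r S ℕ.+ r T
  rk-subadditive S T = ℕₚ.≤-trans (ℕₚ.m≤m+n _ _) (rk-submodular S T)

  rk-∪⁅⁆ : ∀ S x → r (S ∪ ⁅ x ⁆) ℕ.≤ suc (r S)
  rk-∪⁅⁆ S x = ℕₚ.≤-trans (rk-subadditive S ⁅ x ⁆)
    (≡.subst (r S ℕ.+ r ⁅ x ⁆ ℕ.≤_) (ℕₚ.+-comm (r S) 1) (ℕₚ.+-monoʳ-≤ (r S) (rk-⁅⁆ x)))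

  -- Closure is monotone. The inequality `r (Y ∪ Z) ≤ r Y` is the form in which "`Y` spans `Z`" is
  -- expressed throughout.
  spans-⊇ : ∀ {Y₀ Y Z} → Y₀ ⊆ Y → r (Y₀ ∪ Z) ℕ.≤ r Y₀ → r (Y ∪ Z) ℕ.≤ r Y
  spans-⊇ {Y₀} {Y} {Z} Y₀⊆Y spans = ℕₚ.+-cancelʳ-≤ (r Y₀) _ _ (begin
    r (Y ∪ Z) ℕ.+ r Y₀
      ≤⟨ ℕₚ.+-mono-≤ (rk-mono (∪-lub ∈∪ˡ (∈∪ʳ ∘ ∈∪ʳ))) (rk-mono (λ x∈ → x∈p∩q⁺ (Y₀⊆Y x∈ , ∈∪ˡ x∈))) ⟩
    r (Y ∪ (Y₀ ∪ Z)) ℕ.+ r (Y ∩ (Y₀ ∪ Z))  ≤⟨ rk-submodular Y (Y₀ ∪ Z) ⟩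
    r Y ℕ.+ r (Y₀ ∪ Z)                     ≤⟨ ℕₚ.+-monoʳ-≤ (r Y) spans ⟩
    r Y ℕ.+ r Y₀                           ∎)
    where open ℕₚ.≤-Reasoning

module _ {n : ℕ} {p : Level} {P : Pred (Fin n) p} (P? : Decidable P) where

  filterˢ : Subset n
  filterˢ = tabulate (λ x → does (P? x))

  ∈-filterˢ⁺ : ∀ {x} → P x → x ∈ filterˢ
  ∈-filterˢ⁺ {x} px = Vecₚ.lookup⇒[]= x _
    (≡.trans (Vecₚ.lookup∘tabulate (λ x → does (P? x)) x) (dec-true (P? x) px))

  ∈-filterˢ⁻ : ∀ {x} → x ∈ filterˢ → P x
  ∈-filterˢ⁻ {x} x∈ with P? x | ≡.trans (≡.sym (Vecₚ.lookup∘tabulate (λ x → does (P? x)) x)) (Vecₚ.[]=⇒lookup x∈)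
  ... | yes px | _ = px
  ... | no _   | ()

extremum : ∀ {n ℓ} (_≺_ : Rel (Fin n) ℓ) →
  (∀ {x y z} → x ≺ y → y ≺ z → x ≺ z) → (∀ {x y} → x ≢ y → x ≺ y ⊎ y ≺ x) →
  ∀ {Y} → Nonempty Y → ∃[ m ] m ∈ Y × (∀ {y} → y ∈ Y → y ≢ m → m ≺ y)
extremum {n} _≺_ ≺-trans ≺-total {Y₀} = go (suc ∣ Y₀ ∣) Y₀ ℕₚ.≤-refl
  where
  go : ∀ k Y → ∣ Y ∣ ℕ.< k → Nonempty Y → ∃[ m ] m ∈ Y × (∀ {y} → y ∈ Y → y ≢ m → m ≺ y)
  go (suc k) Y lt (x , x∈Y) with nonempty? (Y ∖ x)
  ... | no empty = x , x∈Y , λ y∈Y y≢x → contradiction (_ , x∈p∧x≢y⇒x∈p-y y∈Y y≢x) empty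
  ... | yes ne with go k (Y ∖ x) (ℕₚ.<-≤-trans (x∈p⇒∣p-x∣<∣p∣ x∈Y) (ℕ.s≤s⁻¹ lt)) ne
  ...   | m , m∈ , least with ≺-total {x} {m} (λ { refl → x∉p-x {p = Y} m∈ })
  ...     | inj₁ x≺m = x , x∈Y , λ {y} y∈Y y≢x → below y y∈Y y≢x
    where
    below : ∀ y → y ∈ Y → y ≢ x → x ≺ y
    below y y∈Y y≢x with y Finₚ.≟ m
    ... | yes refl = x≺m
    ... | no  y≢m  = ≺-trans x≺m (least (x∈p∧x≢y⇒x∈p-y y∈Y y≢x) y≢m)
  ...     | inj₂ m≺x = m , p─q⊆p Y ⁅ x ⁆ m∈ , λ {y} y∈Y y≢m → below y y∈Y y≢m
    where
    below : ∀ y → y ∈ Y → y ≢ m → m ≺ y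
    below y y∈Y y≢m with y Finₚ.≟ x
    ... | yes refl = m≺x
    ... | no  y≢x  = least (x∈p∧x≢y⇒x∈p-y y∈Y y≢x) y≢m

-- The cyclic order

module _ {n : ℕ} where

  -- Strict cyclic order of three points. The alternatives are wrapped in a data type so that
  -- unification can recover the points from a proof.
  data Cyclic (a b c : Fin n) : Set where
    ⟨_⟩ : (a Fin.< b × b Fin.< c) ⊎ (b Fin.< c × c Fin.< a) ⊎ (c Fin.< a × a Fin.< b) → Cyclic a b c

  cyclic? : ∀ a b c → Dec (Cyclic a b c)
  cyclic? a b c = map′ ⟨_⟩ (λ { ⟨ h ⟩ → h }) ((a Finₚ.<? b ×-dec b Finₚ.<? c)
    ⊎-dec (b Finₚ.<? c ×-dec c Finₚ.<? a)
    ⊎-dec (c Finₚ.<? a ×-dec a Finₚ.<? b))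

  rotate : ∀ {a b c} → Cyclic a b c → Cyclic b c a
  rotate ⟨ inj₁ h ⟩        = ⟨ inj₂ (inj₂ h) ⟩
  rotate ⟨ inj₂ (inj₁ h) ⟩ = ⟨ inj₁ h ⟩
  rotate ⟨ inj₂ (inj₂ h) ⟩ = ⟨ inj₂ (inj₁ h) ⟩

  cyclic⇒≢ : ∀ {a b c} → Cyclic a b c → a ≢ b
  cyclic⇒≢ ⟨ inj₁ (h , _) ⟩        refl = ℕₚ.<-irrefl refl h
  cyclic⇒≢ ⟨ inj₂ (inj₁ (h , k)) ⟩ refl = ℕₚ.<-asym h k
  cyclic⇒≢ ⟨ inj₂ (inj₂ (_ , h)) ⟩ refl = ℕₚ.<-irrefl refl h

  cyclic-asym : ∀ {a b c} → Cyclic a b c → ¬ Cyclic a c b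
  cyclic-asym ⟨ inj₁ (a<b , b<c) ⟩ ⟨ inj₁ (a<c , c<b) ⟩ = ℕₚ.<-asym b<c c<b
  cyclic-asym ⟨ inj₁ (a<b , b<c) ⟩ ⟨ inj₂ (inj₁ (c<b , b<a)) ⟩ = ℕₚ.<-asym b<c c<b
  cyclic-asym ⟨ inj₁ (a<b , b<c) ⟩ ⟨ inj₂ (inj₂ (b<a , a<c)) ⟩ = ℕₚ.<-asym a<b b<a
  cyclic-asym ⟨ inj₂ (inj₁ (b<c , c<a)) ⟩ ⟨ inj₁ (a<c , c<b) ⟩ = ℕₚ.<-asym a<c c<a
  cyclic-asym ⟨ inj₂ (inj₁ (b<c , c<a)) ⟩ ⟨ inj₂ (inj₁ (c<b , b<a)) ⟩ = ℕₚ.<-asym b<c c<b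
  cyclic-asym ⟨ inj₂ (inj₁ (b<c , c<a)) ⟩ ⟨ inj₂ (inj₂ (b<a , a<c)) ⟩ = ℕₚ.<-asym a<c c<a
  cyclic-asym ⟨ inj₂ (inj₂ (c<a , a<b)) ⟩ ⟨ inj₁ (a<c , c<b) ⟩ = ℕₚ.<-asym a<c c<a
  cyclic-asym ⟨ inj₂ (inj₂ (c<a , a<b)) ⟩ ⟨ inj₂ (inj₁ (c<b , b<a)) ⟩ = ℕₚ.<-asym a<b b<a
  cyclic-asym ⟨ inj₂ (inj₂ (c<a , a<b)) ⟩ ⟨ inj₂ (inj₂ (b<a , a<c)) ⟩ = ℕₚ.<-asym a<b b<a

  cyclic-trans : ∀ {a b c d} → Cyclic a b c → Cyclic a c d → Cyclic a b d
  cyclic-trans ⟨ inj₁ (a<b , b<c) ⟩ ⟨ inj₁ (a<c , c<d) ⟩ = ⟨ inj₁ (a<b , ℕₚ.<-trans b<c c<d) ⟩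
  cyclic-trans ⟨ inj₁ (a<b , b<c) ⟩ ⟨ inj₂ (inj₁ (c<d , d<a)) ⟩ = contradiction (ℕₚ.<-trans a<b b<c) (ℕₚ.<-asym (ℕₚ.<-trans c<d d<a))
  cyclic-trans ⟨ inj₁ (a<b , b<c) ⟩ ⟨ inj₂ (inj₂ (d<a , a<c)) ⟩ = ⟨ inj₂ (inj₂ (d<a , a<b)) ⟩
  cyclic-trans ⟨ inj₂ (inj₁ (b<c , c<a)) ⟩ ⟨ inj₁ (a<c , c<d) ⟩ = contradiction c<a (ℕₚ.<-asym a<c)
  cyclic-trans ⟨ inj₂ (inj₁ (b<c , c<a)) ⟩ ⟨ inj₂ (inj₁ (c<d , d<a)) ⟩ = ⟨ inj₂ (inj₁ (ℕₚ.<-trans b<c c<d , d<a)) ⟩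
  cyclic-trans ⟨ inj₂ (inj₁ (b<c , c<a)) ⟩ ⟨ inj₂ (inj₂ (d<a , a<c)) ⟩ = contradiction c<a (ℕₚ.<-asym a<c)
  cyclic-trans ⟨ inj₂ (inj₂ (c<a , a<b)) ⟩ ⟨ inj₁ (a<c , c<d) ⟩ = contradiction c<a (ℕₚ.<-asym a<c)
  cyclic-trans ⟨ inj₂ (inj₂ (c<a , a<b)) ⟩ ⟨ inj₂ (inj₁ (c<d , d<a)) ⟩ = ⟨ inj₂ (inj₂ (d<a , a<b)) ⟩
  cyclic-trans ⟨ inj₂ (inj₂ (c<a , a<b)) ⟩ ⟨ inj₂ (inj₂ (d<a , a<c)) ⟩ = contradiction c<a (ℕₚ.<-asym a<c)

  cyclic-total : ∀ {a b c} → a ≢ b → b ≢ c → a ≢ c → Cyclic a b c ⊎ Cyclic a c b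
  cyclic-total {a} {b} {c} a≢b b≢c a≢c with Finₚ.<-cmp a b | Finₚ.<-cmp b c | Finₚ.<-cmp a c
  ... | tri≈ _ e _ | _          | _          = contradiction e a≢b
  ... | _          | tri≈ _ e _ | _          = contradiction e b≢c
  ... | _          | _          | tri≈ _ e _ = contradiction e a≢c
  ... | tri< p _ _ | tri< q _ _ | _          = inj₁ ⟨ inj₁ (p , q) ⟩
  ... | tri< p _ _ | tri> _ _ q | tri< s _ _ = inj₂ ⟨ inj₁ (s , q) ⟩
  ... | tri< p _ _ | tri> _ _ q | tri> _ _ s = inj₁ ⟨ inj₂ (inj₂ (s , p)) ⟩
  ... | tri> _ _ p | tri< q _ _ | tri< s _ _ = inj₂ ⟨ inj₂ (inj₂ (p , s)) ⟩
  ... | tri> _ _ p | tri< q _ _ | tri> _ _ s = inj₁ ⟨ inj₂ (inj₁ (q , s)) ⟩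
  ... | tri> _ _ p | tri> _ _ q | _          = inj₂ ⟨ inj₂ (inj₁ (q , p)) ⟩

  cyclic⇒≤[] : ∀ {a x y} → Cyclic a x y → x ≤[ a ] y
  cyclic⇒≤[] ⟨ inj₁ (a<x , x<y) ⟩        = inj₁ (ℕₚ.<⇒≤ a<x , ℕₚ.<⇒≤ x<y)
  cyclic⇒≤[] ⟨ inj₂ (inj₁ (x<y , y<a)) ⟩ = inj₂ (inj₁ (ℕₚ.<⇒≤ x<y , y<a))
  cyclic⇒≤[] ⟨ inj₂ (inj₂ (y<a , a<x)) ⟩ = inj₂ (inj₂ (ℕₚ.<⇒≤ a<x , y<a))

  data InInterval (a b x : Fin n) : Set where
    start  : x ≡ a → InInterval a b x
    end    : x ≡ b → InInterval a b x
    inner  : Cyclic a x b → InInterval a b x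

  ∈-interval⁻ : ∀ a b {x} → x ∈ [ a ⋯ b ] → InInterval a b x
  ∈-interval⁻ a b {x} x∈ with x Finₚ.≟ a | x Finₚ.≟ b
  ... | yes e  | _      = start e
  ... | no  _  | yes e  = end e
  ... | no x≢a | no x≢b with ∈-filterˢ⁻ (λ x → x ≤[ a ]? b) {x} x∈
  ...   | inj₁ (a≤x , x≤b)        = inner ⟨ inj₁ (Finₚ.≤∧≢⇒< a≤x (x≢a ∘ ≡.sym) , Finₚ.≤∧≢⇒< x≤b x≢b) ⟩
  ...   | inj₂ (inj₁ (x≤b , b<a)) = inner ⟨ inj₂ (inj₁ (Finₚ.≤∧≢⇒< x≤b x≢b , b<a)) ⟩
  ...   | inj₂ (inj₂ (a≤x , b<a)) = inner ⟨ inj₂ (inj₂ (b<a , Finₚ.≤∧≢⇒< a≤x (x≢a ∘ ≡.sym))) ⟩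

  ∈-interval⁺ : ∀ a b {x} → InInterval a b x → x ∈ [ a ⋯ b ]
  ∈-interval⁺ a b {x} h = ∈-filterˢ⁺ (λ x → x ≤[ a ]? b) (below h)
    where
    below : InInterval a b x → x ≤[ a ] b
    below (inner h) = cyclic⇒≤[] h
    below (start refl) with a Finₚ.≤? b
    ... | yes a≤b = inj₁ (ℕₚ.≤-refl , a≤b)
    ... | no  a≰b = inj₂ (inj₂ (ℕₚ.≤-refl , ℕₚ.≰⇒> a≰b))
    below (end refl) with a Finₚ.≤? b
    ... | yes a≤b = inj₁ (a≤b , ℕₚ.≤-refl)
    ... | no  a≰b = inj₂ (inj₁ (ℕₚ.≤-refl , ℕₚ.≰⇒> a≰b))

  -- The strict order `x <[ e ] y`, recast as a least element `e` followed by cyclic triples, so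
  -- that the rules for `Cyclic` apply directly.
  data _≺[_]_ (x e y : Fin n) : Set where
    first : x ≡ e → y ≢ e → x ≺[ e ] y
    later : Cyclic e x y → x ≺[ e ] y

  ≺-trans : ∀ {e x y z} → x ≺[ e ] y → y ≺[ e ] z → x ≺[ e ] z
  ≺-trans (first _ y≢e) (first y≡e _) = contradiction y≡e y≢e
  ≺-trans (first x≡e _) (later h)     = first x≡e (cyclic⇒≢ (rotate (rotate h)))
  ≺-trans (later h)     (first y≡e _) = contradiction y≡e (cyclic⇒≢ (rotate (rotate h)))
  ≺-trans (later h)     (later k)     = later (cyclic-trans h k)

  ≺-irrefl : ∀ {e x} → ¬ x ≺[ e ] x
  ≺-irrefl (first x≡e x≢e) = x≢e x≡e
  ≺-irrefl (later h)       = cyclic⇒≢ (rotate h) refl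

  ≺-total : ∀ {e x y} → x ≢ y → x ≺[ e ] y ⊎ y ≺[ e ] x
  ≺-total {e} {x} {y} x≢y with x Finₚ.≟ e | y Finₚ.≟ e
  ... | yes refl | _        = inj₁ (first refl (x≢y ∘ ≡.sym))
  ... | no _     | yes refl = inj₂ (first refl x≢y)
  ... | no x≢e   | no y≢e   with cyclic-total (x≢e ∘ ≡.sym) x≢y (y≢e ∘ ≡.sym)
  ...   | inj₁ h = inj₁ (later h)
  ...   | inj₂ h = inj₂ (later h)

  _≺[_]?_ : ∀ x e y → Dec (x ≺[ e ] y)
  x ≺[ e ]? y = map′ [ (λ (p , q) → first p q) , later ]′
    (λ { (first p q) → inj₁ (p , q) ; (later h) → inj₂ h })
    ((x Finₚ.≟ e ×-dec ¬? (y Finₚ.≟ e)) ⊎-dec cyclic? e x y)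

-- Rank and CCW-arrows

module Rising {n : ℕ} (M : Matroid n) {d : ℕ} (basis-size : ∀ {B} → Matroid.Basis M B → ∣ B ∣ ≡ d) where
  open Rank M basis-size

  after : Fin n → Fin n → Subset n
  after e i = filterˢ (λ x → i ≺[ e ]? x)

  -- The rank is compared at the moment when `i` joins: `E` and all elements after `i` in the order
  -- from `e` are already present.
  Rises : Subset n → Fin n → Fin n → Set
  Rises E e i = ¬ r ((E ∪ after e i) ∪ ⁅ i ⁆) ℕ.≤ r (E ∪ after e i)

  rises? : ∀ E e i → Dec (Rises E e i)
  rises? E e i = ¬? (r ((E ∪ after e i) ∪ ⁅ i ⁆) ℕₚ.≤? r (E ∪ after e i))

  rising : Subset n → Fin n → Subset n
  rising E e = filterˢ (rises? E e)

  -- Add the elements of Y to E from the ≺-largest down.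
  rk-upset : ∀ E e k {Y} → ∣ Y ∣ ℕ.< k → (∀ {x y} → x ∈ Y → x ≺[ e ] y → y ∈ Y) →
             r (E ∪ Y) ≡ r E ℕ.+ ∣ rising E e ∩ Y ∣
  rk-upset E e (suc k) {Y} lt up with nonempty? Y
  ... | no empty rewrite Empty-unique empty = begin
    r (E ∪ ⊥)                        ≡⟨ ≡.cong r (∪-identityʳ E) ⟩
    r E                              ≡⟨ ℕₚ.+-identityʳ (r E) ⟨
    r E ℕ.+ 0                        ≡⟨ ≡.cong (r E ℕ.+_) (∣⊥∣≡0 n) ⟨
    r E ℕ.+ ∣ ⊥ {n} ∣                ≡⟨ ≡.cong (λ Z → r E ℕ.+ ∣ Z ∣) (∩-zeroʳ (rising E e)) ⟨
    r E ℕ.+ ∣ rising E e ∩ ⊥ ∣       ∎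
    where open ≡.≡-Reasoning
  ... | yes ne with extremum (λ x y → x ≺[ e ] y) ≺-trans ≺-total ne
  ...   | m , m∈Y , least with rises? E e m | rk-upset E e k {Y ∖ m}
          (ℕₚ.<-≤-trans (x∈p⇒∣p-x∣<∣p∣ m∈Y) (ℕ.s≤s⁻¹ lt))
          (λ x∈ x≺y → x∈p∧x≢y⇒x∈p-y (up (p─q⊆p Y ⁅ m ⁆ x∈) x≺y)
            λ { refl → ≺-irrefl (≺-trans x≺y (least (p─q⊆p Y ⁅ m ⁆ x∈) λ { refl → x∉p-x {p = Y} x∈ })) })
  ...     | rises | ih = step rises
    where
    open ≡.≡-Reasoning
    A = rising E e
    Y-m≡after : Y ∖ m ≡ after e m
    Y-m≡after = ⊆-antisym
      (λ x∈ → ∈-filterˢ⁺ (λ x → m ≺[ e ]? x) (least (p─q⊆p Y ⁅ m ⁆ x∈) λ { refl → x∉p-x {p = Y} x∈ }))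
      (λ x∈ → let m≺x = ∈-filterˢ⁻ (λ x → m ≺[ e ]? x) x∈ in
        x∈p∧x≢y⇒x∈p-y (up m∈Y m≺x) λ { refl → ≺-irrefl m≺x })
    E∪Y≡ : E ∪ Y ≡ (E ∪ after e m) ∪ ⁅ m ⁆
    E∪Y≡ = begin
      E ∪ Y                      ≡⟨ ≡.cong (E ∪_) (p-x∪⁅x⁆ m∈Y) ⟨
      E ∪ ((Y ∖ m) ∪ ⁅ m ⁆)      ≡⟨ ∪-assoc E (Y ∖ m) ⁅ m ⁆ ⟨
      (E ∪ (Y ∖ m)) ∪ ⁅ m ⁆      ≡⟨ ≡.cong (λ Z → (E ∪ Z) ∪ ⁅ m ⁆) Y-m≡after ⟩
      (E ∪ after e m) ∪ ⁅ m ⁆    ∎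
    before : r (E ∪ after e m) ≡ r E ℕ.+ ∣ A ∩ (Y ∖ m) ∣
    before = ≡.trans (≡.cong (λ Z → r (E ∪ Z)) (≡.sym Y-m≡after)) ih
    step : Dec (Rises E e m) → r (E ∪ Y) ≡ r E ℕ.+ ∣ A ∩ Y ∣
    step (yes rises) = begin
      r (E ∪ Y)                              ≡⟨ ≡.cong r E∪Y≡ ⟩
      r ((E ∪ after e m) ∪ ⁅ m ⁆)            ≡⟨ ℕₚ.≤-antisym (rk-∪⁅⁆ _ m) (ℕₚ.≰⇒> rises) ⟩
      suc (r (E ∪ after e m))                ≡⟨ ≡.cong suc before ⟩
      suc (r E ℕ.+ ∣ A ∩ (Y ∖ m) ∣)          ≡⟨ ℕₚ.+-suc (r E) _ ⟨
      r E ℕ.+ suc ∣ A ∩ (Y ∖ m) ∣            ≡⟨ ≡.cong (r E ℕ.+_) (∣p∪⁅x⁆∣ {p = A ∩ (Y ∖ m)}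
                                                (λ m∈ → x∉p-x {p = Y} (p∩q⊆q A (Y ∖ m) m∈))) ⟨
      r E ℕ.+ ∣ (A ∩ (Y ∖ m)) ∪ ⁅ m ⁆ ∣      ≡⟨ ≡.cong (λ Z → r E ℕ.+ ∣ Z ∣) (⊆-antisym
        (∪-lub (λ x∈ → let x∈A , x∈Y = x∈p∩q⁻ A (Y ∖ m) x∈ in x∈p∩q⁺ (x∈A , p─q⊆p Y ⁅ m ⁆ x∈Y))
               (⁅⁆⊆ (x∈p∩q⁺ (∈-filterˢ⁺ (rises? E e) rises , m∈Y))))
        (λ {x} x∈ → let x∈A , x∈Y = x∈p∩q⁻ A Y x∈ in
          ∪-elim (λ x∈Y-m → ∈∪ˡ (x∈p∩q⁺ (x∈A , x∈Y-m))) ∈∪ʳ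
            (≡.subst (x ∈_) (≡.sym (p-x∪⁅x⁆ m∈Y)) x∈Y))) ⟩
      r E ℕ.+ ∣ A ∩ Y ∣                      ∎
    step (no falls) = begin
      r (E ∪ Y)                              ≡⟨ ≡.cong r E∪Y≡ ⟩
      r ((E ∪ after e m) ∪ ⁅ m ⁆)            ≡⟨ ℕₚ.≤-antisym
        (decidable-stable (r ((E ∪ after e m) ∪ ⁅ m ⁆) ℕₚ.≤? r (E ∪ after e m)) falls) (rk-mono ∈∪ˡ) ⟩
      r (E ∪ after e m)                      ≡⟨ before ⟩
      r E ℕ.+ ∣ A ∩ (Y ∖ m) ∣                ≡⟨ ≡.cong (λ Z → r E ℕ.+ ∣ Z ∣) (⊆-antisym
        (λ x∈ → let x∈A , x∈Y = x∈p∩q⁻ A (Y ∖ m) x∈ in x∈p∩q⁺ (x∈A , p─q⊆p Y ⁅ m ⁆ x∈Y))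
        (λ x∈ → let x∈A , x∈Y = x∈p∩q⁻ A Y x∈ in
          x∈p∩q⁺ (x∈A , x∈p∧x≢y⇒x∈p-y x∈Y λ { refl → falls (∈-filterˢ⁻ (rises? E e) x∈A) }))) ⟩
      r E ℕ.+ ∣ A ∩ Y ∣                      ∎

  -- Adding all elements climbs from `r E` to `r ⊤`, which is `d`, and each rise is by exactly one.
  rk+∣rising∣ : ∀ E e → r E ℕ.+ ∣ rising E e ∣ ≡ d
  rk+∣rising∣ E e = begin
    r E ℕ.+ ∣ rising E e ∣        ≡⟨ ≡.cong (λ Z → r E ℕ.+ ∣ Z ∣) (∩-identityʳ (rising E e)) ⟨
    r E ℕ.+ ∣ rising E e ∩ ⊤ ∣    ≡⟨ rk-upset E e (suc ∣ ⊤ {n} ∣) ℕₚ.≤-refl (λ _ _ → ∈⊤) ⟨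
    r (E ∪ ⊤)                     ≡⟨ ≡.cong r (∪-zeroʳ E) ⟩
    r ⊤                           ≡⟨ rk-⊤ ⟩
    d                             ∎
    where open ≡.≡-Reasoning

∣tabulate∣ : ∀ {n} (f : Fin n → Bool) → ∣ tabulate f ∣ ≡ ∑ (λ i → if f i then 1 else 0)
∣tabulate∣ {zero}  f = refl
∣tabulate∣ {suc n} f with f zero
... | true  = ≡.cong suc (∣tabulate∣ (f ∘ suc))
... | false = ∣tabulate∣ (f ∘ suc)

module _ {n : ℕ} (π : Permutation′ n) where

  -- The arrows inside `S`, recorded by their last element `i` rather than by their first element
  -- `π ⟨$⟩ʳ i` as in `ccw`; this makes them comparable with `rising`. Reindexing along `π`
  -- preserves their number.
  arrowsInto : Subset n → Subset n
  arrowsInto S = filterˢ (λ i → ccwArrow π (π ⟨$⟩ʳ i) ⊆? S)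

  ∣arrowsInto∣ : ∀ S → ∣ arrowsInto S ∣ ≡ ccw π S
  ∣arrowsInto∣ S = begin
    ∣ tabulate (f ∘ (π ⟨$⟩ʳ_)) ∣                       ≡⟨ ∣tabulate∣ (f ∘ (π ⟨$⟩ʳ_)) ⟩
    ∑ (λ i → if f (π ⟨$⟩ʳ i) then 1 else 0)            ≡⟨ sum-permute (λ i → if f i then 1 else 0) π ⟨
    ∑ (λ i → if f i then 1 else 0)                     ≡⟨ ∣tabulate∣ f ⟨
    ccw π S                                            ∎
    where
    open ≡.≡-Reasoning
    f : Fin n → Bool
    f x = does (ccwArrow π x ⊆? S)

  ∈-arrow⁺ : ∀ {i x} → InInterval (π ⟨$⟩ʳ i) i x → x ∈ ccwArrow π (π ⟨$⟩ʳ i)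
  ∈-arrow⁺ {i} {x} h = ≡.subst (λ j → x ∈ [ π ⟨$⟩ʳ i ⋯ j ]) (≡.sym (inverseˡ π)) (∈-interval⁺ (π ⟨$⟩ʳ i) i h)

  ∈-arrow⁻ : ∀ {i x} → x ∈ ccwArrow π (π ⟨$⟩ʳ i) → InInterval (π ⟨$⟩ʳ i) i x
  ∈-arrow⁻ {i} {x} x∈ = ∈-interval⁻ (π ⟨$⟩ʳ i) i (≡.subst (λ j → x ∈ [ π ⟨$⟩ʳ i ⋯ j ]) (inverseˡ π) x∈)

module Arrows {n : ℕ} (M : Matroid n) {d : ℕ} (basis-size : ∀ {B} → Matroid.Basis M B → ∣ B ∣ ≡ d)
  (loopless : ∀ i → ¬ Matroid.Loop M i) (π : Permutation′ n) (decorated : IsDecoratedPermutation M π) where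
  open Matroid M
  open Rank M basis-size
  open Rising M basis-size

  rk-⁅⁆≰0 : ∀ x → ¬ r ⁅ x ⁆ ℕ.≤ 0
  rk-⁅⁆≰0 x le = loopless x λ B b x∈B → ℕₚ.<⇒≱
    (≡.subst (ℕ._≤ r ⁅ x ⁆) (∣⁅x⁆∣≡1 x) (rk-upper (B , b , ⁅⁆⊆ x∈B) id)) le

  π≢ : ∀ i → π ⟨$⟩ʳ i ≢ i
  π≢ i = proj₁ (proj₁ (decorated i))

  between : Fin n → Subset n
  between i = filterˢ (λ x → cyclic? i x (π ⟨$⟩ʳ i))

  -- This is the minimality in the definition of `π`. If the elements strictly between `i` and its
  -- image spanned `i`, the last of them would already satisfy `Closes i`; if there are none, `i`
  -- would be a loop.
  unspanned : ∀ i → ¬ r (between i ∪ ⁅ i ⁆) ℕ.≤ r (between i)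
  unspanned i le with nonempty? (between i)
  ... | no empty = rk-⁅⁆≰0 i (ℕₚ.≤-trans (rk-mono ∈∪ʳ) (ℕₚ.≤-trans le
    (ℕₚ.≤-trans (rk≤∣∣ (between i)) (ℕₚ.≤-reflexive (≡.trans (≡.cong ∣_∣ (Empty-unique empty)) (∣⊥∣≡0 n))))))
  ... | yes ne with extremum (λ x y → y ≺[ i ] x) (λ p q → ≺-trans q p)
                     (λ x≢y → ≺-total (x≢y ∘ ≡.sym)) ne
  ...   | j , j∈ , largest = proj₂ (decorated i) j
    (cyclic⇒≤[] ij , cyclic⇒≢ (rotate ij))
    ( cyclic⇒≢ ij ∘ ≡.sym
    , ≡.subst₂ _≡_ (r≡rk [ i ⋯ j ]) (r≡rk ([ i ⋯ j ] ∖ i))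
        (ℕₚ.≤-antisym (ℕₚ.≤-trans (rk-mono fill) (ℕₚ.≤-trans le (rk-mono inside′)))
          (rk-mono (p─q⊆p [ i ⋯ j ] ⁅ i ⁆))))
    where
    cyc : ∀ {x} → x ∈ between i → Cyclic i x (π ⟨$⟩ʳ i)
    cyc = ∈-filterˢ⁻ (λ x → cyclic? i x (π ⟨$⟩ʳ i))
    ij = cyc j∈
    fill : [ i ⋯ j ] ⊆ between i ∪ ⁅ i ⁆
    fill x∈ with ∈-interval⁻ i j x∈
    ... | start refl = ∈∪ʳ (x∈⁅x⁆ i)
    ... | end refl   = ∈∪ˡ j∈
    ... | inner h    = ∈∪ˡ (∈-filterˢ⁺ (λ x → cyclic? i x (π ⟨$⟩ʳ i)) (cyclic-trans h ij))
    inside′ : between i ⊆ [ i ⋯ j ] ∖ i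
    inside′ {x} x∈ = x∈p∧x≢y⇒x∈p-y (∈-interval⁺ i j below) (cyclic⇒≢ (cyc x∈) ∘ ≡.sym)
      where
      below : InInterval i j x
      below with x Finₚ.≟ j
      ... | yes refl = end refl
      ... | no x≢j with largest x∈ x≢j
      ...   | first e _ = start e
      ...   | later h   = inner h

  beyond : Fin n → Subset n
  beyond i = [ i ⋯ π ⟨$⟩ʳ i ] ∖ i

  spanned : ∀ i → r (beyond i ∪ ⁅ i ⁆) ℕ.≤ r (beyond i)
  spanned i = ℕₚ.≤-trans
    (rk-mono (∪-lub (p─q⊆p [ i ⋯ π ⟨$⟩ʳ i ] ⁅ i ⁆) (⁅⁆⊆ (∈-interval⁺ i (π ⟨$⟩ʳ i) (start refl)))))
    (ℕₚ.≤-reflexive (≡.subst₂ _≡_ (≡.sym (r≡rk [ i ⋯ π ⟨$⟩ʳ i ])) (≡.sym (r≡rk (beyond i))) (proj₂ (proj₁ (decorated i)))))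

  arrowsInto⊆rising : ∀ {E e} → e ∈ E → arrowsInto π (∁ E) ⊆ rising E e
  arrowsInto⊆rising {E} {e} e∈E {i} i∈ = ∈-filterˢ⁺ (rises? E e) λ le →
    unspanned i (spans-⊇ inBetween le)
    where
    arrow⊆ : ∀ {x} → InInterval (π ⟨$⟩ʳ i) i x → x ∉ E
    arrow⊆ h = x∈∁p⇒x∉p (∈-filterˢ⁻ (λ i → ccwArrow π (π ⟨$⟩ʳ i) ⊆? ∁ E) i∈ (∈-arrow⁺ π h))
    E-between : ∀ {x} → x ∈ E → Cyclic i x (π ⟨$⟩ʳ i)
    E-between {x} x∈E with cyclic-total {a = i} {x} {π ⟨$⟩ʳ i} (λ { refl → arrow⊆ (end refl) x∈E })
                             (λ { refl → arrow⊆ (start refl) x∈E }) (π≢ i ∘ ≡.sym)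
    ... | inj₁ h = h
    ... | inj₂ h = contradiction x∈E (arrow⊆ (inner (rotate h)))
    -- Going on cyclically from `i`, an element after `i` in the order from `e` is met before `e`,
    -- and `e` itself before the image of `i`, because `e` lies in `E`.
    after-between : ∀ {x} → i ≺[ e ] x → Cyclic i x (π ⟨$⟩ʳ i)
    after-between (first i≡e _) = contradiction e∈E (≡.subst (_∉ E) i≡e (arrow⊆ (end refl)))
    after-between (later h)     = cyclic-trans (rotate h) (E-between e∈E)
    inBetween : E ∪ after e i ⊆ between i
    inBetween x∈ = ∈-filterˢ⁺ (λ x → cyclic? i x (π ⟨$⟩ʳ i))
      (∪-elim E-between (after-between ∘ ∈-filterˢ⁻ (λ x → i ≺[ e ]? x)) x∈)

  rk+ccw≤d : ∀ {E e} → e ∈ E → r E ℕ.+ ccw π (∁ E) ℕ.≤ d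
  rk+ccw≤d {E} {e} e∈E = begin
    r E ℕ.+ ccw π (∁ E)               ≡⟨ ≡.cong (r E ℕ.+_) (∣arrowsInto∣ π (∁ E)) ⟨
    r E ℕ.+ ∣ arrowsInto π (∁ E) ∣    ≤⟨ ℕₚ.+-monoʳ-≤ (r E) (p⊆q⇒∣p∣≤∣q∣ (arrowsInto⊆rising e∈E)) ⟩
    r E ℕ.+ ∣ rising E e ∣            ≡⟨ rk+∣rising∣ E e ⟩
    d                                 ∎
    where open ℕₚ.≤-Reasoning

-- Apart from the common size of the bases, this is all that the positroid hypothesis contributes to
-- the rest: in the quadrilateral `a`, `i`, `c`, `i′` two opposite sides yield a diagonal.
NoncrossingExchange : ∀ {n} → Matroid n → Set
NoncrossingExchange {n} M = ∀ {K a i c i′} → a ∉ K → i ∉ K → c ∉ K → i′ ∉ K →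
  Cyclic a i c → Cyclic c i′ a →
  Basis (pair K a i) → Basis (pair K c i′) → Basis (pair K a c)
  where open Matroid M

-- The cyclic conditions admit four linear orders, one for each choice of the least point; the other
-- five combinations are contradictory. Rotation turns the two sides into `w x`, `y z` or into
-- `x y`, `w z`, and the diagonal into `w y` or `x z`. This is why `crossing-sorted` has alternative
-- hypotheses and a double conclusion.
positroid⇒noncrossingExchange : ∀ {c ℓ} (R : RealField c ℓ) {n d} {M : Matroid n} →
  IsPositroid R d M → NoncrossingExchange M
positroid⇒noncrossingExchange R {M = M} P {K} {a} {i} {c} {i′} a∉ i∉ c∉ i′∉ = split
  where
  open Positroid R using (crossing-sorted)
  B = Matroid.Basis M
  swap : ∀ {u v} → B (pair K u v) → B (pair K v u)
  swap = ≡.subst B (pair-comm K _ _)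
  split : Cyclic a i c → Cyclic c i′ a → B (pair K a i) → B (pair K c i′) → B (pair K a c)
  split ⟨ inj₁ (a<i , i<c) ⟩        ⟨ inj₁ (c<i′ , i′<a) ⟩       _ _ = contradiction (ℕₚ.<-trans a<i i<c) (ℕₚ.<-asym (ℕₚ.<-trans c<i′ i′<a))
  split ⟨ inj₁ (a<i , i<c) ⟩        ⟨ inj₂ (inj₁ (i′<a , a<c)) ⟩ p q = proj₂ (crossing-sorted P i′∉ a∉ i∉ c∉ i′<a a<i i<c (inj₂ (p , swap q)))
  split ⟨ inj₁ (a<i , i<c) ⟩        ⟨ inj₂ (inj₂ (a<c , c<i′)) ⟩ p q = proj₁ (crossing-sorted P a∉ i∉ c∉ i′∉ a<i i<c c<i′ (inj₁ (p , q)))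
  split ⟨ inj₂ (inj₁ (i<c , c<a)) ⟩ ⟨ inj₁ (c<i′ , i′<a) ⟩       p q = swap (proj₂ (crossing-sorted P i∉ c∉ i′∉ a∉ i<c c<i′ i′<a (inj₂ (q , swap p))))
  split ⟨ inj₂ (inj₁ (i<c , c<a)) ⟩ ⟨ inj₂ (inj₁ (i′<a , a<c)) ⟩ _ _ = contradiction c<a (ℕₚ.<-asym a<c)
  split ⟨ inj₂ (inj₁ (i<c , c<a)) ⟩ ⟨ inj₂ (inj₂ (a<c , c<i′)) ⟩ _ _ = contradiction c<a (ℕₚ.<-asym a<c)
  split ⟨ inj₂ (inj₂ (c<a , a<i)) ⟩ ⟨ inj₁ (c<i′ , i′<a) ⟩       p q = swap (proj₁ (crossing-sorted P c∉ i′∉ a∉ i∉ c<i′ i′<a a<i (inj₁ (q , p))))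
  split ⟨ inj₂ (inj₂ (c<a , a<i)) ⟩ ⟨ inj₂ (inj₁ (i′<a , a<c)) ⟩ _ _ = contradiction c<a (ℕₚ.<-asym a<c)
  split ⟨ inj₂ (inj₂ (c<a , a<i)) ⟩ ⟨ inj₂ (inj₂ (a<c , c<i′)) ⟩ _ _ = contradiction c<a (ℕₚ.<-asym a<c)

-- Dependencies across a cyclic separation

module Noncrossing {n : ℕ} (M : Matroid n) {d : ℕ} (basis-size : ∀ {B} → Matroid.Basis M B → ∣ B ∣ ≡ d)
  (noncrossingExchange : NoncrossingExchange M) where
  open Matroid M
  open Rank M basis-size

  -- B is a basis of E, and J is another one, obtained by swapping a ∈ E₁ for c ∈ E₂.
  exchangeAcross : ∀ {E E₁ E₂} → E ⊆ E₁ ∪ E₂ → E₁ ⊆ E → E₂ ⊆ E → (∀ {x} → x ∈ E₁ → x ∉ E₂) →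
    r E ℕ.< r E₁ ℕ.+ r E₂ →
    ∃[ B ] ∃[ J ] ∃[ a ] ∃[ c ] Independent B × B ⊆ E × Independent J × ∣ J ∣ ≡ r E × J ⊆ B ∪ ⁅ c ⁆ ×
      a ∈ B × a ∉ J × a ∈ E₁ × c ∈ E₂ × ¬ Independent (B ∪ ⁅ c ⁆)
  exchangeAcross {E} {E₁} {E₂} E⊆ E₁⊆ E₂⊆ disjoint lt
    with rk-attained E₁ | rk-attained E₂
  ... | B₁ , ind₁ , B₁⊆ , e₁ | C₂ , ind₂ , C₂⊆ , e₂ with extendIn {S = E} ind₁ (E₁⊆ ∘ B₁⊆)
  -- `B` contains a basis of `E₁` and has only `r E` elements, so fewer than `r E₂` of them lie in
  -- `E₂`; some `c` of `E₂` can be added to these.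
  ...   | B , indB , B₁⊆B , B⊆ , eB with augment (independent-⊆ (p∩q⊆p B E₂) indB) ind₂ fewer
    where
    open ℕₚ.≤-Reasoning
    fewer : ∣ B ∩ E₂ ∣ ℕ.< ∣ C₂ ∣
    fewer = ≡.subst (∣ B ∩ E₂ ∣ ℕ.<_) (≡.sym e₂) (ℕₚ.+-cancelˡ-< (r E₁) _ _ (begin-strict
      r E₁ ℕ.+ ∣ B ∩ E₂ ∣               ≤⟨ ℕₚ.+-mono-≤
        (≡.subst (ℕ._≤ ∣ B ∩ E₁ ∣) e₁ (p⊆q⇒∣p∣≤∣q∣ (λ x∈ → x∈p∩q⁺ (B₁⊆B x∈ , B₁⊆ x∈))))
        (p⊆q⇒∣p∣≤∣q∣ (λ x∈ → let x∈B , x∈E₂ = x∈p∩q⁻ B E₂ x∈ in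
          x∈p∩q⁺ (x∈B , x∉p⇒x∈∁p (λ x∈E₁ → disjoint x∈E₁ x∈E₂)))) ⟩
      ∣ B ∩ E₁ ∣ ℕ.+ ∣ B ∩ ∁ E₁ ∣       ≡⟨ ∣∩∣+∣∩∁∣ B E₁ ⟩
      ∣ B ∣                             ≡⟨ eB ⟩
      r E                               <⟨ lt ⟩
      r E₁ ℕ.+ r E₂                     ∎))
  -- `J` is built around `B ∩ E₂` and `c`, so an element `a` of `B` that is missing from `J` has to
  -- lie in `E₁`.
  ...     | c , c∈C₂ , c∉B∩E₂ , ind-c with extendIn {S = B ∪ ⁅ c ⁆} ind-c
              (∪-lub (∈∪ˡ ∘ p∩q⊆p B E₂) ∈∪ʳ)
  ...       | J , indJ , ⊆J , J⊆ , eJ with ⊈⇒∃ B⊈J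
    where
    c∉B : c ∉ B
    c∉B c∈B = c∉B∩E₂ (x∈p∩q⁺ (c∈B , C₂⊆ c∈C₂))
    B⊈J : B ⊈ J
    B⊈J B⊆J = ℕₚ.<⇒≱ (ℕₚ.≤-reflexive (≡.sym (∣p∪⁅x⁆∣ c∉B)))
      (ℕₚ.≤-trans (p⊆q⇒∣p∣≤∣q∣ (∪-lub B⊆J (⁅⁆⊆ (⊆J (∈∪ʳ (x∈⁅x⁆ c))))))
        (≡.subst (ℕ._≤ ∣ B ∣) (≡.sym eJ) (ℕₚ.≤-trans (rk-mono (∪-lub B⊆ (⁅⁆⊆ (E₂⊆ (C₂⊆ c∈C₂)))))
          (ℕₚ.≤-reflexive (≡.sym eB)))))
  ...         | a , a∈B , a∉J = B , J , a , c , indB , B⊆ , indJ , ∣J∣≡ , J⊆ , a∈B , a∉J ,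
      ∪-elim id (λ a∈E₂ → contradiction (⊆J (∈∪ˡ (x∈p∩q⁺ (a∈B , a∈E₂)))) a∉J) (E⊆ (B⊆ a∈B)) ,
      c∈E₂ , dependent
    where
    c∈E₂ = C₂⊆ c∈C₂
    B∪c⊆E : B ∪ ⁅ c ⁆ ⊆ E
    B∪c⊆E = ∪-lub B⊆ (⁅⁆⊆ (E₂⊆ c∈E₂))
    ∣J∣≡ : ∣ J ∣ ≡ r E
    ∣J∣≡ = ≡.trans eJ (ℕₚ.≤-antisym (rk-mono B∪c⊆E)
      (ℕₚ.≤-trans (ℕₚ.≤-reflexive (≡.trans (≡.sym eB) (≡.sym (rk-independent indB)))) (rk-mono ∈∪ˡ)))
    dependent : ¬ Independent (B ∪ ⁅ c ⁆)
    dependent ind = ℕₚ.<⇒≱ (ℕₚ.≤-reflexive (≡.sym (∣p∪⁅x⁆∣ (λ c∈B → c∉B∩E₂ (x∈p∩q⁺ (c∈B , c∈E₂))))))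
      (≡.subst (∣ B ∪ ⁅ c ⁆ ∣ ℕ.≤_) (≡.sym eB) (rk-upper ind B∪c⊆E))

  -- The closure of `pair K c i′` grows to contain the whole basis `pair K a i`: it contains `E`,
  -- which `J` spans, hence `a`; then `G`, which `BG` spans; then `i`, which `G` spans together with
  -- `i′`.
  basis-replace : ∀ {K J E BG G a c i i′} → Basis (pair K a i) → a ∈ E →
    J ⊆ K ∪ ⁅ c ⁆ → r (J ∪ E) ℕ.≤ r J → BG ⊆ K ∪ ⁅ a ⁆ → r (BG ∪ G) ℕ.≤ r BG →
    r ((G ∪ ⁅ i′ ⁆) ∪ ⁅ i ⁆) ℕ.≤ r (G ∪ ⁅ i′ ⁆) → d ℕ.≤ r (pair K c i′)
  basis-replace {K} {J} {E} {BG} {G} {a} {c} {i} {i′} basis a∈E J⊆ spansE BG⊆ spansG i-spanned = begin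
    d                   ≡⟨ basis-size basis ⟨
    ∣ pair K a i ∣      ≡⟨ rk-independent (pair K a i , basis , id) ⟨
    r (pair K a i)      ≤⟨ rk-mono (∪-lub (∪-lub K⊆ (⁅⁆⊆ (∈∪ˡ {p = Y₁ ∪ G} (∈∪ˡ {p = Y₁} (∈∪ʳ {p = Y} a∈E))))) (∈∪ʳ {p = Y₁ ∪ G})) ⟩
    r ((Y₁ ∪ G) ∪ ⁅ i ⁆) ≤⟨ spans-⊇ {G ∪ ⁅ i′ ⁆} {Y₁ ∪ G} {⁅ i ⁆} G+i′⊆ i-spanned ⟩
    r (Y₁ ∪ G)          ≤⟨ spans-⊇ {BG} {Y₁} {G} BG⊆Y₁ spansG ⟩
    r Y₁                ≤⟨ spans-⊇ {J} {Y} {E} (λ x∈ → ∈∪ˡ {p = K ∪ ⁅ c ⁆} (J⊆ x∈)) spansE ⟩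
    r Y                 ∎
    where
    open ℕₚ.≤-Reasoning
    Y Y₁ : Subset n
    Y = pair K c i′
    Y₁ = Y ∪ E
    K⊆ : K ⊆ (Y₁ ∪ G) ∪ ⁅ i ⁆
    K⊆ x∈ = ∈∪ˡ {p = Y₁ ∪ G} (∈∪ˡ {p = Y₁} (∈∪ˡ {p = Y} (∈∪ˡ {p = K ∪ ⁅ c ⁆} (∈∪ˡ {p = K} x∈))))
    G+i′⊆ : G ∪ ⁅ i′ ⁆ ⊆ Y₁ ∪ G
    G+i′⊆ = ∪-lub (∈∪ʳ {p = Y₁}) (λ x∈ → ∈∪ˡ {p = Y₁} (∈∪ˡ {p = Y} (∈∪ʳ {p = K ∪ ⁅ c ⁆} x∈)))
    BG⊆Y₁ : BG ⊆ Y₁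
    BG⊆Y₁ x∈ = ∪-elim (λ x∈K → ∈∪ˡ {p = Y} (∈∪ˡ {p = K ∪ ⁅ c ⁆} (∈∪ˡ {p = K} x∈K)))
      (λ x∈a → ∈∪ʳ {p = Y} (⁅⁆⊆ a∈E x∈a)) (BG⊆ x∈)

  ∣∪⁅⁆∣≤ : ∀ (S : Subset n) x → ∣ S ∪ ⁅ x ⁆ ∣ ℕ.≤ suc ∣ S ∣
  ∣∪⁅⁆∣≤ S x with x ∈? S
  ... | yes x∈S = ℕₚ.≤-trans (ℕₚ.≤-reflexive (≡.cong ∣_∣ (p∪⁅x⁆≡p x∈S))) (ℕₚ.n≤1+n _)
  ... | no  x∉S = ℕₚ.≤-reflexive (∣p∪⁅x⁆∣ x∉S)

  -- A spanning set with at most `d` elements is a basis. Were `v` in `K`, at most `suc ∣ K ∣`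
  -- elements would have to reach rank `d`.
  spanning-pair : ∀ {K u v} → d ≡ suc (suc ∣ K ∣) → d ℕ.≤ r (pair K u v) → Basis (pair K u v) × v ∉ K
  spanning-pair {K} {u} {v} d≡ le =
    independent⇒basis (rk≥∣∣⇒independent (ℕₚ.≤-trans (ℕₚ.≤-trans (∣∪⁅⁆∣≤ (K ∪ ⁅ u ⁆) v)
      (ℕₚ.≤-trans (ℕ.s≤s (∣∪⁅⁆∣≤ K u)) (ℕₚ.≤-reflexive (≡.sym d≡)))) le)) d≤∣∣ ,
    λ v∈K → ℕₚ.<⇒≱ (begin-strict
      ∣ pair K u v ∣       ≡⟨ ≡.cong ∣_∣ (p∪⁅x⁆≡p {p = K ∪ ⁅ u ⁆} (∈∪ˡ v∈K)) ⟩
      ∣ K ∪ ⁅ u ⁆ ∣        ≤⟨ ∣∪⁅⁆∣≤ K u ⟩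
      suc ∣ K ∣            <⟨ ℕₚ.n<1+n _ ⟩
      suc (suc ∣ K ∣)      ≡⟨ d≡ ⟨
      d                    ∎) d≤∣∣
    where
    open ℕₚ.≤-Reasoning
    d≤∣∣ : d ℕ.≤ ∣ pair K u v ∣
    d≤∣∣ = ℕₚ.≤-trans le (rk≤∣∣ _)

  independent-spans : ∀ {I S} → Independent I → I ⊆ S → ∣ I ∣ ≡ r S → r (I ∪ S) ℕ.≤ r I
  independent-spans ind I⊆S e = ℕₚ.≤-trans (rk-mono (∪-lub I⊆S id))
    (ℕₚ.≤-reflexive (≡.trans (≡.sym e) (≡.sym (rk-independent ind))))

  removePair : ∀ {D : Subset n} {a i} → a ≢ i → a ∈ D → i ∈ D →
    ∃[ K ] a ∉ K × i ∉ K × pair K a i ≡ D × (∀ {x} → x ∈ D → x ≢ i → x ∈ K ∪ ⁅ a ⁆)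
  removePair {D} {a} {i} a≢i a∈D i∈D = (D ∖ i) ∖ a ,
    x∉p-x {p = D ∖ i} , (λ i∈ → x∉p-x {p = D} (p─q⊆p (D ∖ i) ⁅ a ⁆ i∈)) ,
    ≡.trans (≡.cong (_∪ ⁅ i ⁆) restore) (p-x∪⁅x⁆ i∈D) ,
    λ {x} x∈D x≢i → ≡.subst (x ∈_) (≡.sym restore) (x∈p∧x≢y⇒x∈p-y x∈D x≢i)
    where
    restore : ((D ∖ i) ∖ a) ∪ ⁅ a ⁆ ≡ D ∖ i
    restore = p-x∪⁅x⁆ (x∈p∧x≢y⇒x∈p-y a∈D a≢i)

  -- The exchange turns the bases `pair K a i` and `pair K c i′` into the basis `pair K a c`, which
  -- contains the dependent set `B ∪ ⁅ c ⁆`. For a similar reason `c` is outside `K`: otherwise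
  -- `pair K a i` would contain that set.
  noncrossing-at : ∀ {K B J E BG G a c i i′} → a ∉ K → i ∉ K → a ≢ i → Basis (pair K a i) → a ∈ E →
    J ⊆ K ∪ ⁅ c ⁆ → r (J ∪ E) ℕ.≤ r J → BG ⊆ K ∪ ⁅ a ⁆ → r (BG ∪ G) ℕ.≤ r BG →
    r ((G ∪ ⁅ i′ ⁆) ∪ ⁅ i ⁆) ℕ.≤ r (G ∪ ⁅ i′ ⁆) →
    B ⊆ K ∪ ⁅ a ⁆ → ¬ Independent (B ∪ ⁅ c ⁆) → Cyclic a i c → Cyclic c i′ a → Data.Empty.⊥
  noncrossing-at {K} {B} {i = i} {i′} a∉K i∉K a≢i basis a∈E J⊆ spansE BG⊆ spansG i-spanned B⊆ dep aic ci′a =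
    dep (independent-⊆ (∪-lub (λ x∈ → ∈∪ˡ (B⊆ x∈)) ∈∪ʳ)
      (_ , noncrossingExchange a∉K i∉K c∉K (proj₂ new) aic ci′a basis (proj₁ new) , id))
    where
    d≡ : d ≡ suc (suc ∣ K ∣)
    d≡ = ≡.trans (≡.sym (basis-size basis)) (≡.trans
      (∣p∪⁅x⁆∣ {p = K ∪ _} (∪-elim i∉K (λ i∈a → a≢i (≡.sym (x∈⁅y⁆⇒x≡y _ i∈a)))))
      (≡.cong suc (∣p∪⁅x⁆∣ a∉K)))
    new = spanning-pair d≡ (basis-replace basis a∈E J⊆ spansE BG⊆ spansG i-spanned)
    c∉K : _ ∉ K
    c∉K c∈K = dep (_ , basis , ∪-lub (λ x∈ → ∈∪ˡ (B⊆ x∈)) (λ x∈ → ∈∪ˡ {p = K ∪ _} (∈∪ˡ {p = K} (⁅⁆⊆ c∈K x∈))))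

  -- The elements i and i′ are parallel modulo G and separate E₁ from E₂ cyclically.
  module _ {E E₁ E₂ G i i′} (E⊆G : E ⊆ G) (E₁⊆ : E₁ ⊆ E) (E₂⊆ : E₂ ⊆ E)
    (i-free : ¬ r (G ∪ ⁅ i ⁆) ℕ.≤ r G) (i-spanned : r ((G ∪ ⁅ i′ ⁆) ∪ ⁅ i ⁆) ℕ.≤ r (G ∪ ⁅ i′ ⁆))
    (crossing : ∀ {a c} → a ∈ E₁ → c ∈ E₂ → Cyclic a i c × Cyclic c i′ a) where

    private
      i∉G : i ∉ G
      i∉G i∈G = i-free (rk-mono (∪-lub id (⁅⁆⊆ i∈G)))

      ≢i : ∀ {x} → x ∈ G → x ≢ i
      ≢i x∈G refl = i∉G x∈G

      independent-∪⁅⁆ : ∀ {I} → Independent I → I ⊆ G → ∣ I ∣ ≡ r G → Independent (I ∪ ⁅ i ⁆)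
      independent-∪⁅⁆ {I} ind I⊆ e = rk≥∣∣⇒independent (begin
        ∣ I ∪ ⁅ i ⁆ ∣          ≡⟨ ∣p∪⁅x⁆∣ (λ i∈ → i∉G (I⊆ i∈)) ⟩
        suc ∣ I ∣              ≡⟨ ≡.cong suc e ⟩
        suc (r G)              ≤⟨ ℕₚ.≰⇒> i-free ⟩
        r (G ∪ ⁅ i ⁆)          ≤⟨ rk-mono (∪-lub (∈∪ʳ {p = I ∪ ⁅ i ⁆}) (λ x∈ → ∈∪ˡ {q = G} (∈∪ʳ {p = I} x∈))) ⟩
        r ((I ∪ ⁅ i ⁆) ∪ G)    ≤⟨ spans-⊇ {I} {I ∪ ⁅ i ⁆} {G} ∈∪ˡ (independent-spans ind I⊆ e) ⟩
        r (I ∪ ⁅ i ⁆)          ∎)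
        where open ℕₚ.≤-Reasoning

    -- Here `K` is produced: extend `B` to a basis `BG` of `G`, add `i`, which `G` does not span,
    -- extend to a basis `D`, and delete `a` and `i`. Then `BG` lies in `K ∪ ⁅ a ⁆` since `i` is
    -- outside `G`, and `J` lies in `K ∪ ⁅ c ⁆` since it avoids `a`.
    noncrossing-dependency : ∀ {B J a c} → Independent B → B ⊆ E → Independent J → ∣ J ∣ ≡ r E →
      J ⊆ B ∪ ⁅ c ⁆ → a ∈ B → a ∉ J → a ∈ E₁ → c ∈ E₂ → ¬ ¬ Independent (B ∪ ⁅ c ⁆)
    noncrossing-dependency {B} {J} {a} {c} indB B⊆E indJ ∣J∣≡ J⊆ a∈B a∉J a∈E₁ c∈E₂ dep =
      withBasisOfG (extendIn {S = G} indB (λ x∈ → E⊆G (B⊆E x∈)))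
      where
      a≢i : a ≢ i
      a≢i = ≢i (E⊆G (E₁⊆ a∈E₁))
      spansE : r (J ∪ E) ℕ.≤ r J
      spansE = independent-spans indJ (λ x∈ → ∪-lub B⊆E (⁅⁆⊆ (E₂⊆ c∈E₂)) (J⊆ x∈)) ∣J∣≡
      withoutPair : ∀ {BG D} → Independent BG → B ⊆ BG → BG ⊆ G → ∣ BG ∣ ≡ r G → Basis D → BG ⊆ D →
        ¬ (∃[ K ] a ∉ K × i ∉ K × pair K a i ≡ D × (∀ {x} → x ∈ D → x ≢ i → x ∈ K ∪ ⁅ a ⁆))
      withoutPair {BG} indBG B⊆BG BG⊆G eBG basisD BG⊆D (K , a∉K , i∉K , refl , toK∪a) =
        noncrossing-at a∉K i∉K a≢i basisD (E₁⊆ a∈E₁) J⊆K∪c spansE BG⊆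
          (independent-spans indBG BG⊆G eBG) i-spanned (λ x∈ → BG⊆ (B⊆BG x∈)) dep
          (proj₁ (crossing a∈E₁ c∈E₂)) (proj₂ (crossing a∈E₁ c∈E₂))
        where
        BG⊆ : BG ⊆ K ∪ ⁅ a ⁆
        BG⊆ x∈ = toK∪a (BG⊆D x∈) (≢i (BG⊆G x∈))
        J⊆K∪c : J ⊆ K ∪ ⁅ c ⁆
        J⊆K∪c x∈J = ∪-elim
          (λ x∈B → ∪-elim ∈∪ˡ (λ x∈a → contradiction (≡.subst (_∈ J) (x∈⁅y⁆⇒x≡y a x∈a) x∈J) a∉J)
            (BG⊆ (B⊆BG x∈B)))
          ∈∪ʳ (J⊆ x∈J)
      withBasis : ∀ {BG} → Independent BG → B ⊆ BG → BG ⊆ G → ∣ BG ∣ ≡ r G → ¬ Independent (BG ∪ ⁅ i ⁆)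
      withBasis indBG B⊆BG BG⊆G eBG (D , basisD , BG+i⊆D) =
        withoutPair indBG B⊆BG BG⊆G eBG basisD (λ x∈ → BG+i⊆D (∈∪ˡ x∈))
          (removePair {D = D} a≢i (BG+i⊆D (∈∪ˡ (B⊆BG a∈B))) (BG+i⊆D (∈∪ʳ (x∈⁅x⁆ i))))
      withBasisOfG : ¬ (∃[ BG ] Independent BG × B ⊆ BG × BG ⊆ G × ∣ BG ∣ ≡ r G)
      withBasisOfG (BG , indBG , B⊆BG , BG⊆G , eBG) =
        withBasis indBG B⊆BG BG⊆G eBG (independent-∪⁅⁆ indBG BG⊆G eBG)

    noncrossing : E ⊆ E₁ ∪ E₂ → (∀ {x} → x ∈ E₁ → x ∉ E₂) → ¬ r E ℕ.< r E₁ ℕ.+ r E₂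
    noncrossing E⊆ disjoint lt = go (exchangeAcross {E} {E₁} {E₂} E⊆ E₁⊆ E₂⊆ disjoint lt)
      where
      go : ¬ (∃[ B ] ∃[ J ] ∃[ a ] ∃[ c ] Independent B × B ⊆ E × Independent J × ∣ J ∣ ≡ r E ×
        J ⊆ B ∪ ⁅ c ⁆ × a ∈ B × a ∉ J × a ∈ E₁ × c ∈ E₂ × ¬ Independent (B ∪ ⁅ c ⁆))
      go (_ , _ , _ , _ , indB , B⊆E , indJ , ∣J∣≡ , J⊆ , a∈B , a∉J , a∈E₁ , c∈E₂ , dep) =
        noncrossing-dependency indB B⊆E indJ ∣J∣≡ J⊆ a∈B a∉J a∈E₁ c∈E₂ dep

-- Ranks of connected flats

module RankFormula {n : ℕ} (M : Matroid n) {d : ℕ} (basis-size : ∀ {B} → Matroid.Basis M B → ∣ B ∣ ≡ d)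
  (noncrossingExchange : NoncrossingExchange M) (loopless : ∀ i → ¬ Matroid.Loop M i)
  (π : Permutation′ n) (decorated : IsDecoratedPermutation M π) where
  open Rank M basis-size
  open Rising M basis-size
  open Arrows M basis-size loopless π decorated
  open Noncrossing M basis-size noncrossingExchange

  -- Connectedness of the restriction to `E`: subadditivity always gives the weak inequality, and
  -- equality would split the restriction into a direct sum.
  Connected : Subset n → Set
  Connected E = ∀ E₁ E₂ → Nonempty E₁ → Nonempty E₂ → E₁ ⊆ E → E₂ ⊆ E → E ⊆ E₁ ∪ E₂ →
    (∀ {x} → x ∈ E₁ → x ∉ E₂) → r E ℕ.< r E₁ ℕ.+ r E₂

  Flat : Subset n → Set
  Flat E = ∀ s → s ∉ E → r E ℕ.< r (E ∪ ⁅ s ⁆)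

  -- Add the elements of `V` to `X` one at a time. `j` is the one whose arrival first makes `i`
  -- spanned, and `G` is what was present before it, so `i` and `j` are parallel modulo `G`.
  firstSpanning : ∀ {i} k X V → ∣ V ∣ ℕ.< k →
    ¬ r (X ∪ ⁅ i ⁆) ℕ.≤ r X → r ((X ∪ V) ∪ ⁅ i ⁆) ℕ.≤ r (X ∪ V) →
    ∃[ G ] ∃[ j ] X ⊆ G × j ∈ V × ¬ r (G ∪ ⁅ i ⁆) ℕ.≤ r G × r ((G ∪ ⁅ j ⁆) ∪ ⁅ i ⁆) ℕ.≤ r (G ∪ ⁅ j ⁆)
  firstSpanning {i} (suc k) X V lt free spanned with nonempty? V
  ... | no empty = contradiction (≡.subst (λ Z → r (Z ∪ ⁅ i ⁆) ℕ.≤ r Z)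
    (≡.trans (≡.cong (X ∪_) (Empty-unique empty)) (∪-identityʳ X)) spanned) free
  ... | yes (v , v∈V) with r ((X ∪ ⁅ v ⁆) ∪ ⁅ i ⁆) ℕₚ.≤? r (X ∪ ⁅ v ⁆)
  ...   | yes spanned′ = X , v , id , v∈V , free , spanned′
  ...   | no free′ = grow (firstSpanning k (X ∪ ⁅ v ⁆) (V ∖ v)
    (ℕₚ.<-≤-trans (x∈p⇒∣p-x∣<∣p∣ v∈V) (ℕ.s≤s⁻¹ lt)) free′
    (≡.subst (λ Z → r (Z ∪ ⁅ i ⁆) ℕ.≤ r Z) regroup spanned))
    where
    regroup : X ∪ V ≡ (X ∪ ⁅ v ⁆) ∪ (V ∖ v)
    regroup = ≡.trans (≡.cong (X ∪_) (≡.trans (≡.sym (p-x∪⁅x⁆ v∈V)) (∪-comm (V ∖ v) ⁅ v ⁆)))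
      (≡.sym (∪-assoc X ⁅ v ⁆ (V ∖ v)))
    grow : ∃[ G ] ∃[ j ] X ∪ ⁅ v ⁆ ⊆ G × j ∈ V ∖ v × ¬ r (G ∪ ⁅ i ⁆) ℕ.≤ r G × r ((G ∪ ⁅ j ⁆) ∪ ⁅ i ⁆) ℕ.≤ r (G ∪ ⁅ j ⁆) →
      ∃[ G ] ∃[ j ] X ⊆ G × j ∈ V × ¬ r (G ∪ ⁅ i ⁆) ℕ.≤ r G × r ((G ∪ ⁅ j ⁆) ∪ ⁅ i ⁆) ℕ.≤ r (G ∪ ⁅ j ⁆)
    grow (G , j , X⊆ , j∈ , fr , sp) = G , j , (λ x∈ → X⊆ (∈∪ˡ x∈)) , p─q⊆p V ⁅ v ⁆ j∈ , fr , sp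

  -- If the arrow ending at i met E in f, then i and the first j spanning it would separate f from e in E.
  rising⊆arrowsInto : ∀ {E e} → e ∈ E → Connected E → rising E e ⊆ arrowsInto π (∁ E)
  rising⊆arrowsInto {E} {e} e∈E connected {i} i∈ = ∈-filterˢ⁺ (λ i → ccwArrow π (π ⟨$⟩ʳ i) ⊆? ∁ E)
    λ {f} f∈ → x∉p⇒x∈∁p λ f∈E → impossible f∈E (∈-arrow⁻ π f∈)
      (firstSpanning (suc ∣ beyond i ∣) X (beyond i) ℕₚ.≤-refl i-free
        (spans-⊇ {beyond i} {X ∪ beyond i} {⁅ i ⁆} ∈∪ʳ (spanned i)))
    where
    X : Subset n
    X = E ∪ after e i
    i-free : Rises E e i
    i-free = ∈-filterˢ⁻ (rises? E e) i∈
    i∉E : i ∉ E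
    i∉E i∈E = i-free (rk-mono (∪-lub id (⁅⁆⊆ (∈∪ˡ i∈E))))
    module _ {f G j} (f∈E : f ∈ E) (f-arrow : InInterval (π ⟨$⟩ʳ i) i f) (X⊆G : X ⊆ G)
      (j∈beyond : j ∈ beyond i) (free : ¬ r (G ∪ ⁅ i ⁆) ℕ.≤ r G)
      (spanned : r ((G ∪ ⁅ j ⁆) ∪ ⁅ i ⁆) ℕ.≤ r (G ∪ ⁅ j ⁆)) where
      j∉G : j ∉ G
      j∉G j∈G = free (≡.subst (λ Z → r (Z ∪ ⁅ i ⁆) ℕ.≤ r Z) (p∪⁅x⁆≡p j∈G) spanned)
      j∉E : j ∉ E
      j∉E j∈E = j∉G (X⊆G (∈∪ˡ j∈E))
      j≢i : j ≢ i
      j≢i refl = x∉p-x {p = [ i ⋯ π ⟨$⟩ʳ i ]} j∈beyond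
      -- `G` contains every element after `i` in the order from `e`, and it does not contain `j`;
      -- hence `j` comes before `i`.
      eji : Cyclic e j i
      eji with ≺-total {e = e} (j≢i)
      ... | inj₁ (first refl _) = contradiction e∈E j∉E
      ... | inj₁ (later h)      = h
      ... | inj₂ i≺j = contradiction (X⊆G (∈∪ʳ (∈-filterˢ⁺ (λ x → i ≺[ e ]? x) i≺j))) j∉G
      -- Going round from `i`, the element `j` is met no later than the image of `i`, and `f` no
      -- earlier than that image. The two differ because `f` is in `E` and `j` is not.
      jfi : Cyclic j f i
      jfi = order (∈-interval⁻ i (π ⟨$⟩ʳ i) (p─q⊆p [ i ⋯ π ⟨$⟩ʳ i ] ⁅ i ⁆ j∈beyond)) f-arrow
        where
        order : InInterval i (π ⟨$⟩ʳ i) j → InInterval (π ⟨$⟩ʳ i) i f → Cyclic j f i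
        order (start j≡i) _          = contradiction j≡i j≢i
        order _           (end f≡i)  = contradiction (≡.subst (_∈ E) f≡i f∈E) i∉E
        order (end j≡π)   (start f≡π) = contradiction (≡.subst (_∈ E) (≡.trans f≡π (≡.sym j≡π)) f∈E) j∉E
        order (end j≡π)   (inner h)  = ≡.subst (λ x → Cyclic x f i) (≡.sym j≡π) h
        order (inner h)   (start f≡π) = ≡.subst (λ x → Cyclic j x i) (≡.sym f≡π) (rotate h)
        order (inner h)   (inner k)  = rotate (cyclic-trans h (rotate (rotate k)))
      E₁ E₂ : Subset n
      E₁ = E ∩ filterˢ (λ x → cyclic? j x i)
      E₂ = E ∩ filterˢ (λ x → cyclic? i x j)
      in₁ : ∀ {x} → x ∈ E₁ → Cyclic j x i
      in₁ x∈ = ∈-filterˢ⁻ (λ x → cyclic? j x i) (proj₂ (x∈p∩q⁻ E _ x∈))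
      in₂ : ∀ {x} → x ∈ E₂ → Cyclic i x j
      in₂ x∈ = ∈-filterˢ⁻ (λ x → cyclic? i x j) (proj₂ (x∈p∩q⁻ E _ x∈))
      disjoint : ∀ {x} → x ∈ E₁ → x ∉ E₂
      disjoint x∈₁ x∈₂ = cyclic-asym (in₁ x∈₁) (rotate (rotate (in₂ x∈₂)))
      cover : E ⊆ E₁ ∪ E₂
      cover {x} x∈E with cyclic-total {a = j} {x} {i} (λ { refl → j∉E x∈E }) (λ { refl → i∉E x∈E }) j≢i
      ... | inj₁ h = ∈∪ˡ (x∈p∩q⁺ (x∈E , ∈-filterˢ⁺ (λ x → cyclic? j x i) h))
      ... | inj₂ h = ∈∪ʳ (x∈p∩q⁺ (x∈E , ∈-filterˢ⁺ (λ x → cyclic? i x j) (rotate h)))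
      separated : Data.Empty.⊥
      separated = noncrossing {E} {E₁} {E₂} {G} {i} {j} (λ x∈ → X⊆G (∈∪ˡ x∈)) (p∩q⊆p E _) (p∩q⊆p E _)
        free spanned
        (λ {a} {c} a∈ c∈ → let jai = in₁ a∈ ; icj = in₂ c∈ in
          rotate (rotate (cyclic-trans icj (rotate (rotate jai)))) ,
          rotate (rotate (cyclic-trans jai (rotate (rotate icj)))))
        cover disjoint
        (connected E₁ E₂
          (f , x∈p∩q⁺ (f∈E , ∈-filterˢ⁺ (λ x → cyclic? j x i) jfi))
          (e , x∈p∩q⁺ (e∈E , ∈-filterˢ⁺ (λ x → cyclic? i x j) (rotate (rotate eji))))
          (p∩q⊆p E _) (p∩q⊆p E _) cover disjoint)
    impossible : ∀ {f} → f ∈ E → InInterval (π ⟨$⟩ʳ i) i f →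
      ¬ (∃[ G ] ∃[ j ] X ⊆ G × j ∈ beyond i × ¬ r (G ∪ ⁅ i ⁆) ℕ.≤ r G × r ((G ∪ ⁅ j ⁆) ∪ ⁅ i ⁆) ℕ.≤ r (G ∪ ⁅ j ⁆))
    impossible f∈E f-arrow (G , j , X⊆G , j∈ , free , spanned) = separated f∈E f-arrow X⊆G j∈ free spanned

  d≤rk+ccw : ∀ {E e} → e ∈ E → Connected E → d ℕ.≤ r E ℕ.+ ccw π (∁ E)
  d≤rk+ccw {E} {e} e∈E connected = begin
    d                                 ≡⟨ rk+∣rising∣ E e ⟨
    r E ℕ.+ ∣ rising E e ∣            ≤⟨ ℕₚ.+-monoʳ-≤ (r E) (p⊆q⇒∣p∣≤∣q∣ (rising⊆arrowsInto e∈E connected)) ⟩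
    r E ℕ.+ ∣ arrowsInto π (∁ E) ∣    ≡⟨ ≡.cong (r E ℕ.+_) (∣arrowsInto∣ π (∁ E)) ⟩
    r E ℕ.+ ccw π (∁ E)               ∎
    where open ℕₚ.≤-Reasoning

  -- If no arrow inside the complement contained `s`, moving `s` into `E` would destroy no arrow but
  -- raise the rank of a flat. The sum of rank and arrow count is already `d` for connected `E`, and
  -- it can never exceed `d`.
  connectedFlat⇒covered : ∀ {E e} → e ∈ E → Connected E → Flat E → CoveredByCCWArrows π (∁ E)
  connectedFlat⇒covered {E} {e} e∈E connected flat s s∈
    with Finₚ.any? (λ y → s ∈? ccwArrow π y ×-dec ccwArrow π y ⊆? ∁ E)
  ... | yes found = found
  ... | no none = contradiction (begin-strict
    d                                            ≤⟨ d≤rk+ccw e∈E connected ⟩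
    r E ℕ.+ ccw π (∁ E)                          ≤⟨ ℕₚ.+-monoʳ-≤ (r E) (p⊆q⇒∣p∣≤∣q∣ shrink) ⟩
    r E ℕ.+ ccw π (∁ (E ∪ ⁅ s ⁆))                <⟨ ℕₚ.+-monoˡ-< _ (flat s (x∈∁p⇒x∉p s∈)) ⟩
    r (E ∪ ⁅ s ⁆) ℕ.+ ccw π (∁ (E ∪ ⁅ s ⁆))      ≤⟨ rk+ccw≤d {e = e} (∈∪ˡ e∈E) ⟩
    d                                            ∎) (ℕₚ.<-irrefl refl)
    where
    open ℕₚ.≤-Reasoning
    avoids : ∀ {y} → ccwArrow π y ⊆ ∁ E → ccwArrow π y ⊆ ∁ (E ∪ ⁅ s ⁆)
    avoids {y} y⊆ x∈ = x∉p⇒x∈∁p (∪-elim (x∈∁p⇒x∉p (y⊆ x∈))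
      (λ x∈s → none (y , ≡.subst (_∈ ccwArrow π y) (x∈⁅y⁆⇒x≡y s x∈s) x∈ , y⊆)))
    shrink : filterˢ (λ y → ccwArrow π y ⊆? ∁ E) ⊆ filterˢ (λ y → ccwArrow π y ⊆? ∁ (E ∪ ⁅ s ⁆))
    shrink {y} y∈ = ∈-filterˢ⁺ (λ y → ccwArrow π y ⊆? ∁ (E ∪ ⁅ s ⁆))
      (avoids {y} (∈-filterˢ⁻ (λ y → ccwArrow π y ⊆? ∁ E) y∈))

-- Polyhedra over the ordered field

module Summation {c ℓ : Level} (R : RealField c ℓ) where
  open RealField R hiding (zero; refl; sym; trans)
  open RealField R using () renaming (refl to ≈-refl; sym to ≈-sym; trans to ≈-trans)
  open OrderedField R
  open RingProperties ring
  open CommutativeMonoidSum +-commutativeMonoid using (sum-cong-≋; ∑-distrib-+; sum-replicate-zero; ∑-comm) public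
  open SemiringSum semiring using (*-distribˡ-sum; *-distribʳ-sum) public
  open SetoidReasoning setoid

  0≤1 : 0# ≤ 1#
  0≤1 with total 0# 1#
  ... | inj₁ h = h
  ... | inj₂ h = ≤-resp ≈-refl (≈-trans (≈-sym (-‿distribˡ-* 1# (- 1#)))
      (≈-trans (-‿cong (*-identityˡ (- 1#))) (-‿involutive 1#))) (*-nonneg _ _ 0≤-1 0≤-1)
    where
    0≤-1 : 0# ≤ - 1#
    0≤-1 = ≤-resp -0#≈0# ≈-refl (neg-antimono h)

  1≰0 : ¬ 1# ≤ 0#
  1≰0 h = 1≉0 (≤-antisym h 0≤1)

  *-monoˡ : ∀ {t a b} → 0# ≤ t → a ≤ b → t * a ≤ t * b
  *-monoˡ {t} {a} {b} 0≤t a≤b = +-cancelʳ-≤ (- (t * a)) (≤-resp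
    (≈-sym (-‿inverseʳ (t * a)))
    (≈-trans (distribˡ t b (- a)) (+-congˡ (≈-sym (-‿distribʳ-* t a))))
    (*-nonneg _ _ 0≤t (≤-resp (-‿inverseʳ a) ≈-refl (+-mono-≤ a b (- a) a≤b))))

  *-monoʳ : ∀ {t a b} → 0# ≤ t → a ≤ b → a * t ≤ b * t
  *-monoʳ 0≤t a≤b = ≤-resp (*-comm _ _) (*-comm _ _) (*-monoˡ 0≤t a≤b)

  fromℕ-+ : ∀ m k → fromℕ (m ℕ.+ k) ≈ fromℕ m + fromℕ k
  fromℕ-+ zero    k = ≈-sym (+-identityˡ _)
  fromℕ-+ (suc m) k = ≈-trans (+-congˡ (fromℕ-+ m k)) (≈-sym (+-assoc 1# _ _))

  0≤fromℕ : ∀ m → 0# ≤ fromℕ m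
  0≤fromℕ zero    = ≤-refl
  0≤fromℕ (suc m) = +-nonneg 0≤1 (0≤fromℕ m)

  fromℕ-mono : ∀ {m k} → m ℕ.≤ k → fromℕ m ≤ fromℕ k
  fromℕ-mono {k = k} ℕ.z≤n = 0≤fromℕ k
  fromℕ-mono (ℕ.s≤s m≤k) = +-mono ≤-refl (fromℕ-mono m≤k)

  fromℕ-reflects-≤ : ∀ {m k} → fromℕ m ≤ fromℕ k → m ℕ.≤ k
  fromℕ-reflects-≤ {m} {k} h with m ℕₚ.≤? k
  ... | yes m≤k = m≤k
  ... | no m≰k  = contradiction
    (+-cancelʳ-≤ (fromℕ k) (≤-trans (fromℕ-mono (ℕₚ.≰⇒> m≰k)) (≤-resp ≈-refl (≈-sym (+-identityˡ _)) h))) 1≰0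

  sum-mono : ∀ {n} {v w : Vector Carrier n} → (∀ i → v i ≤ w i) → sum v ≤ sum w
  sum-mono {zero}  h = ≤-refl
  sum-mono {suc n} h = +-mono (h zero) (sum-mono (h ∘ suc))

  -- The summand of `sumOver`, named for termwise comparison. `indicator R E` unfolds to `mask E` of
  -- the constant `1#`.
  mask : ∀ {n} → Subset n → Vector Carrier n → Vector Carrier n
  mask E x l = if does (l ∈? E) then x l else 0#

  mask-∈ : ∀ {n} {E : Subset n} (x : Vector Carrier n) {l} → l ∈ E → mask E x l ≈ x l
  mask-∈ {E = E} x {l} l∈E rewrite dec-true (l ∈? E) l∈E = ≈-refl

  mask-∉ : ∀ {n} {E : Subset n} (x : Vector Carrier n) {l} → l ∉ E → mask E x l ≈ 0#
  mask-∉ {E = E} x {l} l∉E rewrite dec-false (l ∈? E) l∉E = ≈-refl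

  mask-cong : ∀ {n} (E : Subset n) {x y : Vector Carrier n} → (∀ l → l ∈ E → x l ≈ y l) → ∀ l → mask E x l ≈ mask E y l
  mask-cong E h l with l ∈? E
  ... | yes l∈ = h l l∈
  ... | no _   = ≈-refl

  sumOver-cong : ∀ {n} (E : Subset n) {x y : Vector Carrier n} → (∀ l → x l ≈ y l) → sumOver R E x ≈ sumOver R E y
  sumOver-cong E h = sum-cong-≋ (mask-cong E (λ l _ → h l))

  sumOver-linear : ∀ {n} (E : Subset n) (x : Vector Carrier n) t (v : Vector Carrier n) →
    sumOver R E (λ l → x l + t * v l) ≈ sumOver R E x + t * sumOver R E v
  sumOver-linear E x t v = begin
    sum (mask E (λ l → x l + t * v l))          ≈⟨ sum-cong-≋ split ⟩
    sum (λ l → mask E x l + t * mask E v l)     ≈⟨ ∑-distrib-+ (mask E x) (λ l → t * mask E v l) ⟩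
    sum (mask E x) + sum (λ l → t * mask E v l) ≈⟨ +-congˡ (*-distribˡ-sum t (mask E v)) ⟨
    sum (mask E x) + t * sum (mask E v)         ∎
    where
    split : ∀ l → mask E (λ l → x l + t * v l) l ≈ mask E x l + t * mask E v l
    split l with l ∈? E
    ... | yes _ = ≈-refl
    ... | no _  = ≈-sym (≈-trans (+-identityˡ _) (zeroʳ t))

  sumOver-modular : ∀ {n} (S T : Subset n) x →
    sumOver R (S ∪ T) x + sumOver R (S ∩ T) x ≈ sumOver R S x + sumOver R T x
  sumOver-modular S T x = ≈-trans (≈-sym (∑-distrib-+ (mask (S ∪ T) x) (mask (S ∩ T) x)))
    (≈-trans (sum-cong-≋ split) (∑-distrib-+ (mask S x) (mask T x)))
    where
    split : ∀ l → mask (S ∪ T) x l + mask (S ∩ T) x l ≈ mask S x l + mask T x l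
    split l = go (l ∈? S) (l ∈? T)
      where
      go : Dec (l ∈ S) → Dec (l ∈ T) → mask (S ∪ T) x l + mask (S ∩ T) x l ≈ mask S x l + mask T x l
      go (yes p) (yes q) = ≈-trans (+-cong (mask-∈ x (∈∪ˡ p)) (mask-∈ x (x∈p∩q⁺ (p , q))))
        (≈-sym (+-cong (mask-∈ x p) (mask-∈ x q)))
      go (yes p) (no q)  = ≈-trans (+-cong (mask-∈ x (∈∪ˡ p)) (mask-∉ x (q ∘ p∩q⊆q S T)))
        (≈-sym (+-cong (mask-∈ x p) (mask-∉ x q)))
      go (no p) (yes q)  = ≈-trans (+-cong (mask-∈ x (∈∪ʳ {p = S} q)) (mask-∉ x (p ∘ p∩q⊆p S T)))
        (≈-trans (+-comm _ _) (≈-sym (+-cong (mask-∉ x p) (mask-∈ x q))))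
      go (no p) (no q)   = ≈-trans (+-cong (mask-∉ x (∪-elim p q)) (mask-∉ x (p ∘ p∩q⊆p S T)))
        (≈-sym (+-cong (mask-∉ x p) (mask-∉ x q)))

  0≤mask : ∀ {n} (E : Subset n) {x} → (∀ i → 0# ≤ x i) → ∀ l → 0# ≤ mask E x l
  0≤mask E 0≤x l with l ∈? E
  ... | yes _ = 0≤x l
  ... | no  _ = ≤-refl

  sumOver-mono : ∀ {n} {S T : Subset n} {x} → (∀ i → 0# ≤ x i) → S ⊆ T → sumOver R S x ≤ sumOver R T x
  sumOver-mono {S = S} {T} {x} 0≤x S⊆T = sum-mono split
    where
    split : ∀ l → mask S x l ≤ mask T x l
    split l = go (l ∈? S)
      where
      go : Dec (l ∈ S) → mask S x l ≤ mask T x l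
      go (yes p) = ≤-reflexive (≈-trans (mask-∈ x p) (≈-sym (mask-∈ x (S⊆T p))))
      go (no p)  = ≤-resp (≈-sym (mask-∉ x p)) ≈-refl (0≤mask T 0≤x l)

  sum-0 : ∀ {n} {v : Vector Carrier n} → (∀ i → v i ≈ 0#) → sum v ≈ 0#
  sum-0 {n} h = ≈-trans (sum-cong-≋ h) (sum-replicate-zero n)

  sumOver-1 : ∀ {n} (E : Subset n) → sumOver R E (λ _ → 1#) ≈ fromℕ ∣ E ∣
  sumOver-1 []            = ≈-refl
  sumOver-1 (outside ∷ E) = ≈-trans (+-identityˡ _) (sumOver-1 E)
  sumOver-1 (inside ∷ E)  = +-congˡ (sumOver-1 E)

  sumOver-indicator : ∀ {n} (E I : Subset n) → sumOver R E (indicator R I) ≈ fromℕ ∣ E ∩ I ∣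
  sumOver-indicator E I = ≈-trans (sum-cong-≋ split) (sumOver-1 (E ∩ I))
    where
    split : ∀ l → mask E (indicator R I) l ≈ mask (E ∩ I) (λ _ → 1#) l
    split l = go (l ∈? E) (l ∈? I)
      where
      go : Dec (l ∈ E) → Dec (l ∈ I) → mask E (indicator R I) l ≈ mask (E ∩ I) (λ _ → 1#) l
      go (yes p) (yes q) = ≈-trans (mask-∈ (indicator R I) p) (≈-trans (mask-∈ (λ _ → 1#) q)
        (≈-sym (mask-∈ (λ _ → 1#) (x∈p∩q⁺ (p , q)))))
      go (yes p) (no q)  = ≈-trans (mask-∈ (indicator R I) p) (≈-trans (mask-∉ (λ _ → 1#) q)
        (≈-sym (mask-∉ (λ _ → 1#) (q ∘ p∩q⊆q E I))))
      go (no p) _        = ≈-trans (mask-∉ (indicator R I) p) (≈-sym (mask-∉ (λ _ → 1#) (p ∘ p∩q⊆p E I)))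

  indicator-∈ : ∀ {n} {E : Subset n} {l} → l ∈ E → indicator R E l ≈ 1#
  indicator-∈ = mask-∈ (λ _ → 1#)

  indicator-∉ : ∀ {n} {E : Subset n} {l} → l ∉ E → indicator R E l ≈ 0#
  indicator-∉ = mask-∉ (λ _ → 1#)

  sumOver-⁅⁆ : ∀ {n} (i : Fin n) x → sumOver R ⁅ i ⁆ x ≈ x i
  sumOver-⁅⁆ {suc n} zero x = ≈-trans (+-congˡ (sum-0 (λ l → mask-∉ (x ∘ suc) (∉⊥ {x = l})))) (+-identityʳ _)
  sumOver-⁅⁆ {suc n} (suc i) x = ≈-trans (+-identityˡ _) (sumOver-⁅⁆ i (x ∘ suc))

  sumOver-unit : ∀ {n} (E : Subset n) i → sumOver R E (indicator R ⁅ i ⁆) ≈ indicator R E i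
  sumOver-unit E i = ≈-trans (sum-cong-≋ split) (sumOver-⁅⁆ i (indicator R E))
    where
    split : ∀ l → mask E (indicator R ⁅ i ⁆) l ≈ mask ⁅ i ⁆ (indicator R E) l
    split l with l ∈? E | l ∈? ⁅ i ⁆
    ... | yes _ | yes _ = ≈-refl
    ... | yes _ | no _  = ≈-refl
    ... | no _  | yes _ = ≈-refl
    ... | no _  | no _  = ≈-refl

module _ {a p q : Level} {A : Set a} {P : Pred A p} {Q : Pred A q} (P? : Decidable P) (Q? : Decidable Q)
  (P⊆Q : ∀ {x} → P x → Q x) where

  length-filter-mono : ∀ xs → List.length (List.filter P? xs) ℕ.≤ List.length (List.filter Q? xs)
  length-filter-mono List.[] = ℕ.z≤n
  length-filter-mono (x List.∷ xs) with P? x | Q? x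
  ... | yes _ | yes _ = ℕ.s≤s (length-filter-mono xs)
  ... | yes p | no ¬q = contradiction (P⊆Q p) ¬q
  ... | no _  | yes _ = ℕₚ.m≤n⇒m≤1+n (length-filter-mono xs)
  ... | no _  | no _  = length-filter-mono xs

  length-filter-< : ∀ {x xs} → x ∈ˡ xs → Q x → ¬ P x →
    List.length (List.filter P? xs) ℕ.< List.length (List.filter Q? xs)
  length-filter-< {xs = x List.∷ xs} (Any.here refl) q ¬p with P? x | Q? x
  ... | yes p | _     = contradiction p ¬p
  ... | no _  | yes _ = ℕ.s≤s (length-filter-mono xs)
  ... | no _  | no ¬q = contradiction q ¬q
  length-filter-< {xs = y List.∷ xs} (Any.there x∈) q ¬p with P? y | Q? y
  ... | yes _ | yes _ = ℕ.s≤s (length-filter-< x∈ q ¬p)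
  ... | yes p | no ¬q = contradiction (P⊆Q p) ¬q
  ... | no _  | yes _ = ℕₚ.m≤n⇒m≤1+n (length-filter-< x∈ q ¬p)
  ... | no _  | no _  = length-filter-< x∈ q ¬p

-- Moving inside a polyhedron until more constraints are tight

module LinearSystem {c ℓ : Level} (R : RealField c ℓ) where
  open RealField R hiding (zero; refl; sym; trans)
  open RealField R using () renaming (refl to ≈-refl; sym to ≈-sym; trans to ≈-trans)
  open OrderedField R
  open Summation R
  open RingProperties ring
  open SetoidReasoning setoid

  module Polyhedron {n : ℕ} {C : Set} (constraints : List.List C) (all∈ : ∀ k → k ∈ˡ constraints)
    (lhs : C → Vector Carrier n → Carrier) (rhs : C → Carrier)
    (lhs-linear : ∀ k x t v → lhs k (λ l → x l + t * v l) ≈ lhs k x + t * lhs k v)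
    (lhs-neg : ∀ k v → lhs k (λ l → - v l) ≈ - lhs k v) where

    Feasible : Pred (Vector Carrier n) ℓ
    Feasible x = ∀ k → lhs k x ≤ rhs k

    Tight : Vector Carrier n → Pred C ℓ
    Tight x k = lhs k x ≈ rhs k

    slack? : ∀ x → Decidable (λ k → ¬ Tight x k)
    slack? x k = ¬? (lhs k x ≟ rhs k)

    #slack : Vector Carrier n → ℕ
    #slack x = List.length (List.filter (slack? x) constraints)

    Tangent : Vector Carrier n → Pred (Vector Carrier n) ℓ
    Tangent x v = ∀ k → Tight x k → lhs k v ≈ 0#

    -- A ray in direction `v` cannot stay feasible forever: some left-hand side grows along it.
    Bounded : Pred (Vector Carrier n) ℓ
    Bounded v = ∃[ k ] ¬ lhs k v ≤ 0#

    -- Made total by sending zero to zero, so that `ratio` can be formed for every constraint before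
    -- it is known whether the constraint bounds the ray.
    inv : Carrier → Carrier
    inv a with a ≟ 0#
    ... | yes _  = 0#
    ... | no a≉0 = proj₁ (inverse a a≉0)

    *-inv : ∀ {a} → ¬ a ≈ 0# → a * inv a ≈ 1#
    *-inv {a} a≉0 with a ≟ 0#
    ... | yes a≈0 = contradiction a≈0 a≉0
    ... | no a≉0  = proj₂ (inverse a a≉0)

    0≤inv : ∀ {a} → 0# ≤ a → 0# ≤ inv a
    0≤inv {a} 0≤a with a ≟ 0#
    ... | yes _  = ≤-refl
    ... | no a≉0 with inverse a a≉0
    ...   | b , ab≈1 with total 0# b
    ...     | inj₁ 0≤b = 0≤b
    ...     | inj₂ b≤0 = contradiction (≤-resp ab≈1 (zeroʳ a) (*-monoˡ 0≤a b≤0)) 1≰0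

    ≰0⇒≉0 : ∀ {a} → ¬ a ≤ 0# → ¬ a ≈ 0#
    ≰0⇒≉0 a≰0 a≈0 = a≰0 (≤-reflexive a≈0)

    ≰0⇒0≤ : ∀ {a} → ¬ a ≤ 0# → 0# ≤ a
    ≰0⇒0≤ {a} a≰0 = [ id , (λ a≤0 → contradiction a≤0 a≰0) ]′ (total 0# a)

    module Ray {x v : Vector Carrier n} (feasible : Feasible x) (tangent : Tangent x v)
      (k₀ : C) (k₀-bounds : ¬ lhs k₀ v ≤ 0#) where

      bounds? : Decidable (λ k → ¬ lhs k v ≤ 0#)
      bounds? k = ¬? (lhs k v ≤? 0#)

      -- The step length along `v` at which constraint `k` becomes tight. Choosing the least one
      -- among the bounding constraints is the ratio test of the simplex method.
      ratio : C → Carrier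
      ratio k = (rhs k + - lhs k x) * inv (lhs k v)

      ratio-* : ∀ {k} → ¬ lhs k v ≤ 0# → ratio k * lhs k v ≈ rhs k + - lhs k x
      ratio-* {k} k-bounds = ≈-trans (*-assoc _ _ _) (≈-trans
        (*-congˡ (≈-trans (*-comm _ _) (*-inv (≰0⇒≉0 k-bounds)))) (*-identityʳ _))

      totalOrder : TotalOrder c ℓ ℓ
      totalOrder = record { isTotalOrder = IsDecTotalOrder.isTotalOrder isDecTotalOrder }

      open Extrema totalOrder using (argmin; argmin-sel; f[argmin]≤f[xs])

      candidates : List.List C
      candidates = List.filter bounds? constraints

      k₁ : C
      -- The starting value `k₀` bounds the ray itself, so the minimum is attained at a bounding
      -- constraint in every case.
      k₁ = argmin ratio k₀ candidates

      t : Carrier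
      t = ratio k₁

      k₁-bounds : ¬ lhs k₁ v ≤ 0#
      k₁-bounds with argmin-sel ratio k₀ candidates
      ... | inj₁ e  = ≡.subst (λ k → ¬ lhs k v ≤ 0#) (≡.sym e) k₀-bounds
      ... | inj₂ k∈ = proj₂ (∈-filter⁻ bounds? {xs = constraints} k∈)

      t≤ : ∀ {k} → ¬ lhs k v ≤ 0# → t ≤ ratio k
      t≤ {k} k-bounds = All.lookup (f[argmin]≤f[xs] k₀ candidates) (∈-filter⁺ bounds? (all∈ k) k-bounds)

      0≤t : 0# ≤ t
      0≤t = *-nonneg _ _ (≤-resp (-‿inverseʳ _) ≈-refl (+-mono-≤ _ _ (- lhs k₁ x) (feasible k₁)))
        (0≤inv (≰0⇒0≤ k₁-bounds))

      y : Vector Carrier n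
      y l = x l + t * v l

      fill : ∀ {k s} → s ≈ rhs k + - lhs k x → lhs k x + s ≈ rhs k
      fill {k} {s} e = begin
        lhs k x + s                      ≈⟨ +-congˡ e ⟩
        lhs k x + (rhs k + - lhs k x)    ≈⟨ +-congˡ (+-comm _ _) ⟩
        lhs k x + (- lhs k x + rhs k)    ≈⟨ +-assoc _ _ _ ⟨
        (lhs k x + - lhs k x) + rhs k    ≈⟨ +-congʳ (-‿inverseʳ _) ⟩
        0# + rhs k                       ≈⟨ +-identityˡ _ ⟩
        rhs k                            ∎

      y-feasible : Feasible y
      y-feasible k with lhs k v ≤? 0#
      ... | yes ≤0 = ≤-trans (≤-reflexive (lhs-linear k x t v))
        (≤-trans (≤-resp ≈-refl (+-identityʳ _) (+-mono ≤-refl (≤-resp ≈-refl (zeroʳ t) (*-monoˡ 0≤t ≤0)))) (feasible k))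
      ... | no ≰0 = ≤-trans (≤-reflexive (lhs-linear k x t v))
        (≤-resp ≈-refl (fill (ratio-* ≰0)) (+-mono ≤-refl (*-monoʳ (≰0⇒0≤ ≰0) (t≤ ≰0))))

      y-tight : ∀ {k} → Tight x k → Tight y k
      y-tight {k} tight = ≈-trans (lhs-linear k x t v) (≈-trans (+-congˡ (≈-trans (*-congˡ (tangent k tight)) (zeroʳ t)))
        (≈-trans (+-identityʳ _) tight))

      y-tight-k₁ : Tight y k₁
      y-tight-k₁ = ≈-trans (lhs-linear k₁ x t v) (fill (ratio-* k₁-bounds))

      -- Tangency keeps the tight constraints tight. It also shows that `k₁` was slack at `x`,
      -- because its left-hand side changes along `v`; at `y` it is tight.
      #slack-y< : #slack y ℕ.< #slack x
      #slack-y< = length-filter-< (slack? y) (slack? x) (λ ¬tight tight → ¬tight (y-tight tight))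
        (all∈ k₁) (λ tight → ≰0⇒≉0 k₁-bounds (tangent k₁ tight)) (λ ¬tight → ¬tight y-tight-k₁)

    module _ {p : Level} {Φ : Pred (Vector Carrier n) p}
      (convex : ∀ {x y z α β} → 0# ≤ α → 0# ≤ β → α + β ≈ 1# → Φ y → Φ z →
                (∀ l → x l ≈ α * y l + β * z l) → Φ x)
      (vertexOrDirection : ∀ x → Feasible x → Φ x ⊎
        (Σ[ v ∈ Vector Carrier n ] Tangent x v × Bounded v × Bounded (λ l → - v l))) where

      -- The weights of the two points are `s` and `t`, each divided by `t + s`. This needs a
      -- nonzero sum, hence the separate case of `t` zero, where the first point is `x` itself.
      between : ∀ {x v : Vector Carrier n} {t s} → 0# ≤ t → 0# ≤ s →
        Φ (λ l → x l + t * v l) → Φ (λ l → x l + s * - v l) → Φ x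
      between {x} {v} {t} {s} 0≤t 0≤s Φy Φz with t ≟ 0#
      ... | yes t≈0 = convex {x} {λ l → x l + t * v l} {λ l → x l + s * - v l} 0≤1 ≤-refl (+-identityʳ 1#) Φy Φz λ l → ≈-sym (begin
        1# * (x l + t * v l) + 0# * (x l + s * - v l)   ≈⟨ +-cong (*-identityˡ _) (zeroˡ _) ⟩
        (x l + t * v l) + 0#                            ≈⟨ +-identityʳ _ ⟩
        x l + t * v l                                   ≈⟨ +-congˡ (≈-trans (*-congʳ t≈0) (zeroˡ _)) ⟩
        x l + 0#                                        ≈⟨ +-identityʳ _ ⟩
        x l                                             ∎)
      ... | no t≉0 = convex {x} {λ l → x l + t * v l} {λ l → x l + s * - v l} (*-nonneg _ _ 0≤s (0≤inv 0≤t+s)) (*-nonneg _ _ 0≤t (0≤inv 0≤t+s))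
        (≈-trans (≈-sym (distribʳ w s t)) (≈-trans (*-congʳ (+-comm s t)) unit)) Φy Φz λ l → ≈-sym (begin
        s * w * (x l + t * v l) + t * w * (x l + s * - v l)
          ≈⟨ +-cong (distribˡ _ _ _) (distribˡ _ _ _) ⟩
        (s * w * x l + s * w * (t * v l)) + (t * w * x l + t * w * (s * - v l))
          ≈⟨ +-congˡ (+-congˡ (cancel s t w (v l))) ⟩
        (s * w * x l + s * w * (t * v l)) + (t * w * x l + - (s * w * (t * v l)))
          ≈⟨ +-cong (+-comm _ _) (+-comm _ _) ⟩
        (s * w * (t * v l) + s * w * x l) + (- (s * w * (t * v l)) + t * w * x l)
          ≈⟨ middle _ _ _ _ ⟩
        (s * w * (t * v l) + - (s * w * (t * v l))) + (s * w * x l + t * w * x l)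
          ≈⟨ +-cong (-‿inverseʳ _) (≈-sym (distribʳ _ _ _)) ⟩
        0# + (s * w + t * w) * x l
          ≈⟨ +-identityˡ _ ⟩
        (s * w + t * w) * x l
          ≈⟨ *-congʳ (≈-trans (≈-sym (distribʳ w s t)) (≈-trans (*-congʳ (+-comm s t)) unit)) ⟩
        1# * x l
          ≈⟨ *-identityˡ _ ⟩
        x l ∎)
        where
        w = inv (t + s)
        0≤t+s : 0# ≤ t + s
        0≤t+s = +-nonneg 0≤t 0≤s
        unit : (t + s) * w ≈ 1#
        unit = *-inv (λ e → t≉0 (nonneg-sum≈0 0≤t 0≤s e))
        cancel : ∀ s t w v → t * w * (s * - v) ≈ - (s * w * (t * v))
        cancel s t w v = begin
          t * w * (s * - v)     ≈⟨ *-congˡ (-‿distribʳ-* s v) ⟨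
          t * w * - (s * v)     ≈⟨ -‿distribʳ-* (t * w) (s * v) ⟨
          - (t * w * (s * v))   ≈⟨ -‿cong (*-congʳ (*-comm t w)) ⟩
          - (w * t * (s * v))   ≈⟨ -‿cong (*-assoc w t _) ⟩
          - (w * (t * (s * v))) ≈⟨ -‿cong (*-congˡ (≈-trans (≈-sym (*-assoc t s v)) (≈-trans (*-congʳ (*-comm t s)) (*-assoc s t v)))) ⟩
          - (w * (s * (t * v))) ≈⟨ -‿cong (*-assoc w s _) ⟨
          - (w * s * (t * v))   ≈⟨ -‿cong (*-congʳ (*-comm w s)) ⟩
          - (s * w * (t * v))   ∎
        middle : ∀ a b c d → (a + b) + (c + d) ≈ (a + c) + (b + d)
        middle a b c d = ≈-trans (+-assoc a b _) (≈-trans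
          (+-congˡ (≈-trans (≈-sym (+-assoc b c d)) (≈-trans (+-congʳ (+-comm b c)) (+-assoc c b d))))
          (≈-sym (+-assoc a c _)))

      -- Follow the direction and its opposite to where they leave the polyhedron. Both exits have
      -- fewer slack constraints, and `x` lies on the segment joining them.
      polyhedron-induction : ∀ k x → #slack x ℕ.< k → Feasible x → Φ x
      polyhedron-induction (suc k) x lt feasible with vertexOrDirection x feasible
      ... | inj₁ Φx = Φx
      ... | inj₂ (v , tangent , (k₊ , b₊) , (k₋ , b₋)) = between {x} {v} {P.t} {N.t} P.0≤t N.0≤t
        (polyhedron-induction k P.y (ℕₚ.<-≤-trans P.#slack-y< (ℕ.s≤s⁻¹ lt)) P.y-feasible)
        (polyhedron-induction k N.y (ℕₚ.<-≤-trans N.#slack-y< (ℕ.s≤s⁻¹ lt)) N.y-feasible)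
        where
        module P = Ray {x} {v} feasible tangent k₊ b₊
        module N = Ray {x} {λ l → - v l} feasible
          (λ k tight → ≈-trans (lhs-neg k v) (≈-trans (-‿cong (tangent k tight)) -0#≈0#)) k₋ b₋

module Convex {c ℓ : Level} (R : RealField c ℓ) where
  open RealField R hiding (zero; refl; sym; trans)
  open RealField R using () renaming (refl to ≈-refl; sym to ≈-sym; trans to ≈-trans)
  open OrderedField R
  open Summation R

  append : ∀ {a} {A : Set a} {m k} → Vector A m → Vector A k → Vector A (m ℕ.+ k)
  append {m = zero}  f g = g
  append {m = suc m} f g = f zero ◂ append (f ∘ suc) g

  append-all : ∀ {a p} {A : Set a} {P : Pred A p} {m k} (f : Vector A m) (g : Vector A k) →
    (∀ i → P (f i)) → (∀ i → P (g i)) → ∀ i → P (append f g i)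
  append-all {m = zero}  f g pf pg i       = pg i
  append-all {m = suc m} f g pf pg zero    = pf zero
  append-all {P = P} {m = suc m} f g pf pg (suc i) = append-all {P = P} (f ∘ suc) g (pf ∘ suc) pg i

  sum-append : ∀ {a} {A : Set a} (h : A → Carrier) {m k} (f : Vector A m) (g : Vector A k) →
    sum (h ∘ append f g) ≈ sum (h ∘ f) + sum (h ∘ g)
  sum-append h {zero}  f g = ≈-sym (+-identityˡ _)
  sum-append h {suc m} f g = ≈-trans (+-congˡ (sum-append h (f ∘ suc) g)) (≈-sym (+-assoc _ _ _))

  Conv-convex : ∀ {n p} {X : Pred (Vector Carrier n) p} {x y z α β} → 0# ≤ α → 0# ≤ β → α + β ≈ 1# →
    Conv R X y → Conv R X z → (∀ l → x l ≈ α * y l + β * z l) → Conv R X x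
  Conv-convex {n} {X = X} {x} {y} {z} {α} {β} 0≤α 0≤β α+β≈1
    (m , w , v , w≥0 , w-sum , Xv , y≈) (m′ , w′ , v′ , w′≥0 , w′-sum , Xv′ , z≈) x≈ =
    m ℕ.+ m′ , proj₁ ∘ terms , proj₂ ∘ terms ,
    append-all {P = λ (a , _) → 0# ≤ a} f g (λ k → *-nonneg _ _ 0≤α (w≥0 k)) (λ k → *-nonneg _ _ 0≤β (w′≥0 k)) ,
    ≈-trans (sum-append proj₁ f g) (≈-trans (+-cong
      (≈-trans (≈-sym (*-distribˡ-sum α w)) (≈-trans (*-congˡ w-sum) (*-identityʳ α)))
      (≈-trans (≈-sym (*-distribˡ-sum β w′)) (≈-trans (*-congˡ w′-sum) (*-identityʳ β)))) α+β≈1) ,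
    append-all {P = λ (_ , u) → X u} f g Xv Xv′ ,
    λ l → ≈-trans (x≈ l) (≈-sym (≈-trans (sum-append (λ (a , u) → a * u l) f g)
      (+-cong (scale α w v l (y≈ l)) (scale β w′ v′ l (z≈ l)))))
    where
    -- Weights and points are concatenated as pairs, which keeps them aligned under a single
    -- `append`.
    f : Vector (Carrier × Vector Carrier n) m
    f k = α * w k , v k
    g : Vector (Carrier × Vector Carrier n) m′
    g k = β * w′ k , v′ k
    terms = append f g
    scale : ∀ {m} α (w : Vector Carrier m) (v : Fin m → Vector Carrier n) l {a} → a ≈ sum (λ k → w k * v k l) →
      sum (λ k → (α * w k) * v k l) ≈ α * a
    scale α w v l e = ≈-trans (sum-cong-≋ (λ k → *-assoc α (w k) (v k l)))
      (≈-trans (≈-sym (*-distribˡ-sum α (λ k → w k * v k l))) (*-congˡ (≈-sym e)))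

  Conv-point : ∀ {n p} {X : Pred (Vector Carrier n) p} {x} → X x → Conv R X x
  Conv-point {x = x} Xx = 1 , (λ _ → 1#) , (λ _ → x) , (λ _ → 0≤1) , +-identityʳ 1# , (λ _ → Xx) ,
    λ i → ≈-sym (≈-trans (+-identityʳ _) (*-identityˡ (x i)))

minimalSubset : ∀ {n p} {P : Pred (Subset n) p} → Decidable P → ∃ P →
  ∃[ T ] P T × (∀ {U} → P U → ∣ T ∣ ℕ.≤ ∣ U ∣)
minimalSubset {n} {P = P} P? (T₀ , PT₀) = go (suc ∣ T₀ ∣) T₀ PT₀ ℕₚ.≤-refl
  where
  go : ∀ k T → P T → ∣ T ∣ ℕ.< k → ∃[ T ] P T × (∀ {U} → P U → ∣ T ∣ ℕ.≤ ∣ U ∣)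
  go (suc k) T PT lt with anySubset? (λ U → P? U ×-dec ∣ U ∣ ℕₚ.<? ∣ T ∣)
  ... | yes (U , PU , U<T) = go k U PU (ℕₚ.<-≤-trans U<T (ℕ.s≤s⁻¹ lt))
  ... | no none = T , PT , λ PU → ℕₚ.≮⇒≥ (λ U<T → none (_ , PU , U<T))

-- Edmonds' theorem for the independent set polytope

module Edmonds {c ℓ : Level} (R : RealField c ℓ) {n : ℕ} (M : Matroid n) {d : ℕ}
  (basis-size : ∀ {B} → Matroid.Basis M B → ∣ B ∣ ≡ d) where
  open RealField R hiding (zero; refl; sym; trans)
  open RealField R using () renaming (refl to ≈-refl; sym to ≈-sym; trans to ≈-trans)
  open OrderedField R
  open Summation R
  open Convex R
  open RingProperties ring
  open Matroid M
  open Rank M basis-size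

  Constraint : Set
  Constraint = Subset n ⊎ Fin n

  constraints : List.List Constraint
  constraints = List.map inj₁ (subsets n) List.++ List.map inj₂ (List.allFin n)

  ∈-constraints : ∀ k → k ∈ˡ constraints
  ∈-constraints (inj₁ E) = ∈-++⁺ˡ (∈-map⁺ inj₁ (∈-subsets E))
  ∈-constraints (inj₂ i) = ∈-++⁺ʳ _ (∈-map⁺ inj₂ (∈-allFin i))

  lhs : Constraint → Vector Carrier n → Carrier
  lhs (inj₁ E) x = sumOver R E x
  lhs (inj₂ i) x = - x i

  rhs : Constraint → Carrier
  rhs (inj₁ E) = fromℕ (r E)
  rhs (inj₂ i) = 0#

  lhs-linear : ∀ k x t v → lhs k (λ l → x l + t * v l) ≈ lhs k x + t * lhs k v
  lhs-linear (inj₁ E) x t v = sumOver-linear E x t v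
  lhs-linear (inj₂ i) x t v = ≈-trans (≈-sym (-‿+-comm _ _)) (+-congˡ (-‿distribʳ-* t (v i)))

  lhs-neg : ∀ k v → lhs k (λ l → - v l) ≈ - lhs k v
  lhs-neg (inj₁ E) v = ≈-trans (sumOver-cong E (λ l → ≈-sym (≈-trans (+-identityˡ _) (-1*x≈-x (v l)))))
    (≈-trans (sumOver-linear E (λ _ → 0#) (- 1#) v) (≈-trans (+-cong (sum-0 masked0) (-1*x≈-x _)) (+-identityˡ _)))
    where
    masked0 : ∀ l → mask E (λ _ → 0#) l ≈ 0#
    masked0 l with l ∈? E
    ... | yes _ = ≈-refl
    ... | no  _ = ≈-refl
  lhs-neg (inj₂ i) v = ≈-refl

  open LinearSystem R
  open Polyhedron constraints ∈-constraints lhs rhs lhs-linear lhs-neg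

  Vertex : Pred (Vector Carrier n) ℓ
  Vertex p = ∃[ I ] Independent I × (∀ i → p i ≈ indicator R I i)

  polytope : Pred (Vector Carrier n) (c ⊔ ℓ)
  polytope = IndependentSetPolytope R M

  module Point (x : Vector Carrier n) (feasible : Feasible x) where

    0≤x : ∀ i → 0# ≤ x i
    0≤x i = ≤-resp -0#≈0# (-‿involutive (x i)) (neg-antimono (feasible (inj₂ i)))

    x≤1 : ∀ i → x i ≤ 1#
    x≤1 i = ≤-resp (sumOver-⁅⁆ i x) (+-identityʳ 1#)
      (≤-trans (feasible (inj₁ ⁅ i ⁆)) (fromℕ-mono (rk-⁅⁆ i)))

    TightSet : Pred (Subset n) ℓ
    TightSet E = sumOver R E x ≈ fromℕ (r E)

    Fractional : Pred (Fin n) ℓ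
    Fractional i = ¬ x i ≈ 0# × ¬ x i ≈ 1#

    fractional? : Decidable Fractional
    fractional? i = ¬? (x i ≟ 0#) ×-dec ¬? (x i ≟ 1#)

    ones : Subset n
    ones = filterˢ (λ i → x i ≟ 1#)

    -- A feasible point with all entries zero or one is the indicator of `ones`, and the rank
    -- inequality of this very set says that its size is at most its rank.
    integral⇒polytope : (∀ i → ¬ Fractional i) → polytope x
    integral⇒polytope integral = Conv-point {X = Vertex} (ones , rk≥∣∣⇒independent size , x≈)
      where
      x≈ : ∀ i → x i ≈ indicator R ones i
      x≈ i with x i ≟ 1# | x i ≟ 0#
      ... | yes e | _     = ≈-trans e (≈-sym (indicator-∈ (∈-filterˢ⁺ (λ i → x i ≟ 1#) e)))
      ... | no ne | yes e = ≈-trans e (≈-sym (indicator-∉ (λ i∈ → ne (∈-filterˢ⁻ (λ i → x i ≟ 1#) i∈))))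
      ... | no ne | no ne′ = contradiction (ne′ , ne) (integral i)
      size : ∣ ones ∣ ℕ.≤ r ones
      size = fromℕ-reflects-≤ (≤-resp
        (≈-trans (sumOver-cong ones x≈) (≈-trans (sumOver-indicator ones ones)
          (reflexive (≡.cong (λ Z → fromℕ ∣ Z ∣) (∩-idem ones)))))
        ≈-refl (feasible (inj₁ ones)))

    -- Uncrossing: the entries over `S ∪ T` and over `S ∩ T` together sum to `r S` plus `r T`. By
    -- submodularity this leaves no gap in the rank inequality of either set.
    tight-∩ : ∀ {S T} → TightSet S → TightSet T → TightSet (S ∩ T)
    tight-∩ {S} {T} tS tT = ≤-antisym (feasible (inj₁ (S ∩ T)))
      (+-cancelʳ-≤ (fromℕ (r (S ∪ T))) (≤-resp (≈-trans (fromℕ-+ (r (S ∪ T)) _) (+-comm _ _)) (+-comm _ _)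
        (≤-trans (fromℕ-mono (rk-submodular S T)) (≤-trans (≤-reflexive
          (≈-trans (fromℕ-+ (r S) (r T)) (≈-trans (≈-sym (+-cong tS tT)) (≈-sym (sumOver-modular S T x)))))
          (+-mono (feasible (inj₁ (S ∪ T))) ≤-refl)))))

    -- A single fractional entry would make the integer x(T) lie strictly between consecutive integers.
    otherFractional : ∀ {T i} → TightSet T → i ∈ T → Fractional i → ∃[ j ] j ∈ T × j ≢ i × Fractional j
    otherFractional {T} {i} tight i∈T (≉0 , ≉1)
      with Finₚ.any? (λ j → j ∈? T ×-dec ¬? (j Finₚ.≟ i) ×-dec fractional? j)
    ... | yes found = found
    ... | no none   = contradiction total≈ (λ e → noninteger (ℕₚ.≤-<-connex (r T) ∣ U ∣) e)
      where
      -- The entries of `T` equal to one, apart from `i`. If no second entry is fractional, the sum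
      -- over `T` is `∣ U ∣` plus `x i`.
      U : Subset n
      U = T ∩ (ones ∖ i)
      U⇒1 : ∀ {l} → l ∈ U → x l ≈ 1#
      U⇒1 l∈U = ∈-filterˢ⁻ (λ i → x i ≟ 1#) (p─q⊆p ones ⁅ i ⁆ (proj₂ (x∈p∩q⁻ T (ones ∖ i) l∈U)))
      split : ∀ l → mask T x l ≈ mask U (λ _ → 1#) l + mask ⁅ i ⁆ x l
      split l = go (l ∈? T) (l Finₚ.≟ i) (x l ≟ 1#) (x l ≟ 0#)
        where
        l∉⁅i⁆ : l ≢ i → l ∉ ⁅ i ⁆
        l∉⁅i⁆ = x≢y⇒x∉⁅y⁆
        go : Dec (l ∈ T) → Dec (l ≡ i) → Dec (x l ≈ 1#) → Dec (x l ≈ 0#) →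
             mask T x l ≈ mask U (λ _ → 1#) l + mask ⁅ i ⁆ x l
        go (no l∉T) _ _ _ = ≈-trans (mask-∉ x l∉T) (≈-sym (≈-trans (+-cong
          (mask-∉ (λ _ → 1#) (λ l∈ → l∉T (p∩q⊆p T (ones ∖ i) l∈)))
          (mask-∉ x (λ l∈ → l∉T (⁅⁆⊆ i∈T l∈)))) (+-identityˡ _)))
        go (yes l∈T) (yes refl) _ _ = ≈-trans (mask-∈ x l∈T) (≈-sym (≈-trans (+-cong
          (mask-∉ (λ _ → 1#) (λ l∈ → x∉p-x {p = ones} (p∩q⊆q T (ones ∖ i) l∈)))
          (mask-∈ x (x∈⁅x⁆ i))) (+-identityˡ _)))
        go (yes l∈T) (no l≢i) (yes ≈1) _ = ≈-trans (mask-∈ x l∈T) (≈-trans ≈1 (≈-sym (≈-trans (+-cong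
          (mask-∈ (λ _ → 1#) (x∈p∩q⁺ (l∈T , x∈p∧x≢y⇒x∈p-y (∈-filterˢ⁺ (λ i → x i ≟ 1#) ≈1) l≢i)))
          (mask-∉ x (l∉⁅i⁆ l≢i))) (+-identityʳ _))))
        go (yes l∈T) (no l≢i) (no ≉1) (yes ≈0) = ≈-trans (mask-∈ x l∈T) (≈-trans ≈0 (≈-sym (≈-trans (+-cong
          (mask-∉ (λ _ → 1#) (λ l∈ → ≉1 (U⇒1 l∈))) (mask-∉ x (l∉⁅i⁆ l≢i))) (+-identityˡ _))))
        go (yes l∈T) (no l≢i) (no ≉1) (no ≉0) = contradiction (l , l∈T , l≢i , ≉0 , ≉1) none
      total≈ : fromℕ (r T) ≈ fromℕ ∣ U ∣ + x i
      total≈ = ≈-trans (≈-sym tight) (≈-trans (sum-cong-≋ split) (≈-trans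
        (∑-distrib-+ (mask U (λ _ → 1#)) (mask ⁅ i ⁆ x)) (+-cong (sumOver-1 U) (sumOver-⁅⁆ i x))))
      noninteger : r T ℕ.≤ ∣ U ∣ ⊎ ∣ U ∣ ℕ.< r T → ¬ fromℕ (r T) ≈ fromℕ ∣ U ∣ + x i
      noninteger (inj₁ le) e = ≉0 (≤-antisym (+-cancelʳ-≤ (fromℕ ∣ U ∣)
        (≤-resp (≈-trans e (+-comm _ _)) (≈-sym (+-identityˡ _)) (fromℕ-mono le))) (0≤x i))
      noninteger (inj₂ lt) e = ≉1 (≤-antisym (x≤1 i) (+-cancelʳ-≤ (fromℕ ∣ U ∣)
        (≤-resp ≈-refl (≈-trans e (+-comm _ _)) (fromℕ-mono lt))))

    Direction : Set (c ⊔ ℓ)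
    Direction = Σ[ v ∈ Vector Carrier n ] Tangent x v × Bounded v × Bounded (λ l → - v l)

    -- The entry one at `i` takes care of both bounds: along `v` the rank inequality of the
    -- singleton of `i` is eventually violated, and along the opposite direction the nonnegativity
    -- of the entry at `i`.
    direction : ∀ v i → v i ≈ 1# → (∀ l → x l ≈ 0# → v l ≈ 0#) → (∀ E → TightSet E → sumOver R E v ≈ 0#) → Direction
    direction v i vi≈1 zeros tights = v , tangent ,
      (inj₁ ⁅ i ⁆ , λ le → 1≰0 (≤-resp (≈-trans (sumOver-⁅⁆ i v) vi≈1) ≈-refl le)) ,
      (inj₂ i , λ le → 1≰0 (≤-resp (≈-trans (-‿involutive (v i)) vi≈1) ≈-refl le))
      where
      tangent : Tangent x v
      tangent (inj₁ E) tight = tights E tight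
      tangent (inj₂ l) tight = ≈-trans (-‿cong (zeros l
        (≈-trans (≈-sym (-‿involutive (x l))) (≈-trans (-‿cong tight) -0#≈0#)))) -0#≈0#

    ≉0⇒unit≈0 : ∀ {i} → ¬ x i ≈ 0# → ∀ l → x l ≈ 0# → indicator R ⁅ i ⁆ l ≈ 0#
    ≉0⇒unit≈0 {i} ≉0 l ≈0 = indicator-∉ λ l∈ → ≉0 (≡.subst (λ j → x j ≈ 0#) (x∈⁅y⁆⇒x≡y i l∈) ≈0)

    MeetsFractional : Pred (Subset n) ℓ
    MeetsFractional T = TightSet T × (∃[ i ] i ∈ T × Fractional i)

    meetsFractional? : Decidable MeetsFractional
    meetsFractional? T = (sumOver R T x ≟ fromℕ (r T)) ×-dec Finₚ.any? (λ i → i ∈? T ×-dec fractional? i)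

    freeDirection : ∀ i → Fractional i → (∀ T → ¬ MeetsFractional T) → Direction
    freeDirection i frac none = direction (indicator R ⁅ i ⁆) i (indicator-∈ (x∈⁅x⁆ i)) (≉0⇒unit≈0 (proj₁ frac))
      λ E tight → ≈-trans (sumOver-unit E i) (indicator-∉ λ i∈E → none E (tight , i , i∈E , frac))

    -- By minimality of T every tight set contains both of i and j or neither.
    exchangeDirection : ∀ {T} → TightSet T → (∀ {U} → MeetsFractional U → ∣ T ∣ ℕ.≤ ∣ U ∣) →
      ∀ {i j} → i ∈ T → Fractional i → j ∈ T → j ≢ i → Fractional j → Direction
    exchangeDirection {T} tightT minimal {i} {j} i∈T fi j∈T j≢i fj = direction v i vi≈1 zeros tights
      where
      v : Vector Carrier n
      v l = indicator R ⁅ i ⁆ l + - 1# * indicator R ⁅ j ⁆ l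
      0-0 : ∀ {a b} → a ≈ 0# → b ≈ 0# → a + - 1# * b ≈ 0#
      0-0 a≈0 b≈0 = ≈-trans (+-cong a≈0 (≈-trans (*-congˡ b≈0) (zeroʳ _))) (+-identityˡ _)
      1-1 : ∀ {a b} → a ≈ 1# → b ≈ 1# → a + - 1# * b ≈ 0#
      1-1 a≈1 b≈1 = ≈-trans (+-cong a≈1 (≈-trans (*-congˡ b≈1) (*-identityʳ _))) (-‿inverseʳ 1#)
      vi≈1 : v i ≈ 1#
      vi≈1 = ≈-trans (+-cong (indicator-∈ (x∈⁅x⁆ i)) (≈-trans
        (*-congˡ (indicator-∉ (x≢y⇒x∉⁅y⁆ (λ i≡j → j≢i (≡.sym i≡j))))) (zeroʳ _))) (+-identityʳ _)
      zeros : ∀ l → x l ≈ 0# → v l ≈ 0#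
      zeros l ≈0 = 0-0 (≉0⇒unit≈0 (proj₁ fi) l ≈0) (≉0⇒unit≈0 (proj₁ fj) l ≈0)
      together : ∀ {E} → TightSet E → ∀ {k l} → k ∈ T → Fractional k → l ∈ T → k ∈ E → l ∈ E
      together {E} tight k∈T fk l∈T k∈E = p∩q⊆p E T (⊆∧∣∣≥⇒⊇ (p∩q⊆q E T)
        (minimal (tight-∩ tight tightT , _ , x∈p∩q⁺ (k∈E , k∈T) , fk)) l∈T)
      tights : ∀ E → TightSet E → sumOver R E v ≈ 0#
      tights E tight = ≈-trans (sumOver-linear E (indicator R ⁅ i ⁆) (- 1#) (indicator R ⁅ j ⁆))
        (≈-trans (+-cong (sumOver-unit E i) (*-congˡ (sumOver-unit E j))) (cases (i ∈? E)))
        where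
        cases : Dec (i ∈ E) → indicator R E i + - 1# * indicator R E j ≈ 0#
        cases (yes i∈E) = 1-1 (indicator-∈ i∈E) (indicator-∈ (together {E} tight i∈T fi j∈T i∈E))
        cases (no i∉E)  = 0-0 (indicator-∉ i∉E) (indicator-∉ (λ j∈E → i∉E (together {E} tight j∈T fj i∈T j∈E)))

    tightDirection : (∃[ T ] MeetsFractional T × (∀ {U} → MeetsFractional U → ∣ T ∣ ℕ.≤ ∣ U ∣)) → Direction
    tightDirection (T , (tight , i , i∈T , fi) , minimal) with otherFractional {T} tight i∈T fi
    ... | j , j∈T , j≢i , fj = exchangeDirection {T} tight minimal i∈T fi j∈T j≢i fj

    vertexOrDirection : polytope x ⊎ Direction
    vertexOrDirection = cases (Finₚ.any? fractional?) (anySubset? meetsFractional?)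
      where
      cases : Dec (∃ Fractional) → Dec (∃ MeetsFractional) → polytope x ⊎ Direction
      cases (no none) _              = inj₁ (integral⇒polytope (λ i fi → none (i , fi)))
      cases (yes (i , fi)) (no none) = inj₂ (freeDirection i fi (λ T mT → none (T , mT)))
      cases (yes _) (yes some)       = inj₂ (tightDirection (minimalSubset meetsFractional? some))

  edmonds : ∀ x → (∀ i → 0# ≤ x i) → (∀ E → sumOver R E x ≤ fromℕ (r E)) → polytope x
  edmonds x 0≤x rankBound = polyhedron-induction {Φ = polytope} (Conv-convex {X = Vertex}) Point.vertexOrDirection (suc (#slack x)) x ℕₚ.≤-refl feasible
    where
    feasible : Feasible x
    feasible (inj₁ E) = rankBound E
    feasible (inj₂ i) = ≤-resp ≈-refl -0#≈0# (neg-antimono (0≤x i))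

-- The polytope and the CCW inequalities

module Main {c ℓ : Level} (R : RealField c ℓ) {n d : ℕ} (M : Matroid n)
  (basis-size : ∀ {B} → Matroid.Basis M B → ∣ B ∣ ≡ d) (noncrossingExchange : NoncrossingExchange M)
  (loopless : ∀ i → ¬ Matroid.Loop M i) (π : Permutation′ n) (decorated : IsDecoratedPermutation M π) where
  open RealField R hiding (zero; refl; sym; trans)
  open RealField R using () renaming (refl to ≈-refl; sym to ≈-sym; trans to ≈-trans)
  open OrderedField R
  open Summation R
  open Matroid M
  open Rank M basis-size
  open Arrows M basis-size loopless π decorated
  open RankFormula M basis-size noncrossingExchange loopless π decorated
  open Edmonds R M basis-size using (Vertex; polytope; edmonds)

  CCWInequalities : Vector Carrier n → Set ℓ
  CCWInequalities x = ∀ E → Nonempty E → CoveredByCCWArrows π (∁ E) →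
    sumOver R E x ≤ fromℕ d - fromℕ (ccw π (∁ E))

  ≤-minus : ∀ {a b c} → a + b ≤ c → a ≤ c - b
  ≤-minus {a} {b} {c} h = ≤-resp (≈-trans (+-assoc a b (- b)) (≈-trans (+-congˡ (-‿inverseʳ b)) (+-identityʳ a)))
    ≈-refl (+-mono-≤ _ _ (- b) h)

  minus-≤ : ∀ {a b c} → c ≤ a + b → c - b ≤ a
  minus-≤ {a} {b} {c} h = ≤-resp ≈-refl (≈-trans (+-assoc a b (- b)) (≈-trans (+-congˡ (-‿inverseʳ b)) (+-identityʳ a)))
    (+-mono-≤ _ _ (- b) h)

  sumOver-combination : ∀ {m} (E : Subset n) (w : Vector Carrier m) (v : Fin m → Vector Carrier n) →
    sumOver R E (λ l → sum (λ k → w k * v k l)) ≈ sum (λ k → w k * sumOver R E (v k))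
  sumOver-combination E w v = ≈-trans (sum-cong-≋ inside-sum) (≈-trans
    (∑-comm (λ l k → w k * mask E (v k) l)) (sum-cong-≋ (λ k → ≈-sym (*-distribˡ-sum (w k) (mask E (v k))))))
    where
    inside-sum : ∀ l → mask E (λ l → sum (λ k → w k * v k l)) l ≈ sum (λ k → w k * mask E (v k) l)
    inside-sum l with l ∈? E
    ... | yes _ = ≈-refl
    ... | no _  = ≈-sym (sum-0 (λ k → zeroʳ (w k)))

  vertex-nonneg : ∀ {p} → Vertex p → ∀ i → 0# ≤ p i
  vertex-nonneg (I , _ , p≈) i = ≤-resp ≈-refl (≈-sym (p≈ i)) (0≤mask I (λ _ → 0≤1) i)

  -- An independent set meets `E` in at most `r E` elements, and `rk+ccw≤d` bounds that rank.
  vertex-ccw : ∀ {p} → Vertex p → ∀ E → Nonempty E → sumOver R E p ≤ fromℕ d - fromℕ (ccw π (∁ E))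
  vertex-ccw (I , ind , p≈) E (e , e∈E) = ≤-minus (≤-trans
    (≤-resp (≈-trans (fromℕ-+ ∣ E ∩ I ∣ (ccw π (∁ E))) (+-congʳ (≈-trans (≈-sym (sumOver-indicator E I)) (≈-sym (sumOver-cong E p≈)))))
      ≈-refl (fromℕ-mono {m = ∣ E ∩ I ∣ ℕ.+ ccw π (∁ E)} {k = r E ℕ.+ ccw π (∁ E)} (ℕₚ.+-monoˡ-≤ (ccw π (∁ E)) (rk-upper (independent-⊆ (p∩q⊆q E I) ind) (p∩q⊆p E I)))))
    (fromℕ-mono (rk+ccw≤d e∈E)))

  polytope⇒inequalities : ∀ x → polytope x → (∀ i → 0# ≤ x i) × CCWInequalities x
  polytope⇒inequalities x (m , w , v , w≥0 , w-sum , vertex , x≈) =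
    (λ i → ≤-resp ≈-refl (≈-sym (x≈ i)) (≤-resp (sum-0 {v = λ (_ : Fin m) → 0#} (λ _ → ≈-refl)) ≈-refl
      (sum-mono (λ k → *-nonneg _ _ (w≥0 k) (vertex-nonneg (vertex k) i))))) ,
    λ E ne _ → let b = fromℕ d - fromℕ (ccw π (∁ E)) in
      ≤-resp (≈-sym (≈-trans (sumOver-cong E x≈) (sumOver-combination E w v)))
        (≈-trans (≈-sym (*-distribʳ-sum b w)) (≈-trans (*-congʳ w-sum) (*-identityˡ b)))
        (sum-mono (λ k → *-monoˡ (w≥0 k) (vertex-ccw (vertex k) E ne)))

  -- A witness against `Connected`. Taking the second part as the complement of `P` in `E` reduces
  -- it to a single subset, so that an exhaustive search decides whether one exists.
  Separation : Subset n → Subset n → Set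
  Separation E P = Nonempty P × P ⊆ E × Nonempty (E ∩ ∁ P) × r P ℕ.+ r (E ∩ ∁ P) ℕ.≤ r E

  separation? : ∀ E P → Dec (Separation E P)
  separation? E P = nonempty? P ×-dec P ⊆? E ×-dec nonempty? (E ∩ ∁ P) ×-dec (r P ℕ.+ r (E ∩ ∁ P)) ℕₚ.≤? r E

  inseparable⇒connected : ∀ {E} → (∀ P → ¬ Separation E P) → Connected E
  inseparable⇒connected {E} insep E₁ E₂ ne₁ (e , e∈E₂) E₁⊆ E₂⊆ cover disjoint = ℕₚ.<-≤-trans
    (ℕₚ.≰⇒> λ le → insep E₁ (ne₁ , E₁⊆ ,
      (e , x∈p∩q⁺ (E₂⊆ e∈E₂ , x∉p⇒x∈∁p (λ e∈E₁ → disjoint e∈E₁ e∈E₂))) , le))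
    (ℕₚ.+-monoʳ-≤ (r E₁) (rk-mono λ x∈ → let x∈E , x∉E₁ = x∈p∩q⁻ E (∁ E₁) x∈ in
      ∪-elim (λ x∈E₁ → contradiction x∈E₁ (x∈∁p⇒x∉p x∉E₁)) id (cover x∈E)))

  0<rk : ∀ {S} → Nonempty S → 0 ℕ.< r S
  0<rk (x , x∈S) = ℕₚ.<-≤-trans (ℕₚ.≰⇒> (rk-⁅⁆≰0 x)) (rk-mono (⁅⁆⊆ x∈S))

  module _ {x : Vector Carrier n} (0≤x : ∀ i → 0# ≤ x i) (ccwInequalities : CCWInequalities x) where

    RankBound : Subset n → Set ℓ
    RankBound E = sumOver R E x ≤ fromℕ (r E)

    rankBound-connectedFlat : ∀ {E e} → e ∈ E → Connected E → Flat E → RankBound E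
    rankBound-connectedFlat {E} {e} e∈E connected flat = ≤-trans
      (ccwInequalities E (e , e∈E) (connectedFlat⇒covered e∈E connected flat))
      (minus-≤ (≤-resp ≈-refl (fromℕ-+ (r E) (ccw π (∁ E))) (fromℕ-mono (d≤rk+ccw e∈E connected))))

    rankBound-split : ∀ {E P} → P ⊆ E → r P ℕ.+ r (E ∩ ∁ P) ℕ.≤ r E → RankBound P → RankBound (E ∩ ∁ P) → RankBound E
    rankBound-split {E} {P} P⊆E le bP bQ = ≤-trans (sumOver-mono 0≤x cover) (≤-trans
      (≤-resp (+-identityʳ _) ≈-refl (+-mono ≤-refl 0≤meet))
      (≤-trans (≤-reflexive (sumOver-modular P (E ∩ ∁ P) x)) (≤-trans (+-mono bP bQ)
        (≤-trans (≤-reflexive (≈-sym (fromℕ-+ (r P) (r (E ∩ ∁ P))))) (fromℕ-mono le)))))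
      where
      0≤meet : 0# ≤ sumOver R (P ∩ (E ∩ ∁ P)) x
      0≤meet = ≤-resp (sum-0 {v = λ (_ : Fin n) → 0#} (λ _ → ≈-refl)) ≈-refl (sum-mono (0≤mask (P ∩ (E ∩ ∁ P)) 0≤x))
      cover : E ⊆ P ∪ (E ∩ ∁ P)
      cover {y} y∈E = go (y ∈? P)
        where
        go : Dec (y ∈ P) → y ∈ P ∪ (E ∩ ∁ P)
        go (yes y∈P) = ∈∪ˡ y∈P
        go (no y∉P)  = ∈∪ʳ (x∈p∩q⁺ (y∈E , x∉p⇒x∈∁p y∉P))

    -- Passing to a larger set of the same rank and splitting along separations ends at connected flats.
    rankBound : ∀ k E → r E ℕ.< k → RankBound E
    rankBound (suc k) E₀ rk<k₀ = enlarge (suc ∣ ∁ E₀ ∣) E₀ rk<k₀ ℕₚ.≤-refl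
      where
      -- The induction is nested: enlarging at constant rank shrinks the complement, while a
      -- separation lowers the rank of both parts, since in a loopless matroid each nonempty part
      -- has positive rank.
      enlarge : ∀ l E → r E ℕ.< suc k → ∣ ∁ E ∣ ℕ.< l → RankBound E
      enlarge (suc l) E rk<k ∣∁∣<l = cases (nonempty? E)
        (Finₚ.any? (λ s → ¬? (s ∈? E) ×-dec r (E ∪ ⁅ s ⁆) ℕₚ.≤? r E)) (anySubset? (separation? E))
        where
        cases : Dec (Nonempty E) → Dec (∃[ s ] s ∉ E × r (E ∪ ⁅ s ⁆) ℕ.≤ r E) → Dec (∃ (Separation E)) → RankBound E
        cases (no empty) _ _ = ≤-trans (≤-reflexive (sum-0 (λ y → mask-∉ x (λ y∈E → empty (y , y∈E))))) (0≤fromℕ (r E))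
        cases (yes _) (yes (s , s∉E , le)) _ = ≤-trans (sumOver-mono {S = E} {E ∪ ⁅ s ⁆} 0≤x ∈∪ˡ) (≤-trans
          (enlarge l (E ∪ ⁅ s ⁆) (ℕₚ.≤-<-trans le rk<k) (ℕₚ.<-≤-trans (p⊂q⇒∣p∣<∣q∣
            {p = ∁ (E ∪ ⁅ s ⁆)} {∁ E} (p⊂q⇒∁p⊃∁q {p = E} {E ∪ ⁅ s ⁆} (∈∪ˡ , s , ∈∪ʳ (x∈⁅x⁆ s) , s∉E))) (ℕ.s≤s⁻¹ ∣∁∣<l)))
          (fromℕ-mono le))
        cases (yes _) (no _) (yes (P , neP , P⊆E , neQ , le)) = rankBound-split {E} {P} P⊆E le
          (rankBound k P (ℕₚ.<-≤-trans (ℕₚ.<-≤-trans (ℕₚ.m<m+n (r P) (0<rk neQ)) le) (ℕ.s≤s⁻¹ rk<k)))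
          (rankBound k (E ∩ ∁ P)
            (ℕₚ.<-≤-trans (ℕₚ.<-≤-trans (ℕₚ.m<n+m (r (E ∩ ∁ P)) (0<rk neP)) le) (ℕ.s≤s⁻¹ rk<k)))
        cases (yes (e , e∈E)) (no closed) (no insep) = rankBound-connectedFlat e∈E
          (inseparable⇒connected (λ P sep → insep (P , sep)))
          (λ s s∉E → ℕₚ.≰⇒> (λ le → closed (s , s∉E , le)))

    inequalities⇒polytope : polytope x
    inequalities⇒polytope = edmonds x 0≤x (λ E → rankBound (suc (r E)) E ℕₚ.≤-refl)

theorem5p2 : ∀ {c ℓ : Level} (R : RealField c ℓ) → let open RealField R in
    (n d : ℕ) (M : Matroid n) → IsPositroid R d M →
    (∀ i → ¬ Matroid.Loop M i) → (∀ i → ¬ Matroid.Coloop M i) →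
    (π : Permutation′ n) → IsDecoratedPermutation M π →
    (x : Vector Carrier n) →
    IndependentSetPolytope R M x
    ⇔ ((∀ i → 0# ≤ x i) ×
    (∀ (E : Subset n) → Nonempty E → CoveredByCCWArrows π (∁ E) →
    sumOver R E x ≤ fromℕ d - fromℕ (ccw π (∁ E))))
theorem5p2 R n d M P loopless _ π decorated x =
  mk⇔ (polytope⇒inequalities x) (λ (0≤x , ineqs) → inequalities⇒polytope 0≤x ineqs)
  where
  open Main R M (Positroid.basis-size R P) (positroid⇒noncrossingExchange R P) loopless π decorated
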